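{- Let $m \le 153$ be a positive integer and let $C$ be an extremal binary doubly even self-dual $[24m,12m,4m+4]$ code. Let $D$ be the support design of the minimum weight $4m+4$ of $C$. If $D$ is a $t$-design for some $t \geq 6$, then $D$ is a $7$-design and $$m \in \{15,52,55,57,59,60,63,90,93,104,105,107,118,125,127,135,143,151\};$$ moreover, $D$ is never an $8$-design.
   Context: A binary linear code $C \subseteq \mathbb{F}_2^{n}$ is self-dual if $C = C^{\perp}$ with respect to the standard inner product, and doubly even if every codeword has Hamming weight divisible by $4$. A binary doubly even self-dual $[24m,12m,4m+4]$ code has length $24m$, dimension $12m$ and minimum weight $4m+4$; it is called extremal. The support of a codeword $c=(c_1,\dots,c_n)$ is $\mathrm{supp}(c)=\{i : c_i \neq 0\}$. The support design of $C$ for weight $w$ has as points the $n$ coordinate indices and as blocks the supports of all codewords of weight $w$. A $t$-$(v,k,\lambda)$ design is a pair $(X,\mathcal{B})$ where $|X|=v$ and $\mathcal{B}$ is a collection of $k$-subsets of $X$ (blocks) such that every $t$-subset of $X$ is contained in exactly $\lambda$ blocks; a $t$-design means a $t$-$(v,k,\lambda)$ design for some $\lambda$. -}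

module Defs where

open import Data.Bool using (Bool; true; false; _∧_; _xor_; if_then_else_)
open import Data.Nat using (ℕ; zero; suc; _+_; _*_; _^_; _≤_)
open import Data.Nat.Divisibility using (_∣_)
open import Data.Vec using (Vec; []; _∷_; zipWith; replicate)
open import Data.List using (List; []; _∷_; map; _++_; length; filter)
open import Data.Product using (Σ; _×_; ∃)
open import Relation.Binary.PropositionalEquality using (_≡_)
open import Relation.Nullary using (¬_)
open import Function.Bundles using (_⇔_)

-- Words of F₂ⁿ, with true = 1.
Word : ℕ → Set
Word n = Vec Bool n

zeroWord : (n : ℕ) → Word n
zeroWord n = replicate n false

_⊕_ : ∀ {n} → Word n → Word n → Word n
_⊕_ = zipWith _xor_

dot : ∀ {n} → Word n → Word n → Bool
dot [] [] = false
dot (a ∷ u) (b ∷ v) = (a ∧ b) xor dot u v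

wt : ∀ {n} → Word n → ℕ
wt [] = 0
wt (true ∷ v) = suc (wt v)
wt (false ∷ v) = wt v

_⊆ᵇ_ : ∀ {n} → Word n → Word n → Bool
[] ⊆ᵇ [] = true
(true ∷ t) ⊆ᵇ (b ∷ v) = b ∧ (t ⊆ᵇ v)
(false ∷ t) ⊆ᵇ (b ∷ v) = t ⊆ᵇ v

allWords : (n : ℕ) → List (Word n)
allWords zero = [] ∷ []
allWords (suc n) = map (false ∷_) (allWords n) ++ map (true ∷_) (allWords n)

countᵇ : ∀ {A : Set} → (A → Bool) → List A → ℕ
countᵇ p [] = 0
countᵇ p (x ∷ xs) = if p x then suc (countᵇ p xs) else countᵇ p xs

-- A binary code of length n, given by its (decidable) characteristic function.
Code : ℕ → Set
Code n = Word n → Bool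

_∈C_ : ∀ {n} → Word n → Code n → Set
v ∈C C = C v ≡ true

IsLinear : ∀ {n} → Code n → Set
IsLinear {n} C = (zeroWord n ∈C C) × (∀ u v → u ∈C C → v ∈C C → (u ⊕ v) ∈C C)

IsSelfDual : ∀ {n} → Code n → Set
IsSelfDual {n} C = ∀ (v : Word n) → (v ∈C C) ⇔ (∀ u → u ∈C C → dot u v ≡ false)

IsDoublyEven : ∀ {n} → Code n → Set
IsDoublyEven C = ∀ v → v ∈C C → 4 ∣ wt v

HasDimension : ∀ {n} → Code n → ℕ → Set
HasDimension {n} C k = countᵇ C (allWords n) ≡ 2 ^ k

HasMinWeight : ∀ {n} → Code n → ℕ → Set
HasMinWeight {n} C d =
  (∀ v → v ∈C C → ¬ (v ≡ zeroWord n) → d ≤ wt v) × (Σ (Word n) λ v → (v ∈C C) × (wt v ≡ d))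

IsExtremal : (m : ℕ) → Code (24 * m) → Set
IsExtremal m C =
  IsLinear C × IsSelfDual C × IsDoublyEven C ×
  HasDimension C (12 * m) × HasMinWeight C (4 * m + 4)

_==ℕ_ : ℕ → ℕ → Bool
zero ==ℕ zero = true
zero ==ℕ suc _ = false
suc _ ==ℕ zero = false
suc a ==ℕ suc b = a ==ℕ b

-- number of blocks of the support design of weight w of C containing supp T
-- (blocks = supports of codewords of weight w; distinct binary codewords have
--  distinct supports, so counting codewords counts blocks)
blocksThrough : ∀ {n} → Code n → ℕ → Word n → ℕ
blocksThrough {n} C w T = countᵇ (λ v → C v ∧ ((wt v ==ℕ w) ∧ (T ⊆ᵇ v))) (allWords n)

IsTDesign : ∀ {n} → Code n → (w t : ℕ) → Set
IsTDesign {n} C w t =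
  (t ≤ w) × ∃ λ lam → ∀ (T : Word n) → wt T ≡ t → blocksThrough C w T ≡ lam

{-# OPTIONS --safe #-}
module Submission where

{-
Poisson summation over the self-dual code C turns a function with small Fourier support into a linear
relation between numbers of codewords through a point set T. The functions used here have transform
u ↦ (−1)^|T∩u| [y^(r − |u∖T|)] h(y); for a suitable series h they vanish at every codeword through T
whose weight is not d = 4m+4, 24m − d or 24m, and their values there are residues computed with the
MacWilliams substitution s = (1 − y)/(1 + y). For |T| = 5 this yields
λ₅ = 4 C(5m−1, m−1) − C(5m−2, 4m−2); for |T| = 7 it shows that a 6-design is a 7-design.

Integrality of λ₆, λ₇ and λ₈ eliminates most m. The others are eliminated 2-adically: a block B meets a
codeword W in an even number of points, so Σ_B Π_{e<s} (|B∩W| − 2e) is divisible by 2^s s!, whereas in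
an s-design this sum is determined by |W| and the λ_j. The argument needs some |W| ≡ 4 mod 8, which
exists because a self-dual code without words of weight 2 cannot have all weights divisible by 8.
-}

open import Defs
open import Algebra.Bundles using (CommutativeRing)
import Algebra.Properties.CommutativeSemiring.Exp as Exp
import Algebra.Solver.Ring as RingSolver
open import Algebra.Solver.Ring.AlmostCommutativeRing using (fromCommutativeRing; _-Raw-AlmostCommutative⟶_)
open import Data.Bool using (Bool; true; false; _∧_; _∨_; _xor_; not; if_then_else_)
open import Data.Bool.Properties using (∧-assoc; not-involutive; T-≡)
open import Data.Empty using (⊥; ⊥-elim)
open import Data.Integer as ℤ using (ℤ; +_; -[1+_]; 0ℤ; 1ℤ)
import Data.Integer.Properties as ℤₚ
open import Data.Integer.Solver using (module +-*-Solver)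
open import Data.List using (List; []; _∷_; map; _++_)
open import Data.List.Membership.Propositional using (_∈_)
open import Data.Maybe using (Maybe; just; nothing)
open import Data.Nat as ℕ using (ℕ; zero; suc; _≤_; _*_; _+_; _!)
open import Data.List.Membership.DecPropositional ℕ._≟_ using (_∈?_)
open import Data.Nat.Combinatorics using (nCk+nC[k+1]≡[n+1]C[k+1]; nCn≡1; k>n⇒nCk≡0) renaming (_C_ to _choose_)
open import Data.Nat.DivMod using (m*n/n≡m; m*n%n≡0)
open import Data.Nat.Divisibility using (_∣_; divides; ∣m∣n⇒∣m+n; ∣m+n∣m⇒∣n; ∣-trans; *-cancelˡ-∣)
import Data.Nat.Properties as ℕₚ
import Data.Nat.Solver as ℕSolver
open import Data.Product using (Σ; ∃; _×_; _,_; proj₁; proj₂)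
open import Data.Sum using (_⊎_; inj₁; inj₂; [_,_]′)
open import Data.Vec using ([]; _∷_; zipWith; replicate)
open import Function using (_∘_; id)
open import Function.Bundles using (Equivalence)
open import Level using (0ℓ)
import Relation.Binary.Reasoning.Setoid as SetoidReasoning
open import Relation.Binary.PropositionalEquality
  using (_≡_; _≢_; refl; sym; trans; cong; cong₂; subst; subst₂; module ≡-Reasoning)
open import Relation.Nullary using (¬_; Dec; yes; no; does)
open import Relation.Nullary.Decidable using (dec-true; dec-false; decidable-stable)
open +-*-Solver using (solve; _:=_; _:+_; _:*_; :-_; _:-_; con)

open ℕSolver.+-*-Solver using ()
  renaming (solve to solveⁿ; _:=_ to _:=ⁿ_; _:+_ to _:+ⁿ_; _:*_ to _:*ⁿ_; con to conⁿ)

-- The crux is the choice of r. At a codeword of weight d + 4j through T the transform equals 2^|T|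
-- (-8)^r C(j-1, r), which up to constants is the residue of w^(j-1) dw / (w - 1)^(r+1) at w = s⁴ =
-- 1. It vanishes for 1 ≤ j ≤ r, so the weights strictly between d and 24m - d disappear once r ≥ J
-- - 1, where J = (24m - 2d)/4 = 4m - 2. On the other side of the Poisson formula a nonzero codeword
-- contributes only if at most r of its points lie outside T, so r ≤ d - |T| leaves at most the
-- blocks through T. For |T| = 5 the choice r = J = d - 6 removes every unknown except λ₅. For |T| =
-- 6 both r = J and r = J - 1 are possible, but N(T) cancels, so this method gives no 6-design. For
-- |T| = 7 only r = J - 1 = d - 7 is left. Blocks through T then occur on both sides, and in a
-- 6-design the complements of blocks through T number const - N(T) and enter with a negative sign
-- because r is odd. All contributions of N(T) add up, with total coefficient 6.

-- Powers and products are kept opaque because unfolding a product by a large numeral swamps conversion.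
infixr 8 _↑_

opaque

  _↑_ : ℤ → ℕ → ℤ
  x ↑ n = x ℤ.^ n

-- Formal power series over ℤ

Series : Set
Series = ℕ → ℤ

infix 4 _≈_
infixl 6 _⊞_
infixl 7 _⊠_

_≈_ : Series → Series → Set
f ≈ g = ∀ n → f n ≡ g n

tail : Series → Series
tail f n = f (suc n)

_⊞_ : Series → Series → Series
(f ⊞ g) n = f n ℤ.+ g n

⊟_ : Series → Series
(⊟ f) n = ℤ.- f n

opaque
  _⊠_ : Series → Series → Series
  (f ⊠ g) zero = f 0 ℤ.* g 0
  (f ⊠ g) (suc n) = f 0 ℤ.* g (suc n) ℤ.+ (tail f ⊠ g) n

scale : ℤ → Series
scale c zero = c
scale c (suc n) = 0ℤ

opaque
  unfolding _⊠_

  ⊠-zero : ∀ f g → (f ⊠ g) 0 ≡ f 0 ℤ.* g 0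
  ⊠-zero f g = refl

  ⊠-suc : ∀ f g n → (f ⊠ g) (suc n) ≡ f 0 ℤ.* g (suc n) ℤ.+ (tail f ⊠ g) n
  ⊠-suc f g n = refl

  ⊠-cong : ∀ {f f′ g g′} → f ≈ f′ → g ≈ g′ → f ⊠ g ≈ f′ ⊠ g′
  ⊠-cong p q zero = cong₂ ℤ._*_ (p 0) (q 0)
  ⊠-cong p q (suc n) =
    cong₂ ℤ._+_ (cong₂ ℤ._*_ (p 0) (q (suc n))) (⊠-cong (λ i → p (suc i)) q n)

  ⊠-distribʳ : ∀ h f g → (f ⊞ g) ⊠ h ≈ f ⊠ h ⊞ g ⊠ h
  ⊠-distribʳ h f g zero = ℤₚ.*-distribʳ-+ (h 0) (f 0) (g 0)
  ⊠-distribʳ h f g (suc n) = trans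
    (cong (λ z → (f 0 ℤ.+ g 0) ℤ.* h (suc n) ℤ.+ z) (⊠-distribʳ h (tail f) (tail g) n))
    (solve 5 (λ a b c d e → (a :+ b) :* c :+ (d :+ e) := (a :* c :+ d) :+ (b :* c :+ e)) refl
      (f 0) (g 0) (h (suc n)) ((tail f ⊠ h) n) ((tail g ⊠ h) n))

  ⊠-scaleˡ : ∀ c g n → (scale c ⊠ g) n ≡ c ℤ.* g n
  ⊠-zeroˡ : ∀ g n → ((λ _ → 0ℤ) ⊠ g) n ≡ 0ℤ
  ⊠-zeroˡ g zero = refl
  ⊠-zeroˡ g (suc n) = trans (ℤₚ.+-identityˡ _) (⊠-zeroˡ g n)
  ⊠-scaleˡ c g zero = refl
  ⊠-scaleˡ c g (suc n) =
    trans (cong (λ z → c ℤ.* g (suc n) ℤ.+ z) (⊠-zeroˡ g n)) (ℤₚ.+-identityʳ _)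

  -- The product peels off the left factor; this is the mirror recursion, and the two together make
  -- commutativity an induction.
  ⊠-stepʳ : ∀ f g n → (f ⊠ g) (suc n) ≡ g 0 ℤ.* f (suc n) ℤ.+ (f ⊠ tail g) n
  ⊠-stepʳ f g zero =
    solve 4 (λ a b c d → a :* b :+ c :* d := d :* c :+ a :* b) refl (f 0) (g 1) (f 1) (g 0)
  ⊠-stepʳ f g (suc n) = trans
    (cong (λ z → f 0 ℤ.* g (suc (suc n)) ℤ.+ z) (⊠-stepʳ (tail f) g n))
    (solve 3 (λ a b c → a :+ (b :+ c) := b :+ (a :+ c)) refl
      (f 0 ℤ.* g (suc (suc n))) (g 0 ℤ.* f (suc (suc n))) ((tail f ⊠ tail g) n))

  ⊠-comm : ∀ f g → f ⊠ g ≈ g ⊠ f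
  ⊠-comm f g zero = ℤₚ.*-comm (f 0) (g 0)
  ⊠-comm f g (suc n) = trans
    (cong (λ z → f 0 ℤ.* g (suc n) ℤ.+ z) (⊠-comm (tail f) g n)) (sym (⊠-stepʳ g f n))

  ⊠-scale-assoc : ∀ c f g n → ((λ i → c ℤ.* f i) ⊠ g) n ≡ c ℤ.* (f ⊠ g) n
  ⊠-scale-assoc c f g zero = ℤₚ.*-assoc c (f 0) (g 0)
  ⊠-scale-assoc c f g (suc n) = trans
    (cong (λ z → c ℤ.* f 0 ℤ.* g (suc n) ℤ.+ z) (⊠-scale-assoc c (tail f) g n))
    (solve 4 (λ a b d e → a :* b :* d :+ a :* e := a :* (b :* d :+ e)) refl
      c (f 0) (g (suc n)) ((tail f ⊠ g) n))

  ⊠-assoc : ∀ f g h → (f ⊠ g) ⊠ h ≈ f ⊠ (g ⊠ h)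
  ⊠-assoc f g h zero = ℤₚ.*-assoc (f 0) (g 0) (h 0)
  ⊠-assoc f g h (suc n) = trans
    (cong (λ z → f 0 ℤ.* g 0 ℤ.* h (suc n) ℤ.+ z) (trans
      (⊠-distribʳ h (λ i → f 0 ℤ.* tail g i) (tail f ⊠ g) n)
      (cong₂ ℤ._+_ (⊠-scale-assoc (f 0) (tail g) h n) (⊠-assoc (tail f) g h n))))
    (solve 5 (λ a b c d e → a :* b :* c :+ (a :* d :+ e) := a :* (b :* c :+ d) :+ e) refl
      (f 0) (g 0) (h (suc n)) ((tail g ⊠ h) n) ((tail f ⊠ (g ⊠ h)) n))

seriesRing : CommutativeRing 0ℓ 0ℓ
seriesRing = record
  { Carrier = Series ; _≈_ = _≈_ ; _+_ = _⊞_ ; _*_ = _⊠_ ; -_ = ⊟_ ; 0# = scale 0ℤ ; 1# = scale 1ℤ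
  ; isCommutativeRing = record
    { isRing = record
      { +-isAbelianGroup = record
        { isGroup = record
          { isMonoid = record
            { isSemigroup = record
              { isMagma = record
                { isEquivalence = record
                  { refl = λ _ → refl
                  ; sym = λ p n → sym (p n)
                  ; trans = λ p q n → trans (p n) (q n) }
                ; ∙-cong = λ p q n → cong₂ ℤ._+_ (p n) (q n) }
              ; assoc = λ f g h n → ℤₚ.+-assoc (f n) (g n) (h n) }
            ; identity = (λ f n → trans (cong (ℤ._+ f n) (zero-coeff n)) (ℤₚ.+-identityˡ (f n)))
                       , (λ f n → trans (cong (λ z → f n ℤ.+ z) (zero-coeff n)) (ℤₚ.+-identityʳ (f n))) }
          ; inverse = (λ f n → trans (ℤₚ.+-inverseˡ (f n)) (sym (zero-coeff n)))
                    , (λ f n → trans (ℤₚ.+-inverseʳ (f n)) (sym (zero-coeff n)))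
          ; ⁻¹-cong = λ p n → cong ℤ.-_ (p n) }
        ; comm = λ f g n → ℤₚ.+-comm (f n) (g n) }
      ; *-cong = ⊠-cong
      ; *-assoc = ⊠-assoc
      ; *-identity = identityˡ
                   , (λ f n → trans (⊠-comm f (scale 1ℤ) n) (identityˡ f n))
      ; distrib = (λ h f g n → trans (⊠-comm h (f ⊞ g) n) (trans (⊠-distribʳ h f g n)
                    (cong₂ ℤ._+_ (⊠-comm f h n) (⊠-comm g h n))))
                , ⊠-distribʳ }
    ; *-comm = ⊠-comm } }
  where
  zero-coeff : ∀ n → scale 0ℤ n ≡ 0ℤ
  zero-coeff zero = refl
  zero-coeff (suc n) = refl
  identityˡ : ∀ f → scale 1ℤ ⊠ f ≈ f
  identityˡ f n = trans (⊠-scaleˡ 1ℤ f n) (ℤₚ.*-identityˡ (f n))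

open CommutativeRing seriesRing
  using (0#; 1#) renaming (setoid to seriesSetoid; *-congˡ to ⊠-congˡ; *-congʳ to ⊠-congʳ; *-identityˡ to ⊠-identityˡ;
    refl to ≈-refl; sym to ≈-sym; trans to ≈-trans; +-cong to ⊞-cong; -‿cong to ⊟-cong; +-identityˡ to ⊞-identityˡ;
        *-identityʳ to ⊠-identityʳ)

-- Lets the ring solver prove identities between series whose coefficients are integer constants
-- such as -8.
scale-morphism : ℤ.+-*-rawRing -Raw-AlmostCommutative⟶ fromCommutativeRing seriesRing
scale-morphism = record
  { ⟦_⟧ = scale
  ; +-homo = λ { a b zero → refl ; a b (suc n) → refl }
  ; *-homo = λ { a b zero → sym (⊠-zero (scale a) (scale b))
               ; a b (suc n) → sym (trans (⊠-scaleˡ a (scale b) (suc n)) (ℤₚ.*-zeroʳ a)) }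
  ; -‿homo = λ { a zero → refl ; a (suc n) → refl }
  ; 0-homo = λ _ → refl
  ; 1-homo = λ _ → refl }

scale-≟ : ∀ a b → Maybe (scale a ≈ scale b)
scale-≟ a b with a ℤₚ.≟ b
... | yes refl = just (λ _ → refl)
... | no _ = nothing

module SeriesSolver = RingSolver ℤ.+-*-rawRing (fromCommutativeRing seriesRing) scale-morphism scale-≟

open SeriesSolver using ()
  renaming (solve to solveˢ; _:=_ to _:=ˢ_; _:+_ to _:+ˢ_; _:*_ to _:*ˢ_; _:-_ to _:-ˢ_; :-_ to :-ˢ_; _:^_ to _:^ˢ_;
      con to conˢ)

open Exp (CommutativeRing.commutativeSemiring seriesRing)
  using () renaming (_^_ to infixr 8 _^ˢ_; ^-homo-* to ^ˢ-homo; ^-distrib-* to ^ˢ-distrib; ^-assocʳ to ^ˢ-assocʳ)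

module ≈-Reasoning = SetoidReasoning seriesSetoid

nC0≡1 : ∀ n → n choose 0 ≡ 1
nC0≡1 zero = refl
nC0≡1 (suc n) = refl

-- The units 1 - y, 1 + y, 1 + y² and the derivation θ

y : Series
y 1 = 1ℤ
y _ = 0ℤ

y⊠-zero : ∀ f → (y ⊠ f) 0 ≡ 0ℤ
y⊠-zero f = ⊠-zero y f

y⊠-suc : ∀ f n → (y ⊠ f) (suc n) ≡ f n
y⊠-suc f n = trans (⊠-suc y f n) (trans (ℤₚ.+-identityˡ _) (trans (⊠-cong tail-y ≈-refl n) (⊠-identityˡ f n)))
  where
  tail-y : tail y ≈ 1#
  tail-y zero = refl
  tail-y (suc n) = refl

X Y Q X⁻¹ Y⁻¹ Q⁻¹ : Series
X = 1# ⊞ ⊟ y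
Y = 1# ⊞ y
Q = 1# ⊞ y ⊠ y
X⁻¹ _ = 1ℤ
Y⁻¹ zero = 1ℤ
Y⁻¹ (suc n) = ℤ.- Y⁻¹ n
Q⁻¹ 0 = 1ℤ
Q⁻¹ 1 = 0ℤ
Q⁻¹ (suc (suc n)) = ℤ.- Q⁻¹ n

X⊠X⁻¹ : X ⊠ X⁻¹ ≈ 1#
X⊠X⁻¹ n = trans (solveˢ 2 (λ y X⁻¹ → (conˢ 1ℤ :-ˢ y) :*ˢ X⁻¹ :=ˢ X⁻¹ :-ˢ y :*ˢ X⁻¹) ≈-refl y X⁻¹ n) (go n)
  where
  go : X⁻¹ ⊞ ⊟ (y ⊠ X⁻¹) ≈ 1#
  go zero rewrite y⊠-zero X⁻¹ = refl
  go (suc n) rewrite y⊠-suc X⁻¹ n = refl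

Y⊠Y⁻¹ : Y ⊠ Y⁻¹ ≈ 1#
Y⊠Y⁻¹ n = trans (solveˢ 2 (λ y X⁻¹ → (conˢ 1ℤ :+ˢ y) :*ˢ X⁻¹ :=ˢ X⁻¹ :+ˢ y :*ˢ X⁻¹) ≈-refl y Y⁻¹ n) (go n)
  where
  go : Y⁻¹ ⊞ (y ⊠ Y⁻¹) ≈ 1#
  go zero rewrite y⊠-zero Y⁻¹ = refl
  go (suc n) rewrite y⊠-suc Y⁻¹ n = ℤₚ.+-inverseˡ (Y⁻¹ n)

Q⊠Q⁻¹ : Q ⊠ Q⁻¹ ≈ 1#
Q⊠Q⁻¹ n = trans (solveˢ 2 (λ y X⁻¹ → (conˢ 1ℤ :+ˢ y :*ˢ y) :*ˢ X⁻¹ :=ˢ X⁻¹ :+ˢ y :*ˢ (y :*ˢ X⁻¹)) ≈-refl y Q⁻¹ n)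
  (go n)
  where
  go : Q⁻¹ ⊞ (y ⊠ (y ⊠ Q⁻¹)) ≈ 1#
  go zero rewrite y⊠-zero (y ⊠ Q⁻¹) = refl
  go (suc zero) rewrite y⊠-suc (y ⊠ Q⁻¹) 0 | y⊠-zero Q⁻¹ = refl
  go (suc (suc n)) rewrite y⊠-suc (y ⊠ Q⁻¹) (suc n) | y⊠-suc Q⁻¹ n = ℤₚ.+-inverseˡ (Q⁻¹ n)

-- θ = y d/dy
θ : Series → Series
θ f n = + n ℤ.* f n

opaque
  unfolding _⊠_

  θ-⊠ : ∀ f g → θ (f ⊠ g) ≈ θ f ⊠ g ⊞ f ⊠ θ g
  θ-⊠ f g zero = solve 2 (λ a b → con 0ℤ := con 0ℤ :* a :* b :+ a :* (con 0ℤ :* b)) refl (f 0) (g 0)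
  θ-⊠ f g (suc n) = begin
    + suc n ℤ.* (f 0 ℤ.* g (suc n) ℤ.+ (tail f ⊠ g) n)
      ≡⟨ solve 4 (λ k a b c → (con 1ℤ :+ k) :* (a :* b :+ c) := a :* ((con 1ℤ :+ k) :* b) :+ (k :* c :+ c)) refl
           (+ n) (f 0) (g (suc n)) ((tail f ⊠ g) n) ⟩
    f 0 ℤ.* θ g (suc n) ℤ.+ (θ (tail f ⊠ g) n ℤ.+ (tail f ⊠ g) n)
      ≡⟨ cong (λ z → f 0 ℤ.* θ g (suc n) ℤ.+ (z ℤ.+ (tail f ⊠ g) n)) (θ-⊠ (tail f) g n) ⟩
    f 0 ℤ.* θ g (suc n) ℤ.+ ((θ (tail f) ⊠ g) n ℤ.+ (tail f ⊠ θ g) n ℤ.+ (tail f ⊠ g) n)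
      ≡⟨ solve 5 (λ a b c d e → a :+ (b :+ c :+ d) := (con 0ℤ :* e) :+ (b :+ d) :+ (a :+ c)) refl
           (f 0 ℤ.* θ g (suc n)) ((θ (tail f) ⊠ g) n) ((tail f ⊠ θ g) n) ((tail f ⊠ g) n) (g (suc n)) ⟩
    0ℤ ℤ.* g (suc n) ℤ.+ ((θ (tail f) ⊠ g) n ℤ.+ (tail f ⊠ g) n) ℤ.+ (f ⊠ θ g) (suc n)
      ≡⟨ cong (λ z → 0ℤ ℤ.* g (suc n) ℤ.+ z ℤ.+ (f ⊠ θ g) (suc n)) (trans
           (sym (⊠-distribʳ g (θ (tail f)) (tail f) n))
           (⊠-cong {g = g} (λ i → solve 2 (λ k a → k :* a :+ a := (con 1ℤ :+ k) :* a) refl (+ i) (f (suc i))) ≈-refl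
               n)) ⟩
    (θ f ⊠ g ⊞ f ⊠ θ g) (suc n) ∎
    where open ≡-Reasoning

θ-cong : ∀ {f g} → f ≈ g → θ f ≈ θ g
θ-cong p n = cong (+ n ℤ.*_) (p n)

θ-^ : ∀ f r → θ (f ^ˢ suc r) ≈ scale (+ suc r) ⊠ (f ^ˢ r ⊠ θ f)
θ-^ f zero = begin
  θ (f ⊠ 1#) ≈⟨ θ-cong (⊠-identityʳ f) ⟩
  θ f ≈⟨ solveˢ 1 (λ a → a :=ˢ conˢ 1ℤ :*ˢ (conˢ 1ℤ :*ˢ a)) ≈-refl (θ f) ⟩
  scale 1ℤ ⊠ (1# ⊠ θ f) ∎
  where open ≈-Reasoning
θ-^ f (suc r) = begin
  θ (f ⊠ f ^ˢ suc r) ≈⟨ θ-⊠ f (f ^ˢ suc r) ⟩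
  θ f ⊠ f ^ˢ suc r ⊞ f ⊠ θ (f ^ˢ suc r) ≈⟨ ⊞-cong {θ f ⊠ f ^ˢ suc r} ≈-refl (⊠-congˡ {f} (θ-^ f r)) ⟩
  θ f ⊠ f ^ˢ suc r ⊞ f ⊠ (scale (+ suc r) ⊠ (f ^ˢ r ⊠ θ f))
    ≈⟨ solveˢ 4 (λ f g h c → h :*ˢ (f :*ˢ g) :+ˢ f :*ˢ (c :*ˢ (g :*ˢ h))
         :=ˢ (conˢ 1ℤ :+ˢ c) :*ˢ ((f :*ˢ g) :*ˢ h)) ≈-refl f (f ^ˢ r) (θ f) (scale (+ suc r)) ⟩
  (scale 1ℤ ⊞ scale (+ suc r)) ⊠ (f ^ˢ suc r ⊠ θ f) ≈⟨ ⊠-congʳ {f ^ˢ suc r ⊠ θ f}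
      (λ { zero → refl ; (suc n) → refl }) ⟩
  scale (+ suc (suc r)) ⊠ (f ^ˢ suc r ⊠ θ f) ∎
  where open ≈-Reasoning

-- Residues attached to the weights d + 4j

-- In terms of s = (1 − y)/(1 + y): σ = s⁴ and κ / y = −8 / (s⁴ − 1).
κ σ ρ : Series
κ = (Y ^ˢ 4) ⊠ Q⁻¹
σ = (X ^ˢ 4) ⊠ (Y⁻¹ ^ˢ 4)
ρ = X⁻¹ ⊠ Y⁻¹

⊠-unit : ∀ {a b : Series} → a ≈ 1# → b ≈ 1# → a ⊠ b ≈ 1#
⊠-unit {a} {b} p s = ≈-trans (⊠-cong p s) (⊠-identityˡ 1#)

^ˢ-unit : ∀ {a} n → a ≈ 1# → a ^ˢ n ≈ 1#
^ˢ-unit zero p = ≈-refl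
^ˢ-unit {a} (suc n) p = ≈-trans (⊠-cong p (^ˢ-unit n p)) (⊠-identityˡ 1#)

-- Rests on (1 - y)⁴ - (1 + y)⁴ = -8y(1 + y²). It turns multiplication by s⁴ into a recurrence of
-- Pascal type for the residues.
σ⊠κ : σ ⊠ κ ≈ κ ⊞ scale -[1+ 7 ] ⊠ y
σ⊠κ = begin
  σ ⊠ κ
    -- To the solver `Y⁻¹` and `Q⁻¹` are indeterminates, so the products with `Y` and `Q` are kept
    -- until the next step replaces them by 1.
    ≈⟨ solveˢ 3 (λ y Y⁻¹ Q⁻¹ → let X = conˢ 1ℤ :-ˢ y ; Y = conˢ 1ℤ :+ˢ y in
         (X :^ˢ 4 :*ˢ Y⁻¹ :^ˢ 4) :*ˢ (Y :^ˢ 4 :*ˢ Q⁻¹)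
           :=ˢ (Y :*ˢ Y⁻¹) :^ˢ 4 :*ˢ (Y :^ˢ 4 :*ˢ Q⁻¹)
             :+ˢ (Y :*ˢ Y⁻¹) :^ˢ 4 :*ˢ (conˢ -[1+ 7 ] :*ˢ y :*ˢ ((conˢ 1ℤ :+ˢ y :*ˢ y) :*ˢ Q⁻¹))) ≈-refl y Y⁻¹ Q⁻¹ ⟩
  (Y ⊠ Y⁻¹) ^ˢ 4 ⊠ κ ⊞ (Y ⊠ Y⁻¹) ^ˢ 4 ⊠ (scale -[1+ 7 ] ⊠ y ⊠ (Q ⊠ Q⁻¹))
    ≈⟨ ⊞-cong (⊠-congʳ {κ} (^ˢ-unit 4 Y⊠Y⁻¹)) (⊠-cong (^ˢ-unit 4 Y⊠Y⁻¹) (⊠-congˡ {scale -[1+ 7 ] ⊠ y} Q⊠Q⁻¹)) ⟩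
  1# ⊠ κ ⊞ 1# ⊠ (scale -[1+ 7 ] ⊠ y ⊠ 1#)
    ≈⟨ solveˢ 2 (λ k z → conˢ 1ℤ :*ˢ k :+ˢ conˢ 1ℤ :*ˢ (z :*ˢ conˢ 1ℤ) :=ˢ k :+ˢ z) ≈-refl κ (scale -[1+ 7 ] ⊠ y) ⟩
  κ ⊞ scale -[1+ 7 ] ⊠ y ∎
  where open ≈-Reasoning

-- F r j dy / y^(r+1) is a constant multiple of s^(4j−1) ds / (s⁴ − 1)^(r+1), and G r j is its residue.
F : ℕ → ℕ → Series
F r j = ρ ⊠ (σ ^ˢ j ⊠ κ ^ˢ suc r)

F-step : ∀ r j → F (suc r) (suc j) ≈ F (suc r) j ⊞ scale -[1+ 7 ] ⊠ (y ⊠ F r j)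
F-step r j = begin
  ρ ⊠ (σ ⊠ σ ^ˢ j ⊠ (κ ⊠ κ ^ˢ suc r))
    ≈⟨ solveˢ 5 (λ ρ σ s κ k → ρ :*ˢ (σ :*ˢ s :*ˢ (κ :*ˢ k)) :=ˢ (σ :*ˢ κ) :*ˢ (ρ :*ˢ (s :*ˢ k))) ≈-refl ρ σ
        (σ ^ˢ j) κ (κ ^ˢ suc r) ⟩
  (σ ⊠ κ) ⊠ F r j
    ≈⟨ ⊠-congʳ {F r j} σ⊠κ ⟩
  (κ ⊞ scale -[1+ 7 ] ⊠ y) ⊠ F r j
    ≈⟨ solveˢ 6 (λ ρ s κ k c y → (κ :+ˢ c :*ˢ y) :*ˢ (ρ :*ˢ (s :*ˢ k)) :=ˢ ρ :*ˢ (s :*ˢ (κ :*ˢ k)) :+ˢ c :*ˢ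
        (y :*ˢ (ρ :*ˢ (s :*ˢ k)))) ≈-refl ρ (σ ^ˢ j) κ (κ ^ˢ suc r) (scale -[1+ 7 ]) y ⟩
  F (suc r) j ⊞ scale -[1+ 7 ] ⊠ (y ⊠ F r j) ∎
  where open ≈-Reasoning

^ˢ-zero : ∀ f n → f 0 ≡ 1ℤ → (f ^ˢ n) 0 ≡ 1ℤ
^ˢ-zero f zero p = refl
^ˢ-zero f (suc n) p rewrite ⊠-zero f (f ^ˢ n) | p | ^ˢ-zero f n p = refl

opaque
  G : ℕ → ℕ → ℤ
  G r j = F r j r

opaque
  unfolding G _↑_

  G-step : ∀ r j → G (suc r) (suc j) ≡ G (suc r) j ℤ.+ -[1+ 7 ] ℤ.* G r j
  G-step r j = trans (F-step r j (suc r)) (cong (λ z → G (suc r) j ℤ.+ z)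
    (trans (⊠-scaleˡ -[1+ 7 ] (y ⊠ F r j) (suc r)) (cong (-[1+ 7 ] ℤ.*_) (y⊠-suc (F r j) r))))

  κ₀ : κ 0 ≡ 1ℤ
  κ₀ rewrite ⊠-zero (Y ^ˢ 4) Q⁻¹ | ^ˢ-zero Y 4 refl = refl

  σ₀ : σ 0 ≡ 1ℤ
  σ₀ rewrite ⊠-zero (X ^ˢ 4) (Y⁻¹ ^ˢ 4) | ^ˢ-zero X 4 refl | ^ˢ-zero Y⁻¹ 4 refl = refl

  G-zero : ∀ j → G 0 j ≡ 1ℤ
  G-zero j rewrite ⊠-zero ρ (σ ^ˢ j ⊠ κ ^ˢ 1) | ⊠-zero (σ ^ˢ j) (κ ^ˢ 1) | ^ˢ-zero σ j σ₀ | ^ˢ-zero κ 1 κ₀ | ⊠-zero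
      X⁻¹ Y⁻¹ = refl

  θ-⊞ : ∀ f g → θ (f ⊞ g) ≈ θ f ⊞ θ g
  θ-⊞ f g n = ℤₚ.*-distribˡ-+ (+ n) (f n) (g n)

  θ-1# : θ 1# ≈ 0#
  θ-1# zero = refl
  θ-1# (suc n) = ℤₚ.*-zeroʳ (+ suc n)

  θ-y : θ y ≈ y
  θ-y zero = refl
  θ-y (suc zero) = refl
  θ-y (suc (suc n)) = ℤₚ.*-zeroʳ (+ suc (suc n))

  θ-Y : θ Y ≈ y
  θ-Y = begin
    θ Y ≈⟨ θ-⊞ 1# y ⟩
    θ 1# ⊞ θ y ≈⟨ ⊞-cong θ-1# θ-y ⟩
    0# ⊞ y ≈⟨ ⊞-identityˡ y ⟩
    y ∎
    where open ≈-Reasoning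

  θ-Q : θ Q ≈ scale (+ 2) ⊠ (y ⊠ y)
  θ-Q = begin
    θ Q ≈⟨ θ-⊞ 1# (y ⊠ y) ⟩
    θ 1# ⊞ θ (y ⊠ y) ≈⟨ ⊞-cong θ-1# (≈-trans (θ-⊠ y y) (⊞-cong (⊠-congʳ {y} θ-y) (⊠-congˡ {y} θ-y))) ⟩
    0# ⊞ (y ⊠ y ⊞ y ⊠ y)
      ≈⟨ solveˢ 1 (λ z → conˢ 0ℤ :+ˢ (z :+ˢ z) :=ˢ conˢ (+ 2) :*ˢ z) ≈-refl (y ⊠ y) ⟩
    scale (+ 2) ⊠ (y ⊠ y) ∎
    where open ≈-Reasoning

  θ-Q⁻¹ : θ Q⁻¹ ≈ ⊟ (scale (+ 2) ⊠ (y ⊠ y) ⊠ (Q⁻¹ ⊠ Q⁻¹))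
  θ-Q⁻¹ = begin
    θ Q⁻¹ ≈⟨ ⊠-identityˡ (θ Q⁻¹) ⟨
    1# ⊠ θ Q⁻¹ ≈⟨ ⊠-congʳ {θ Q⁻¹} Q⊠Q⁻¹ ⟨
    Q ⊠ Q⁻¹ ⊠ θ Q⁻¹
      ≈⟨ solveˢ 4 (λ Q Q⁻¹ d e → Q :*ˢ Q⁻¹ :*ˢ d :=ˢ Q⁻¹ :*ˢ (e :*ˢ Q⁻¹ :+ˢ Q :*ˢ d) :-ˢ e :*ˢ (Q⁻¹ :*ˢ Q⁻¹)) ≈-refl
          Q Q⁻¹ (θ Q⁻¹) (θ Q) ⟩
    Q⁻¹ ⊠ (θ Q ⊠ Q⁻¹ ⊞ Q ⊠ θ Q⁻¹) ⊞ ⊟ (θ Q ⊠ (Q⁻¹ ⊠ Q⁻¹))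
      ≈⟨ ⊞-cong (⊠-congˡ {Q⁻¹} (≈-trans (≈-sym (θ-⊠ Q Q⁻¹)) (≈-trans (θ-cong Q⊠Q⁻¹) θ-1#)))
          (⊟-cong (⊠-congʳ {Q⁻¹ ⊠ Q⁻¹} θ-Q)) ⟩
    Q⁻¹ ⊠ 0# ⊞ ⊟ (scale (+ 2) ⊠ (y ⊠ y) ⊠ (Q⁻¹ ⊠ Q⁻¹))
      ≈⟨ solveˢ 2 (λ Q⁻¹ z → Q⁻¹ :*ˢ conˢ 0ℤ :-ˢ z :=ˢ :-ˢ z) ≈-refl Q⁻¹ (scale (+ 2) ⊠ (y ⊠ y) ⊠ (Q⁻¹ ⊠ Q⁻¹)) ⟩
    ⊟ (scale (+ 2) ⊠ (y ⊠ y) ⊠ (Q⁻¹ ⊠ Q⁻¹)) ∎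
    where open ≈-Reasoning

  -- Since ds/s = -2ρ dy, the derivative of κ/y = -8/(s⁴ - 1) is -ρσ(κ/y)². Multiplying by y² gives
  -- θκ - κ = -ρσκ², which involves power series only.
  θ-κ : θ κ ≈ κ ⊞ ⊟ (κ ⊠ (ρ ⊠ σ ⊠ κ))
  θ-κ = begin
    θ κ ≈⟨ θ-⊠ (Y ^ˢ 4) Q⁻¹ ⟩
    θ (Y ^ˢ 4) ⊠ Q⁻¹ ⊞ Y ^ˢ 4 ⊠ θ Q⁻¹
      ≈⟨ ⊞-cong (⊠-congʳ {Q⁻¹} (≈-trans (θ-^ Y 3) (⊠-congˡ {scale (+ 4)} (⊠-congˡ {Y ^ˢ 3} θ-Y))))
          (⊠-congˡ {Y ^ˢ 4} θ-Q⁻¹) ⟩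
    scale (+ 4) ⊠ (Y ^ˢ 3 ⊠ y) ⊠ Q⁻¹ ⊞ Y ^ˢ 4 ⊠ ⊟ (scale (+ 2) ⊠ (y ⊠ y) ⊠ (Q⁻¹ ⊠ Q⁻¹))
      ≈⟨ ⊞-cong (ins (scale (+ 4) ⊠ (Y ^ˢ 3 ⊠ y) ⊠ Q⁻¹)) ≈-refl ⟩
    Q ⊠ Q⁻¹ ⊠ (scale (+ 4) ⊠ (Y ^ˢ 3 ⊠ y) ⊠ Q⁻¹) ⊞ Y ^ˢ 4 ⊠ ⊟ (scale (+ 2) ⊠ (y ⊠ y) ⊠ (Q⁻¹ ⊠ Q⁻¹))
      ≈⟨ solveˢ 2 (λ y Q⁻¹ → let X = conˢ 1ℤ :-ˢ y ; Y = conˢ 1ℤ :+ˢ y ; Q = conˢ 1ℤ :+ˢ y :*ˢ y in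
           Q :*ˢ Q⁻¹ :*ˢ (conˢ (+ 4) :*ˢ (Y :^ˢ 3 :*ˢ y) :*ˢ Q⁻¹) :+ˢ Y :^ˢ 4 :*ˢ
               (:-ˢ (conˢ (+ 2) :*ˢ (y :*ˢ y) :*ˢ (Q⁻¹ :*ˢ Q⁻¹)))
           :=ˢ Q :*ˢ Q⁻¹ :*ˢ (Y :^ˢ 4 :*ˢ Q⁻¹) :-ˢ X :^ˢ 3 :*ˢ Y :^ˢ 3 :*ˢ (Q⁻¹ :*ˢ Q⁻¹)) ≈-refl y Q⁻¹ ⟩
    Q ⊠ Q⁻¹ ⊠ κ ⊞ ⊟ (X ^ˢ 3 ⊠ Y ^ˢ 3 ⊠ (Q⁻¹ ⊠ Q⁻¹))
      ≈⟨ ⊞-cong (≈-sym (ins κ)) (⊟-cong (≈-sym collapse)) ⟩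
    κ ⊞ ⊟ (κ ⊠ (ρ ⊠ σ ⊠ κ)) ∎
    where
    open ≈-Reasoning
    ins : ∀ f → f ≈ Q ⊠ Q⁻¹ ⊠ f
    ins f = ≈-sym (≈-trans (⊠-congʳ {f} Q⊠Q⁻¹) (⊠-identityˡ f))
    collapse : κ ⊠ (ρ ⊠ σ ⊠ κ) ≈ X ^ˢ 3 ⊠ Y ^ˢ 3 ⊠ (Q⁻¹ ⊠ Q⁻¹)
    collapse = begin
      κ ⊠ (ρ ⊠ σ ⊠ κ)
        ≈⟨ solveˢ 5 (λ X Y X⁻¹ Y⁻¹ Q⁻¹ → (Y :^ˢ 4 :*ˢ Q⁻¹) :*ˢ
            ((X⁻¹ :*ˢ Y⁻¹) :*ˢ (X :^ˢ 4 :*ˢ Y⁻¹ :^ˢ 4) :*ˢ (Y :^ˢ 4 :*ˢ Q⁻¹))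
             :=ˢ ((X :*ˢ X⁻¹) :*ˢ (Y :*ˢ Y⁻¹) :^ˢ 5) :*ˢ (X :^ˢ 3 :*ˢ Y :^ˢ 3 :*ˢ (Q⁻¹ :*ˢ Q⁻¹))) ≈-refl X Y X⁻¹ Y⁻¹
                 Q⁻¹ ⟩
      (X ⊠ X⁻¹ ⊠ (Y ⊠ Y⁻¹) ^ˢ 5) ⊠ (X ^ˢ 3 ⊠ Y ^ˢ 3 ⊠ (Q⁻¹ ⊠ Q⁻¹))
        ≈⟨ ⊠-congʳ {X ^ˢ 3 ⊠ Y ^ˢ 3 ⊠ (Q⁻¹ ⊠ Q⁻¹)} (⊠-unit X⊠X⁻¹ (^ˢ-unit 5 Y⊠Y⁻¹)) ⟩
      1# ⊠ (X ^ˢ 3 ⊠ Y ^ˢ 3 ⊠ (Q⁻¹ ⊠ Q⁻¹)) ≈⟨ ⊠-identityˡ (X ^ˢ 3 ⊠ Y ^ˢ 3 ⊠ (Q⁻¹ ⊠ Q⁻¹)) ⟩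
      X ^ˢ 3 ⊠ Y ^ˢ 3 ⊠ (Q⁻¹ ⊠ Q⁻¹) ∎

  -- The residue of the exact differential d(κ^r / y^r) vanishes.
  G-one : ∀ r → G (suc r) 1 ≡ 0ℤ
  G-one r = ℤₚ.*-cancelˡ-≡ (+ suc r) (G (suc r) 1) 0ℤ (begin
    a ℤ.* g ≡⟨ solve 3 (λ a g k → a :* g := a :* k :- a :* (k :- g)) refl a g k ⟩
    a ℤ.* k ℤ.- a ℤ.* (k ℤ.- g) ≡⟨ cong (λ z → a ℤ.* k ℤ.- z) eq ⟨
    a ℤ.* k ℤ.- a ℤ.* k ≡⟨ solve 2 (λ a k → a :* k :- a :* k := a :* con 0ℤ) refl a k ⟩
    a ℤ.* 0ℤ ∎)
    where
    open ≡-Reasoning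
    a g k : ℤ
    a = + suc r
    g = G (suc r) 1
    k = (κ ^ˢ suc r) (suc r)
    expand : κ ^ˢ r ⊠ θ κ ≈ κ ^ˢ suc r ⊞ ⊟ F (suc r) 1
    expand = ≈-trans (⊠-congˡ {κ ^ˢ r} θ-κ)
      (solveˢ 4 (λ k κ ρ σ → k :*ˢ (κ :-ˢ κ :*ˢ (ρ :*ˢ σ :*ˢ κ))
         :=ˢ κ :*ˢ k :-ˢ ρ :*ˢ ((σ :*ˢ conˢ 1ℤ) :*ˢ (κ :*ˢ (κ :*ˢ k)))) ≈-refl (κ ^ˢ r) κ ρ σ)
    -- The coefficient of y^(r+1) in θ(κ^(r+1)) is computed twice: θ multiplies `k` by r + 1, and
    -- the power rule with `θ-κ` gives the right side.
    eq : a ℤ.* k ≡ a ℤ.* (k ℤ.- g)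
    eq = trans (θ-^ κ r (suc r)) (trans (⊠-scaleˡ a (κ ^ˢ r ⊠ θ κ) (suc r)) (cong (a ℤ.*_) (expand (suc r))))

  -- `G-step` is Pascal's rule scaled by -8, with `G-zero` and `G-one` as boundary values. What
  -- matters later is that the binomial coefficient vanishes for j < r.
  G-suc : ∀ r j → G r (suc j) ≡ -[1+ 7 ] ↑ r ℤ.* + (j choose r)
  G-suc zero j = trans (G-zero (suc j)) (sym (cong (λ z → 1ℤ ℤ.* + z) (nC0≡1 j)))
  G-suc (suc r) zero = trans (G-one r) (sym (trans (cong (λ z → -[1+ 7 ] ↑ suc r ℤ.* + z)
      (k>n⇒nCk≡0 {0} {suc r} (ℕ.s≤s ℕ.z≤n))) (ℤₚ.*-zeroʳ (-[1+ 7 ] ↑ suc r))))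
  G-suc (suc r) (suc j) = begin
    G (suc r) (suc (suc j)) ≡⟨ G-step r (suc j) ⟩
    G (suc r) (suc j) ℤ.+ -[1+ 7 ] ℤ.* G r (suc j)
      ≡⟨ cong₂ (λ a b → a ℤ.+ -[1+ 7 ] ℤ.* b) (G-suc (suc r) j) (G-suc r j) ⟩
    -[1+ 7 ] ℤ.* p ℤ.* + (j choose suc r) ℤ.+ -[1+ 7 ] ℤ.* (p ℤ.* + (j choose r))
      ≡⟨ solve 4 (λ c p a b → c :* p :* a :+ c :* (p :* b) := c :* p :* (b :+ a)) refl -[1+ 7 ] p
          (+ (j choose suc r)) (+ (j choose r)) ⟩
    -[1+ 7 ] ℤ.* p ℤ.* + (j choose r ℕ.+ j choose suc r)
      ≡⟨ cong (λ z → -[1+ 7 ] ℤ.* p ℤ.* + z) (nCk+nC[k+1]≡[n+1]C[k+1] j r) ⟩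
    -[1+ 7 ] ℤ.* p ℤ.* + (suc j choose suc r) ∎
    where
    open ≡-Reasoning
    p : ℤ
    p = -[1+ 7 ] ↑ r

  -- The formula of `G-suc` continued to C(-1, r) = (-1)^r, obtained by running the recurrence
  -- backwards from `G-one`.
  G-first : ∀ r → G r 0 ≡ (+ 8) ↑ r
  G-first zero = G-zero 0
  G-first (suc r) = begin
    G (suc r) 0 ≡⟨ solve 2 (λ a b → a := a :+ con -[1+ 7 ] :* b :+ con (+ 8) :* b) refl (G (suc r) 0) (G r 0) ⟩
    G (suc r) 0 ℤ.+ -[1+ 7 ] ℤ.* G r 0 ℤ.+ + 8 ℤ.* G r 0
      ≡⟨ cong₂ (λ a b → a ℤ.+ + 8 ℤ.* b) (trans (sym (G-step r 0)) (G-one r)) (G-first r) ⟩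
    0ℤ ℤ.+ + 8 ℤ.* ((+ 8) ↑ r) ≡⟨ ℤₚ.+-identityˡ _ ⟩
    (+ 8) ↑ suc r ∎
    where open ≡-Reasoning

-- Powers of 1 / (1 - y⁴) and the series h

-- 1 / (1 − y⁴)
P : Series
P = X⁻¹ ⊠ Y⁻¹ ⊠ Q⁻¹

P₀ : P 0 ≡ 1ℤ
P₀ rewrite ⊠-zero (X⁻¹ ⊠ Y⁻¹) Q⁻¹ | ⊠-zero X⁻¹ Y⁻¹ = refl

P-unit : ∀ f → f ≈ P ⊠ f ⊞ ⊟ (y ⊠ (y ⊠ (y ⊠ (y ⊠ (P ⊠ f)))))
P-unit f = begin
  f ≈⟨ ⊠-identityˡ f ⟨
  1# ⊠ f ≈⟨ ⊠-congʳ {f} (⊠-unit (⊠-unit X⊠X⁻¹ Y⊠Y⁻¹) Q⊠Q⁻¹) ⟨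
  X ⊠ X⁻¹ ⊠ (Y ⊠ Y⁻¹) ⊠ (Q ⊠ Q⁻¹) ⊠ f
    ≈⟨ solveˢ 5 (λ y X⁻¹ Y⁻¹ Q⁻¹ f → let Y = conˢ 1ℤ :+ˢ y in
         (conˢ 1ℤ :-ˢ y) :*ˢ X⁻¹ :*ˢ (Y :*ˢ Y⁻¹) :*ˢ ((conˢ 1ℤ :+ˢ y :*ˢ y) :*ˢ Q⁻¹) :*ˢ f
         :=ˢ X⁻¹ :*ˢ Y⁻¹ :*ˢ Q⁻¹ :*ˢ f :-ˢ y :*ˢ (y :*ˢ (y :*ˢ (y :*ˢ (X⁻¹ :*ˢ Y⁻¹ :*ˢ Q⁻¹ :*ˢ f))))) ≈-refl y X⁻¹
             Y⁻¹ Q⁻¹ f ⟩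
  P ⊠ f ⊞ ⊟ (y ⊠ (y ⊠ (y ⊠ (y ⊠ (P ⊠ f))))) ∎
  where open ≈-Reasoning

y⁴⊠-coeff : ∀ f n → (y ⊠ (y ⊠ (y ⊠ (y ⊠ f)))) (4 ℕ.+ n) ≡ f n
y⁴⊠-coeff f n rewrite y⊠-suc (y ⊠ (y ⊠ (y ⊠ f))) (3 ℕ.+ n) | y⊠-suc (y ⊠ (y ⊠ f)) (2 ℕ.+ n)
  | y⊠-suc (y ⊠ f) (1 ℕ.+ n) | y⊠-suc f n = refl

P-step : ∀ M n → (P ^ˢ suc M) (4 ℕ.+ n) ≡ (P ^ˢ suc M) n ℤ.+ (P ^ˢ M) (4 ℕ.+ n)
P-step M n = sym (trans
  (cong (λ z → (P ^ˢ suc M) n ℤ.+ z) (trans (P-unit (P ^ˢ M) (4 ℕ.+ n))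
    (cong (λ z → (P ^ˢ suc M) (4 ℕ.+ n) ℤ.- z) (y⁴⊠-coeff (P ^ˢ suc M) n))))
  (solve 2 (λ a b → a :+ (b :- a) := b) refl ((P ^ˢ suc M) n) ((P ^ˢ suc M) (4 ℕ.+ n))))

P-base : ∀ M c → c ℕ.< 4 → (P ^ˢ suc M) c ≡ (P ^ˢ M) c
P-base M c c<4 = sym (trans (P-unit (P ^ˢ M) c) (trans
  (cong (λ z → (P ^ˢ suc M) c ℤ.- z) (low c c<4)) (ℤₚ.+-identityʳ _)))
  where
  f = P ^ˢ suc M
  low : ∀ c → c ℕ.< 4 → (y ⊠ (y ⊠ (y ⊠ (y ⊠ f)))) c ≡ 0ℤ
  low 0 _ rewrite y⊠-zero (y ⊠ (y ⊠ (y ⊠ f))) = refl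
  low 1 _ rewrite y⊠-suc (y ⊠ (y ⊠ (y ⊠ f))) 0 | y⊠-zero (y ⊠ (y ⊠ f)) = refl
  low 2 _ rewrite y⊠-suc (y ⊠ (y ⊠ (y ⊠ f))) 1 | y⊠-suc (y ⊠ (y ⊠ f)) 0 | y⊠-zero (y ⊠ f) = refl
  low 3 _ rewrite y⊠-suc (y ⊠ (y ⊠ (y ⊠ f))) 2 | y⊠-suc (y ⊠ (y ⊠ f)) 1 | y⊠-suc (y ⊠ f) 0 | y⊠-zero f = refl
  low (suc (suc (suc (suc _)))) (ℕ.s≤s (ℕ.s≤s (ℕ.s≤s (ℕ.s≤s ()))))

P-off : ∀ M c k → suc c ℕ.< 4 → (P ^ˢ M) (suc c ℕ.+ k ℕ.* 4) ≡ 0ℤ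
P-off zero c k c<4 = refl
P-off (suc M) c zero c<4 = trans (P-base M (suc c ℕ.+ 0) (subst (ℕ._< 4) (sym (ℕₚ.+-identityʳ (suc c))) c<4))
  (P-off M c zero c<4)
P-off (suc M) c (suc k) c<4 rewrite ℕₚ.+-suc c (3 ℕ.+ k ℕ.* 4) | ℕₚ.+-suc c (2 ℕ.+ k ℕ.* 4)
  | ℕₚ.+-suc c (1 ℕ.+ k ℕ.* 4) | ℕₚ.+-suc c (k ℕ.* 4) =
  trans (P-step M (suc c ℕ.+ k ℕ.* 4)) (cong₂ ℤ._+_ (P-off (suc M) c k c<4) (trans
    (cong (P ^ˢ M) (sym shift)) (P-off M c (suc k) c<4)))
  where
  shift : suc c ℕ.+ suc k ℕ.* 4 ≡ 4 ℕ.+ (suc c ℕ.+ k ℕ.* 4)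
  shift = trans (sym (ℕₚ.+-assoc (suc c) 4 (k ℕ.* 4))) (trans (cong (ℕ._+ k ℕ.* 4) (ℕₚ.+-comm (suc c) 4))
      (ℕₚ.+-assoc 4 (suc c) (k ℕ.* 4)))

-- The negative binomial series in y⁴; `P-step` is Pascal's rule.
P-coeff : ∀ M k → (P ^ˢ suc M) (k ℕ.* 4) ≡ + ((M ℕ.+ k) choose k)
P-coeff zero zero = trans (⊠-identityʳ P 0) P₀
P-coeff zero (suc k) = trans (P-step 0 (k ℕ.* 4)) (trans (ℤₚ.+-identityʳ _)
  (trans (P-coeff 0 k) (cong +_ (trans (nCn≡1 k) (sym (nCn≡1 (suc k)))))))
P-coeff (suc M) zero = trans (P-base (suc M) 0 (ℕ.s≤s ℕ.z≤n))
  (trans (P-coeff M 0) (cong +_ (trans (nC0≡1 (M ℕ.+ 0)) (sym (nC0≡1 (suc M ℕ.+ 0))))))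
P-coeff (suc M) (suc k) = trans (P-step (suc M) (k ℕ.* 4)) (trans
  (cong₂ ℤ._+_ (P-coeff (suc M) k) (P-coeff M (suc k)))
  (cong +_ (trans (cong (λ z → (suc M ℕ.+ k) choose k ℕ.+ z choose suc k) (ℕₚ.+-suc M k))
    (trans (nCk+nC[k+1]≡[n+1]C[k+1] (suc M ℕ.+ k) k) (cong (λ z → suc z choose suc k) (sym (ℕₚ.+-suc M k)))))))

-- A and B are chosen so that testSeries-eval leaves F r j at the words of weight d + 4j.
opaque
  testSeries : ℕ → ℕ → ℕ → Series
  testSeries A B r = ρ ⊠ κ ^ˢ suc r ⊠ (X⁻¹ ^ˢ A ⊠ Y⁻¹ ^ˢ B)

opaque
  unfolding testSeries G

  -- The parameters are those of |T| = 5: r = N = 4m - 2, A = d - 5, B = 24m - d. The numerator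
  -- Y^(4(N+1)) of κ^(N+1) cancels all but N + 2 factors of `Y⁻¹ ^ˢ B`, so `X⁻¹`, `Y⁻¹` and `Q⁻¹`
  -- are left with nearly equal exponents and combine into powers of `P`.
  testSeries-closed : ∀ N → testSeries (suc N) (4 ℕ.* suc N ℕ.+ suc (suc N)) N ≈ P ^ˢ (3 ℕ.+ N) ⊠ (X ⊠ (Q ⊠ Q))
  testSeries-closed N = begin
    ρ ⊠ κ ^ˢ n ⊠ (X⁻¹ ^ˢ n ⊠ Y⁻¹ ^ˢ (4 ℕ.* n ℕ.+ suc n))
      ≈⟨ ⊠-cong (⊠-congˡ {ρ} (^ˢ-distrib (Y ^ˢ 4) Q⁻¹ n))
          (⊠-congˡ {X⁻¹ ^ˢ n} (≈-trans (^ˢ-homo Y⁻¹ (4 ℕ.* n) (suc n))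
          (⊠-congʳ {Y⁻¹ ^ˢ suc n} (≈-sym (^ˢ-assocʳ Y⁻¹ 4 n))))) ⟩
    ρ ⊠ ((Y ^ˢ 4) ^ˢ n ⊠ Q⁻¹ ^ˢ n) ⊠ (X⁻¹ ^ˢ n ⊠ ((Y⁻¹ ^ˢ 4) ^ˢ n ⊠ (Y⁻¹ ⊠ Y⁻¹ ^ˢ n)))
      ≈⟨ solveˢ 7 (λ X⁻¹ Y⁻¹ y4 qn xn v4 vn → (X⁻¹ :*ˢ Y⁻¹) :*ˢ (y4 :*ˢ qn) :*ˢ (xn :*ˢ (v4 :*ˢ (Y⁻¹ :*ˢ vn)))
           :=ˢ (y4 :*ˢ v4) :*ˢ (xn :*ˢ vn :*ˢ qn :*ˢ (X⁻¹ :*ˢ Y⁻¹ :*ˢ Y⁻¹))) ≈-refl X⁻¹ Y⁻¹ ((Y ^ˢ 4) ^ˢ n)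
               (Q⁻¹ ^ˢ n) (X⁻¹ ^ˢ n) ((Y⁻¹ ^ˢ 4) ^ˢ n) (Y⁻¹ ^ˢ n) ⟩
    (Y ^ˢ 4) ^ˢ n ⊠ (Y⁻¹ ^ˢ 4) ^ˢ n ⊠ (X⁻¹ ^ˢ n ⊠ Y⁻¹ ^ˢ n ⊠ Q⁻¹ ^ˢ n ⊠ (X⁻¹ ⊠ Y⁻¹ ⊠ Y⁻¹))
      ≈⟨ ⊠-cong
           (≈-trans (≈-sym (^ˢ-distrib (Y ^ˢ 4) (Y⁻¹ ^ˢ 4) n))
               (^ˢ-unit n (≈-trans (≈-sym (^ˢ-distrib Y Y⁻¹ 4)) (^ˢ-unit 4 Y⊠Y⁻¹))))
           (⊠-cong (≈-sym (≈-trans (^ˢ-distrib (X⁻¹ ⊠ Y⁻¹) Q⁻¹ n) (⊠-congʳ {Q⁻¹ ^ˢ n} (^ˢ-distrib X⁻¹ Y⁻¹ n))))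
               X⁻¹Y⁻²) ⟩
    1# ⊠ (P ^ˢ n ⊠ (P ⊠ P ⊠ (X ⊠ (Q ⊠ Q))))
      ≈⟨ solveˢ 3 (λ p k z → conˢ 1ℤ :*ˢ (k :*ˢ (p :*ˢ p :*ˢ z)) :=ˢ p :*ˢ (p :*ˢ k) :*ˢ z) ≈-refl P (P ^ˢ n)
          (X ⊠ (Q ⊠ Q)) ⟩
    P ^ˢ (2 ℕ.+ n) ⊠ (X ⊠ (Q ⊠ Q)) ∎
    where
    open ≈-Reasoning
    n : ℕ
    n = suc N
    X⁻¹Y⁻² : X⁻¹ ⊠ Y⁻¹ ⊠ Y⁻¹ ≈ P ⊠ P ⊠ (X ⊠ (Q ⊠ Q))
    X⁻¹Y⁻² = ≈-sym (≈-trans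
      (solveˢ 5 (λ X Q X⁻¹ Y⁻¹ Q⁻¹ → (X⁻¹ :*ˢ Y⁻¹ :*ˢ Q⁻¹) :*ˢ (X⁻¹ :*ˢ Y⁻¹ :*ˢ Q⁻¹) :*ˢ (X :*ˢ (Q :*ˢ Q))
        :=ˢ ((X :*ˢ X⁻¹) :*ˢ ((Q :*ˢ Q⁻¹) :*ˢ (Q :*ˢ Q⁻¹))) :*ˢ (X⁻¹ :*ˢ Y⁻¹ :*ˢ Y⁻¹)) ≈-refl X Q X⁻¹ Y⁻¹ Q⁻¹)
      (≈-trans (⊠-congʳ {X⁻¹ ⊠ Y⁻¹ ⊠ Y⁻¹} (⊠-unit X⊠X⁻¹ (⊠-unit Q⊠Q⁻¹ Q⊠Q⁻¹))) (⊠-identityˡ (X⁻¹ ⊠ Y⁻¹ ⊠ Y⁻¹))))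

  -- X Q² = 1 - y + 2y² - 2y³ + y⁴ - y⁵, and powers of `P` have only exponents divisible by 4. The
  -- index is 2 mod 4, so the term 2y² alone contributes.
  testSeries-coeff : ∀ m → testSeries (3 ℕ.+ m ℕ.* 4) (4 ℕ.* (3 ℕ.+ m ℕ.* 4) ℕ.+ (4 ℕ.+ m ℕ.* 4)) (2 ℕ.+ m ℕ.* 4)
      (2 ℕ.+ m ℕ.* 4)
    ≡ + 2 ℤ.* + ((4 ℕ.+ m ℕ.* 4 ℕ.+ m) choose m)
  testSeries-coeff m = trans (testSeries-closed (2 ℕ.+ m ℕ.* 4) r) (trans
    (solveˢ 2 (λ y f → f :*ˢ ((conˢ 1ℤ :-ˢ y) :*ˢ ((conˢ 1ℤ :+ˢ y :*ˢ y) :*ˢ (conˢ 1ℤ :+ˢ y :*ˢ y)))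
      :=ˢ (f :-ˢ y :*ˢ f) :+ˢ (conˢ (+ 2) :*ˢ (y :*ˢ (y :*ˢ f)) :-ˢ conˢ (+ 2) :*ˢ (y :*ˢ (y :*ˢ (y :*ˢ f))))
        :+ˢ (y :*ˢ (y :*ˢ (y :*ˢ (y :*ˢ f))) :-ˢ (y :*ˢ (y :*ˢ (y :*ˢ (y :*ˢ (y :*ˢ f))))))) ≈-refl y f r)
    go)
    where
    r : ℕ
    r = 2 ℕ.+ m ℕ.* 4
    f : Series
    f = P ^ˢ (3 ℕ.+ r)
    y² : ∀ g n → (y ⊠ (y ⊠ g)) (2 ℕ.+ n) ≡ g n
    y² g n = trans (y⊠-suc (y ⊠ g) (suc n)) (y⊠-suc g n)
    off1 : ∀ m → (y ⊠ f) (m ℕ.* 4) ≡ 0ℤ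
    off1 zero = y⊠-zero f
    off1 (suc m) = trans (y⊠-suc f _) (P-off (3 ℕ.+ r) 2 m (ℕ.s≤s (ℕ.s≤s (ℕ.s≤s (ℕ.s≤s ℕ.z≤n)))))
    off2 : ∀ m → (y ⊠ (y ⊠ f)) (m ℕ.* 4) ≡ 0ℤ
    off2 zero = y⊠-zero (y ⊠ f)
    off2 (suc m) = trans (y² f _) (P-off (3 ℕ.+ r) 1 m (ℕ.s≤s (ℕ.s≤s (ℕ.s≤s ℕ.z≤n))))
    off3 : ∀ m → (y ⊠ (y ⊠ (y ⊠ f))) (m ℕ.* 4) ≡ 0ℤ
    off3 zero = y⊠-zero (y ⊠ (y ⊠ f))
    off3 (suc m) = trans (y² (y ⊠ f) _) (trans (y⊠-suc f _) (P-off (3 ℕ.+ r) 0 m (ℕ.s≤s (ℕ.s≤s ℕ.z≤n))))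
    go : (f r ℤ.- (y ⊠ f) r) ℤ.+ ((scale (+ 2) ⊠ (y ⊠ (y ⊠ f))) r ℤ.- (scale (+ 2) ⊠ (y ⊠ (y ⊠ (y ⊠ f)))) r)
      ℤ.+ ((y ⊠ (y ⊠ (y ⊠ (y ⊠ f)))) r ℤ.- (y ⊠ (y ⊠ (y ⊠ (y ⊠ (y ⊠ f))))) r) ≡ + 2 ℤ.* +
          ((4 ℕ.+ m ℕ.* 4 ℕ.+ m) choose m)
    go rewrite y⊠-suc f (suc (m ℕ.* 4)) | P-off (3 ℕ.+ r) 1 m (ℕ.s≤s (ℕ.s≤s (ℕ.s≤s ℕ.z≤n))) | P-off (3 ℕ.+ r) 0 m
        (ℕ.s≤s (ℕ.s≤s ℕ.z≤n))
      | ⊠-scaleˡ (+ 2) (y ⊠ (y ⊠ f)) r | ⊠-scaleˡ (+ 2) (y ⊠ (y ⊠ (y ⊠ f))) r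
      | y² f (m ℕ.* 4) | y² (y ⊠ f) (m ℕ.* 4) | y² (y ⊠ (y ⊠ f)) (m ℕ.* 4) | y² (y ⊠ (y ⊠ (y ⊠ f))) (m ℕ.* 4)
      | off1 m | off2 m | off3 m | P-coeff (2 ℕ.+ r) m = trans (ℤₚ.+-identityʳ _)
          (trans (ℤₚ.+-identityˡ _) (ℤₚ.+-identityʳ _))

  -- The factors X^(A+4j) and Y^e are those which the transform produces at a word of weight d + 4j.
  -- Against X^(-A) Y^(-B) they leave (X / Y)^(4j) = σ^j.
  testSeries-eval : ∀ A B r j e → e ℕ.+ 4 ℕ.* j ≡ B → X ^ˢ (A ℕ.+ 4 ℕ.* j) ⊠ (Y ^ˢ e ⊠ testSeries A B r) ≈ F r j
  testSeries-eval A .(e ℕ.+ 4 ℕ.* j) r j e refl = begin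
    X ^ˢ (A ℕ.+ 4 ℕ.* j) ⊠ (Y ^ˢ e ⊠ (ρ ⊠ k ⊠ (X⁻¹ ^ˢ A ⊠ Y⁻¹ ^ˢ (e ℕ.+ 4 ℕ.* j))))
      ≈⟨ ⊠-cong (split X A) (⊠-congˡ {Y ^ˢ e} (⊠-congˡ {ρ ⊠ k} (⊠-congˡ {X⁻¹ ^ˢ A} (split Y⁻¹ e)))) ⟩
    X ^ˢ A ⊠ (X ^ˢ 4) ^ˢ j ⊠ (Y ^ˢ e ⊠ (ρ ⊠ k ⊠ (X⁻¹ ^ˢ A ⊠ (Y⁻¹ ^ˢ e ⊠ (Y⁻¹ ^ˢ 4) ^ˢ j))))
      ≈⟨ solveˢ 8 (λ XA X4 Ye ρ k xA ve v4 → XA :*ˢ X4 :*ˢ (Ye :*ˢ (ρ :*ˢ k :*ˢ (xA :*ˢ (ve :*ˢ v4))))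
           :=ˢ (XA :*ˢ xA) :*ˢ (Ye :*ˢ ve) :*ˢ (ρ :*ˢ ((X4 :*ˢ v4) :*ˢ k))) ≈-refl
           (X ^ˢ A) ((X ^ˢ 4) ^ˢ j) (Y ^ˢ e) ρ k (X⁻¹ ^ˢ A) (Y⁻¹ ^ˢ e) ((Y⁻¹ ^ˢ 4) ^ˢ j) ⟩
    (X ^ˢ A ⊠ X⁻¹ ^ˢ A) ⊠ (Y ^ˢ e ⊠ Y⁻¹ ^ˢ e) ⊠ (ρ ⊠ ((X ^ˢ 4) ^ˢ j ⊠ (Y⁻¹ ^ˢ 4) ^ˢ j ⊠ k))
      ≈⟨ ⊠-cong (⊠-unit (unit A X⊠X⁻¹) (unit e Y⊠Y⁻¹)) (⊠-congˡ {ρ}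
          (⊠-congʳ {k} (≈-sym (^ˢ-distrib (X ^ˢ 4) (Y⁻¹ ^ˢ 4) j)))) ⟩
    1# ⊠ F r j ≈⟨ ⊠-identityˡ (F r j) ⟩
    F r j ∎
    where
    open ≈-Reasoning
    k : Series
    k = κ ^ˢ suc r
    split : ∀ f a → f ^ˢ (a ℕ.+ 4 ℕ.* j) ≈ f ^ˢ a ⊠ (f ^ˢ 4) ^ˢ j
    split f a = ≈-trans (^ˢ-homo f a (4 ℕ.* j)) (⊠-congˡ {f ^ˢ a} (≈-sym (^ˢ-assocʳ f 4 j)))
    unit : ∀ {f g} a → f ⊠ g ≈ 1# → f ^ˢ a ⊠ g ^ˢ a ≈ 1#
    unit {f} {g} a p = ≈-trans (≈-sym (^ˢ-distrib f g a)) (^ˢ-unit a p)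

  testSeries-zero : ∀ A B r → testSeries A B r 0 ≡ 1ℤ
  testSeries-zero A B r rewrite ⊠-zero (ρ ⊠ κ ^ˢ suc r) (X⁻¹ ^ˢ A ⊠ Y⁻¹ ^ˢ B) | ⊠-zero ρ (κ ^ˢ suc r) | ⊠-zero
      (X⁻¹ ^ˢ A) (Y⁻¹ ^ˢ B)
    | ^ˢ-zero κ (suc r) κ₀ | ^ˢ-zero X⁻¹ A refl | ^ˢ-zero Y⁻¹ B refl | ⊠-zero X⁻¹ Y⁻¹ = refl

  testSeries-value : ∀ A B r j e → e ℕ.+ 4 ℕ.* j ≡ B → (X ^ˢ (A ℕ.+ 4 ℕ.* j) ⊠ (Y ^ˢ e ⊠ testSeries A B r)) r ≡ G r j
  testSeries-value A B r j e p = testSeries-eval A B r j e p r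

-- Sums over words and Fourier transforms

ι : Bool → ℤ
ι true = 1ℤ
ι false = 0ℤ

ι-∧ : ∀ a b → ι (a ∧ b) ≡ ι a ℤ.* ι b
ι-∧ true b = sym (ℤₚ.*-identityˡ (ι b))
ι-∧ false b = refl

countᵇ-++ : ∀ {A : Set} (p : A → Bool) xs ys → countᵇ p (xs ++ ys) ≡ countᵇ p xs ℕ.+ countᵇ p ys
countᵇ-++ p [] ys = refl
countᵇ-++ p (x ∷ xs) ys with p x
... | true = cong suc (countᵇ-++ p xs ys)
... | false = countᵇ-++ p xs ys

countᵇ-map : ∀ {A B : Set} (p : B → Bool) (f : A → B) xs → countᵇ p (map f xs) ≡ countᵇ (p ∘ f) xs
countᵇ-map p f [] = refl
countᵇ-map p f (x ∷ xs) with p (f x)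
... | true = cong suc (countᵇ-map p f xs)
... | false = countᵇ-map p f xs

opaque
  -- Recursion on the coordinates instead of the list `allWords`, so that transforms of product
  -- functions factor coordinate by coordinate.
  ∑ : ∀ {n} → (Word n → ℤ) → ℤ
  ∑ {zero} f = f []
  ∑ {suc n} f = ∑ (f ∘ (false ∷_)) ℤ.+ ∑ (f ∘ (true ∷_))

  ∑-split : ∀ {n} (f : Word (suc n) → ℤ) → ∑ f ≡ ∑ (f ∘ (false ∷_)) ℤ.+ ∑ (f ∘ (true ∷_))
  ∑-split f = refl

  ∑-[] : (f : Word 0 → ℤ) → ∑ f ≡ f []
  ∑-[] f = refl

  countᵇ-∑ : ∀ {n} (p : Word n → Bool) → + countᵇ p (allWords n) ≡ ∑ (ι ∘ p)
  countᵇ-∑ {zero} p with p []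
  ... | true = refl
  ... | false = refl
  countᵇ-∑ {suc n} p = trans
    (cong +_ (trans (countᵇ-++ p (map (false ∷_) (allWords n)) (map (true ∷_) (allWords n)))
      (cong₂ ℕ._+_ (countᵇ-map p (false ∷_) (allWords n)) (countᵇ-map p (true ∷_) (allWords n)))))
    (cong₂ ℤ._+_ (countᵇ-∑ (p ∘ (false ∷_))) (countᵇ-∑ (p ∘ (true ∷_))))

  ∑-cong : ∀ {n} {f g : Word n → ℤ} → (∀ v → f v ≡ g v) → ∑ f ≡ ∑ g
  ∑-cong {zero} p = p []
  ∑-cong {suc n} p = cong₂ ℤ._+_ (∑-cong (p ∘ (false ∷_))) (∑-cong (p ∘ (true ∷_)))

  ∑-+ : ∀ {n} (f g : Word n → ℤ) → ∑ (λ v → f v ℤ.+ g v) ≡ ∑ f ℤ.+ ∑ g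
  ∑-+ {zero} f g = refl
  ∑-+ {suc n} f g = trans (cong₂ ℤ._+_ (∑-+ (f ∘ (false ∷_)) (g ∘ (false ∷_))) (∑-+ (f ∘ (true ∷_)) (g ∘ (true ∷_))))
    (solve 4 (λ a b c d → (a :+ b) :+ (c :+ d) := (a :+ c) :+ (b :+ d)) refl
      (∑ (f ∘ (false ∷_))) (∑ (g ∘ (false ∷_))) (∑ (f ∘ (true ∷_))) (∑ (g ∘ (true ∷_))))

  ∑-* : ∀ {n} c (f : Word n → ℤ) → ∑ (λ v → c ℤ.* f v) ≡ c ℤ.* ∑ f
  ∑-* {zero} c f = refl
  ∑-* {suc n} c f = trans (cong₂ ℤ._+_ (∑-* c (f ∘ (false ∷_))) (∑-* c (f ∘ (true ∷_))))
    (sym (ℤₚ.*-distribˡ-+ c _ _))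

  ∑-0 : ∀ n → ∑ {n} (λ _ → 0ℤ) ≡ 0ℤ
  ∑-0 zero = refl
  ∑-0 (suc n) rewrite ∑-0 n = refl

  ∑-swap : ∀ {n k} (f : Word n → Word k → ℤ) → ∑ (λ u → ∑ (f u)) ≡ ∑ (λ v → ∑ (λ u → f u v))
  ∑-swap {zero} f = refl
  ∑-swap {suc n} f = trans (cong₂ ℤ._+_ (∑-swap (f ∘ (false ∷_))) (∑-swap (f ∘ (true ∷_))))
    (sym (∑-+ (λ v → ∑ (λ u → f (false ∷ u) v)) (λ v → ∑ (λ u → f (true ∷ u) v))))

  ∑-translate : ∀ {n} (u : Word n) (f : Word n → ℤ) → ∑ (λ v → f (u ⊕ v)) ≡ ∑ f
  ∑-translate [] f = refl
  ∑-translate (false ∷ u) f = cong₂ ℤ._+_ (∑-translate u (f ∘ (false ∷_))) (∑-translate u (f ∘ (true ∷_)))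
  ∑-translate (true ∷ u) f = trans
    (cong₂ ℤ._+_ (∑-translate u (f ∘ (true ∷_))) (∑-translate u (f ∘ (false ∷_))))
        (ℤₚ.+-comm (∑ (f ∘ (true ∷_))) (∑ (f ∘ (false ∷_))))

  ∑-weight-zero : ∀ {n} (f : Word n → ℤ) → ∑ (λ v → ι (wt v ==ℕ 0) ℤ.* f v) ≡ f (zeroWord n)
  ∑-weight-zero {zero} f = ℤₚ.*-identityˡ (f [])
  ∑-weight-zero {suc n} f = trans
    (cong₂ ℤ._+_ (∑-weight-zero (f ∘ (false ∷_))) (∑-0 n)) (ℤₚ.+-identityʳ _)

-- Characters and Poisson summation

sgn : Bool → ℤ
sgn false = 1ℤ
sgn true = -[1+ 0 ]

sgn-xor : ∀ a b → sgn (a xor b) ≡ sgn a ℤ.* sgn b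
sgn-xor false b = sym (ℤₚ.*-identityˡ (sgn b))
sgn-xor true false = refl
sgn-xor true true = refl

dot-⊕ˡ : ∀ {n} (u v w : Word n) → dot (u ⊕ v) w ≡ dot u w xor dot v w
dot-⊕ˡ [] [] [] = refl
dot-⊕ˡ (a ∷ u) (b ∷ v) (c ∷ w) rewrite dot-⊕ˡ u v w = bits a b c (dot u w) (dot v w)
  where
  bits : ∀ a b c p q → ((a xor b) ∧ c) xor (p xor q) ≡ ((a ∧ c) xor p) xor ((b ∧ c) xor q)
  bits false false false false false = refl
  bits false false false false true = refl
  bits false false false true false = refl
  bits false false false true true = refl
  bits false false true false false = refl
  bits false false true false true = refl
  bits false false true true false = refl
  bits false false true true true = refl
  bits false true false false false = refl
  bits false true false false true = refl
  bits false true false true false = refl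
  bits false true false true true = refl
  bits false true true false false = refl
  bits false true true false true = refl
  bits false true true true false = refl
  bits false true true true true = refl
  bits true false false false false = refl
  bits true false false false true = refl
  bits true false false true false = refl
  bits true false false true true = refl
  bits true false true false false = refl
  bits true false true false true = refl
  bits true false true true false = refl
  bits true false true true true = refl
  bits true true false false false = refl
  bits true true false false true = refl
  bits true true false true false = refl
  bits true true false true true = refl
  bits true true true false false = refl
  bits true true true false true = refl
  bits true true true true false = refl
  bits true true true true true = refl

⊕-self : ∀ {n} (u v : Word n) → u ⊕ (u ⊕ v) ≡ v
⊕-self [] [] = refl
⊕-self (false ∷ u) (b ∷ v) = cong (b ∷_) (⊕-self u v)
⊕-self (true ∷ u) (false ∷ v) = cong (false ∷_) (⊕-self u v)
⊕-self (true ∷ u) (true ∷ v) = cong (true ∷_) (⊕-self u v)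

module Poisson {n} (C : Code n) (linear : IsLinear C) (self-dual : IsSelfDual C) where

  C-translate : ∀ u v → u ∈C C → C (u ⊕ v) ≡ C v
  C-translate u v u∈C with C v in Cv | C (u ⊕ v) in Cuv
  ... | true | true = refl
  ... | false | false = refl
  ... | true | false = trans (sym Cuv) (proj₂ linear u v u∈C Cv)
  ... | false | true = trans (sym (trans (sym (cong C (⊕-self u v))) (proj₂ linear u (u ⊕ v) u∈C Cuv))) Cv

  size : ℤ
  size = ∑ (ι ∘ C)

  character-sum : ∀ v → ∑ (λ u → ι (C u) ℤ.* sgn (dot u v)) ≡ ι (C v) ℤ.* size
  character-sum v with C v in Cv
  ... | true = trans (∑-cong pointwise) (sym (ℤₚ.*-identityˡ size))
    where
    pointwise : ∀ u → ι (C u) ℤ.* sgn (dot u v) ≡ ι (C u)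
    pointwise u with C u in Cu
    ... | false = refl
    ... | true rewrite Equivalence.to (self-dual v) Cv u Cu = refl
  -- No u₀ ∈ C with dot product 1 has to be searched for. Translation by such a u₀ would negate the
  -- sum, so a nonzero sum makes v orthogonal to C, hence a member of C.
  ... | false = decidable-stable (S ℤₚ.≟ 0ℤ) (λ S≢0 → case-⊥
      (trans (sym Cv) (Equivalence.from (self-dual v) (orth S≢0))))
    where
    S = ∑ (λ u → ι (C u) ℤ.* sgn (dot u v))
    case-⊥ : false ≡ true → ⊥
    case-⊥ ()
    orth : S ≢ 0ℤ → ∀ u₀ → u₀ ∈C C → dot u₀ v ≡ false
    orth S≢0 u₀ u₀∈C with dot u₀ v in d
    ... | false = refl
    ... | true = ⊥-elim (S≢0 (self-neg S (trans (sym (∑-translate u₀ _)) (trans (∑-cong flip) (∑-* -[1+ 0 ] _)))))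
      where
      flip : ∀ u → ι (C (u₀ ⊕ u)) ℤ.* sgn (dot (u₀ ⊕ u) v) ≡ -[1+ 0 ] ℤ.* (ι (C u) ℤ.* sgn (dot u v))
      flip u rewrite C-translate u₀ u u₀∈C | dot-⊕ˡ u₀ u v | d | sgn-xor true (dot u v) =
        solve 3 (λ a b c → a :* (b :* c) := b :* (a :* c)) refl (ι (C u)) -[1+ 0 ] (sgn (dot u v))
      self-neg : ∀ s → s ≡ -[1+ 0 ] ℤ.* s → s ≡ 0ℤ
      self-neg s p = ℤₚ.*-cancelˡ-≡ (+ 2) s 0ℤ (trans (solve 1 (λ s → con (+ 2) :* s := s :- con -[1+ 0 ] :* s) refl
          s)
        (trans (cong (λ z → z ℤ.- -[1+ 0 ] ℤ.* s) p) (ℤₚ.+-inverseʳ (-[1+ 0 ] ℤ.* s))))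

  poisson : ∀ (f : Word n → ℤ) → size ℤ.* ∑ (λ v → ι (C v) ℤ.* f v) ≡ ∑
      (λ u → ι (C u) ℤ.* ∑ (λ v → sgn (dot u v) ℤ.* f v))
  poisson f = sym (begin
    ∑ (λ u → ι (C u) ℤ.* ∑ (λ v → sgn (dot u v) ℤ.* f v))
      ≡⟨ ∑-cong (λ u → sym (∑-* (ι (C u)) (λ v → sgn (dot u v) ℤ.* f v))) ⟩
    ∑ (λ u → ∑ (λ v → ι (C u) ℤ.* (sgn (dot u v) ℤ.* f v)))
      ≡⟨ ∑-swap (λ u v → ι (C u) ℤ.* (sgn (dot u v) ℤ.* f v)) ⟩
    ∑ (λ v → ∑ (λ u → ι (C u) ℤ.* (sgn (dot u v) ℤ.* f v)))
      ≡⟨ ∑-cong inner ⟩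
    ∑ (λ v → size ℤ.* (ι (C v) ℤ.* f v))
      ≡⟨ ∑-* size (λ v → ι (C v) ℤ.* f v) ⟩
    size ℤ.* ∑ (λ v → ι (C v) ℤ.* f v) ∎)
    where
    open ≡-Reasoning
    inner : ∀ v → ∑ (λ u → ι (C u) ℤ.* (sgn (dot u v) ℤ.* f v)) ≡ size ℤ.* (ι (C v) ℤ.* f v)
    inner v = trans (∑-cong (λ u → solve 3 (λ a b c → a :* (b :* c) := c :* (a :* b)) refl (ι (C u)) (sgn (dot u v))
        (f v)))
      (trans (∑-* (f v) (λ u → ι (C u) ℤ.* sgn (dot u v))) (trans (cong (f v ℤ.*_) (character-sum v))
        (solve 3 (λ a b c → a :* (b :* c) := c :* (b :* a)) refl (f v) (ι (C v)) size)))

-- Test functions and their transforms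

-- The coefficient of y^r in (−1)^|T∩u| y^|u∖T| g.
testFn : ℕ → ∀ {n} → Word n → Word n → Series → ℤ
testFn r [] [] g = g r
testFn r (true ∷ T) (b ∷ u) g = sgn b ℤ.* testFn r T u g
testFn r (false ∷ T) (false ∷ u) g = testFn r T u g
testFn r (false ∷ T) (true ∷ u) g = testFn r T u (y ⊠ g)

testFn-cong : ∀ r {n} (T u : Word n) {g h} → g ≈ h → testFn r T u g ≡ testFn r T u h
testFn-cong r [] [] p = p r
testFn-cong r (true ∷ T) (b ∷ u) p = cong (sgn b ℤ.*_) (testFn-cong r T u p)
testFn-cong r (false ∷ T) (false ∷ u) p = testFn-cong r T u p
testFn-cong r (false ∷ T) (true ∷ u) p = testFn-cong r T u (⊠-congˡ {y} p)

-- Used with c = 1 and c = -1: the two values of a coordinate outside T then combine into a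
-- multiplication of the series by 1 + y or 1 - y.
testFn-linear : ∀ r {n} (T u : Word n) c g h → testFn r T u (g ⊞ scale c ⊠ h) ≡ testFn r T u g ℤ.+ c ℤ.* testFn r T
  u h
testFn-linear r [] [] c g h = cong (λ z → g r ℤ.+ z) (⊠-scaleˡ c h r)
testFn-linear r (true ∷ T) (b ∷ u) c g h rewrite testFn-linear r T u c g h =
  solve 4 (λ s c a b → s :* (a :+ c :* b) := s :* a :+ c :* (s :* b)) refl (sgn b) c (testFn r T u g) (testFn r T u h)
testFn-linear r (false ∷ T) (false ∷ u) c g h = testFn-linear r T u c g h
testFn-linear r (false ∷ T) (true ∷ u) c g h = trans
  (testFn-cong r T u (solveˢ 4 (λ y g c h → y :*ˢ (g :+ˢ c :*ˢ h) :=ˢ y :*ˢ g :+ˢ c :*ˢ (y :*ˢ h)) ≈-refl y g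
      (scale c) h))
  (testFn-linear r T u c (y ⊠ g) (y ⊠ h))

-- The local Fourier factors: 1 - (-1)^(u_i), which is 0 or 2, at a point of T, and 1 + (-1)^(u_i)
-- y, which is `Y` or `X`, elsewhere. This is the MacWilliams substitution with T marked.
transform : ℕ → ∀ {n} → Word n → Word n → Series → ℤ
transform r [] [] g = g r
transform r (true ∷ T) (false ∷ u) g = 0ℤ
transform r (true ∷ T) (true ∷ u) g = + 2 ℤ.* transform r T u g
transform r (false ∷ T) (false ∷ u) g = transform r T u (Y ⊠ g)
transform r (false ∷ T) (true ∷ u) g = transform r T u (X ⊠ g)

transform-correct : ∀ r {n} (T u : Word n) g → ∑ (λ v → sgn (dot u v) ℤ.* testFn r T v g) ≡ transform r T u g
transform-correct r [] [] g = trans (∑-[] (λ v → sgn (dot [] v) ℤ.* testFn r [] v g)) (ℤₚ.*-identityˡ (g r))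
transform-correct r (true ∷ T) (false ∷ u) g = trans (∑-split
  (λ v → sgn (dot (false ∷ u) v) ℤ.* testFn r (true ∷ T) v g)) (begin
  ∑ (λ v → s v ℤ.* (1ℤ ℤ.* t v)) ℤ.+ ∑ (λ v → s v ℤ.* (-[1+ 0 ] ℤ.* t v))
    ≡⟨ sym (∑-+ _ _) ⟩
  ∑ (λ v → s v ℤ.* (1ℤ ℤ.* t v) ℤ.+ s v ℤ.* (-[1+ 0 ] ℤ.* t v))
    ≡⟨ ∑-cong (λ v → solve 2 (λ s t → s :* (con 1ℤ :* t) :+ s :* (con -[1+ 0 ] :* t) := con 0ℤ) refl (s v) (t v)) ⟩
  ∑ (λ v → 0ℤ) ≡⟨ ∑-0 _ ⟩
  0ℤ ∎)
  where
  open ≡-Reasoning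
  s = λ v → sgn (dot u v)
  t = λ v → testFn r T v g
transform-correct r (true ∷ T) (true ∷ u) g = trans (∑-split
  (λ v → sgn (dot (true ∷ u) v) ℤ.* testFn r (true ∷ T) v g)) (begin
  ∑ (λ v → s v ℤ.* (1ℤ ℤ.* t v)) ℤ.+ ∑ (λ v → sgn (true xor dot u v) ℤ.* (-[1+ 0 ] ℤ.* t v))
    ≡⟨ sym (∑-+ _ _) ⟩
  ∑ (λ v → s v ℤ.* (1ℤ ℤ.* t v) ℤ.+ sgn (true xor dot u v) ℤ.* (-[1+ 0 ] ℤ.* t v))
    ≡⟨ ∑-cong (λ v → trans (cong (λ z → s v ℤ.* (1ℤ ℤ.* t v) ℤ.+ z ℤ.* (-[1+ 0 ] ℤ.* t v)) (sgn-xor true (dot u v)))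
         (solve 2 (λ s t → s :* (con 1ℤ :* t) :+ (con -[1+ 0 ] :* s) :* (con -[1+ 0 ] :* t) := con (+ 2) :*
             (s :* t)) refl (s v) (t v))) ⟩
  ∑ (λ v → + 2 ℤ.* (s v ℤ.* t v)) ≡⟨ ∑-* (+ 2) _ ⟩
  + 2 ℤ.* ∑ (λ v → s v ℤ.* t v) ≡⟨ cong (+ 2 ℤ.*_) (transform-correct r T u g) ⟩
  + 2 ℤ.* transform r T u g ∎)
  where
  open ≡-Reasoning
  s = λ v → sgn (dot u v)
  t = λ v → testFn r T v g
transform-correct r (false ∷ T) (false ∷ u) g = trans (∑-split
  (λ v → sgn (dot (false ∷ u) v) ℤ.* testFn r (false ∷ T) v g)) (begin
  ∑ (λ v → s v ℤ.* testFn r T v g) ℤ.+ ∑ (λ v → s v ℤ.* testFn r T v (y ⊠ g))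
    ≡⟨ sym (∑-+ _ _) ⟩
  ∑ (λ v → s v ℤ.* testFn r T v g ℤ.+ s v ℤ.* testFn r T v (y ⊠ g))
    ≡⟨ ∑-cong (λ v → trans (solve 3 (λ s a b → s :* a :+ s :* b := s :* (a :+ con 1ℤ :* b)) refl (s v)
        (testFn r T v g) (testFn r T v (y ⊠ g)))
         (cong (s v ℤ.*_) (sym (trans (testFn-cong r T v
             (solveˢ 2 (λ y g → (conˢ 1ℤ :+ˢ y) :*ˢ g :=ˢ g :+ˢ conˢ 1ℤ :*ˢ (y :*ˢ g)) ≈-refl y g))
            (testFn-linear r T v 1ℤ g (y ⊠ g)))))) ⟩
  ∑ (λ v → s v ℤ.* testFn r T v (Y ⊠ g)) ≡⟨ transform-correct r T u (Y ⊠ g) ⟩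
  transform r T u (Y ⊠ g) ∎)
  where
  open ≡-Reasoning
  s = λ v → sgn (dot u v)
transform-correct r (false ∷ T) (true ∷ u) g = trans (∑-split
  (λ v → sgn (dot (true ∷ u) v) ℤ.* testFn r (false ∷ T) v g)) (begin
  ∑ (λ v → s v ℤ.* testFn r T v g) ℤ.+ ∑ (λ v → sgn (true xor dot u v) ℤ.* testFn r T v (y ⊠ g))
    ≡⟨ sym (∑-+ _ _) ⟩
  ∑ (λ v → s v ℤ.* testFn r T v g ℤ.+ sgn (true xor dot u v) ℤ.* testFn r T v (y ⊠ g))
    ≡⟨ ∑-cong (λ v → trans (cong (λ z → s v ℤ.* testFn r T v g ℤ.+ z ℤ.* testFn r T v (y ⊠ g))
        (sgn-xor true (dot u v)))
        (trans (solve 3 (λ s a b → s :* a :+ (con -[1+ 0 ] :* s) :* b := s :* (a :+ con -[1+ 0 ] :* b)) refl (s v)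
            (testFn r T v g) (testFn r T v (y ⊠ g)))
         (cong (s v ℤ.*_) (sym (trans (testFn-cong r T v
             (solveˢ 2 (λ y g → (conˢ 1ℤ :-ˢ y) :*ˢ g :=ˢ g :+ˢ conˢ -[1+ 0 ] :*ˢ (y :*ˢ g)) ≈-refl y g))
            (testFn-linear r T v -[1+ 0 ] g (y ⊠ g))))))) ⟩
  ∑ (λ v → s v ℤ.* testFn r T v (X ⊠ g)) ≡⟨ transform-correct r T u (X ⊠ g) ⟩
  transform r T u (X ⊠ g) ∎)
  where
  open ≡-Reasoning
  s = λ v → sgn (dot u v)

-- Weights and inclusions; where transforms and test functions vanish

wt≤n : ∀ {n} (v : Word n) → wt v ℕ.≤ n
wt≤n [] = ℕ.z≤n
wt≤n (true ∷ v) = ℕ.s≤s (wt≤n v)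
wt≤n (false ∷ v) = ℕₚ.m≤n⇒m≤1+n (wt≤n v)

⊆ᵇ-wt : ∀ {n} (T v : Word n) → T ⊆ᵇ v ≡ true → wt T ℕ.≤ wt v
⊆ᵇ-wt [] [] _ = ℕ.z≤n
⊆ᵇ-wt (true ∷ T) (true ∷ v) p = ℕ.s≤s (⊆ᵇ-wt T v p)
⊆ᵇ-wt (false ∷ T) (true ∷ v) p = ℕₚ.m≤n⇒m≤1+n (⊆ᵇ-wt T v p)
⊆ᵇ-wt (false ∷ T) (false ∷ v) p = ⊆ᵇ-wt T v p

infixl 7 _∩_
_∩_ : ∀ {n} → Word n → Word n → Word n
_∩_ = zipWith _∧_

transform-outside : ∀ r {n} (T u : Word n) g → T ⊆ᵇ u ≡ false → transform r T u g ≡ 0ℤ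
transform-outside r [] [] g ()
transform-outside r (true ∷ T) (false ∷ u) g p = refl
transform-outside r (true ∷ T) (true ∷ u) g p rewrite transform-outside r T u g p = refl
transform-outside r (false ∷ T) (false ∷ u) g p = transform-outside r T u (Y ⊠ g) p
transform-outside r (false ∷ T) (true ∷ u) g p = transform-outside r T u (X ⊠ g) p

opaque
  unfolding _↑_

  transform-inside : ∀ r {n} (T u : Word n) g a e → T ⊆ᵇ u ≡ true → a ℕ.+ wt T ≡ wt u → e ℕ.+ wt u ≡ n →
    transform r T u g ≡ (+ 2) ↑ wt T ℤ.* (X ^ˢ a ⊠ (Y ^ˢ e ⊠ g)) r
  transform-inside r [] [] g a e p q s rewrite ℕₚ.+-identityʳ a | q | ℕₚ.+-identityʳ e | s =
    sym (trans (ℤₚ.*-identityˡ _) (≈-trans (⊠-identityˡ (1# ⊠ g)) (⊠-identityˡ g) r))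
  transform-inside r (true ∷ T) (true ∷ u) g a e p q s rewrite transform-inside r T u g a e p
    (ℕₚ.suc-injective (trans (sym (ℕₚ.+-suc a (wt T))) q)) (ℕₚ.suc-injective (trans (sym (ℕₚ.+-suc e (wt u))) s)) =
    sym (ℤₚ.*-assoc (+ 2) ((+ 2) ↑ wt T) _)
  transform-inside r (false ∷ T) (false ∷ u) g a zero p q s =
    ⊥-elim (ℕₚ.<-irrefl s (ℕ.s≤s (wt≤n u)))
  transform-inside r (false ∷ T) (false ∷ u) g a (suc e) p q s = trans
    (transform-inside r T u (Y ⊠ g) a e p q (ℕₚ.suc-injective s))
    (cong (λ z → (+ 2) ↑ wt T ℤ.* z) (solveˢ 4 (λ Xa Y Ye g → Xa :*ˢ (Ye :*ˢ (Y :*ˢ g)) :=ˢ Xa :*ˢ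
        ((Y :*ˢ Ye) :*ˢ g)) ≈-refl (X ^ˢ a) Y (Y ^ˢ e) g r))
  transform-inside r (false ∷ T) (true ∷ u) g zero e p q s = ⊥-elim (ℕₚ.<-irrefl q (ℕ.s≤s (⊆ᵇ-wt T u p)))
  transform-inside r (false ∷ T) (true ∷ u) g (suc a) e p q s = trans
    (transform-inside r T u (X ⊠ g) a e p (ℕₚ.suc-injective q) (ℕₚ.suc-injective (trans (sym (ℕₚ.+-suc e (wt u))) s)))
    (cong (λ z → (+ 2) ↑ wt T ℤ.* z) (solveˢ 4 (λ Xa X Ye g → Xa :*ˢ (Ye :*ˢ (X :*ˢ g)) :=ˢ (X :*ˢ Xa) :*ˢ
        (Ye :*ˢ g)) ≈-refl (X ^ˢ a) X (Y ^ˢ e) g r))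

testFn-zeroWord : ∀ r {n} (T : Word n) g → testFn r T (zeroWord n) g ≡ g r
testFn-zeroWord r [] g = refl
testFn-zeroWord r (true ∷ T) g = trans (ℤₚ.*-identityˡ _) (testFn-zeroWord r T g)
testFn-zeroWord r (false ∷ T) g = testFn-zeroWord r T g

-- `k` is a lower bound for the order of g. It grows by one with each factor y, that is with each
-- point of u outside T, and the hypothesis says that it ends above r.
testFn-high : ∀ r {n} (T u : Word n) g k → (∀ i → i ℕ.< k → g i ≡ 0ℤ) →
  r ℕ.+ wt (T ∩ u) ℕ.< k ℕ.+ wt u → testFn r T u g ≡ 0ℤ
testFn-high r [] [] g k van lt = van r (subst₂ ℕ._<_ (ℕₚ.+-identityʳ r) (ℕₚ.+-identityʳ k) lt)
testFn-high r (true ∷ T) (false ∷ u) g k van lt rewrite testFn-high r T u g k van lt = refl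
testFn-high r (true ∷ T) (true ∷ u) g k van lt rewrite testFn-high r T u g k van
  (ℕₚ.≤-pred (subst₂ ℕ._<_ (ℕₚ.+-suc r (wt (T ∩ u))) (ℕₚ.+-suc k (wt u)) lt)) = refl
testFn-high r (false ∷ T) (false ∷ u) g k van lt = testFn-high r T u g k van lt
testFn-high r (false ∷ T) (true ∷ u) g k van lt = testFn-high r T u (y ⊠ g) (suc k) van′
  (subst (r ℕ.+ wt (T ∩ u) ℕ.<_) (ℕₚ.+-suc k (wt u)) lt)
  where
  van′ : ∀ i → i ℕ.< suc k → (y ⊠ g) i ≡ 0ℤ
  van′ zero _ = y⊠-zero g
  van′ (suc i) (ℕ.s≤s lt) = trans (y⊠-suc g i) (van i lt)

opaque
  unfolding _↑_

  -- Here k = r - |u| + |T|. The case k = 0 is the one of a block through T with r = d - |T|, where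
  -- only the constant coefficient is read.
  testFn-inside : ∀ r {n} (T u : Word n) g k → T ⊆ᵇ u ≡ true → k ℕ.+ wt u ≡ r ℕ.+ wt T →
    testFn r T u g ≡ -[1+ 0 ] ↑ wt T ℤ.* g k
  testFn-inside r [] [] g k p q rewrite ℕₚ.+-identityʳ k | ℕₚ.+-identityʳ r | q = sym (ℤₚ.*-identityˡ (g r))
  testFn-inside r (true ∷ T) (true ∷ u) g k p q rewrite testFn-inside r T u g k p
    (ℕₚ.suc-injective (trans (sym (ℕₚ.+-suc k (wt u))) (trans q (ℕₚ.+-suc r (wt T))))) = sym
        (ℤₚ.*-assoc -[1+ 0 ] (-[1+ 0 ] ↑ wt T) (g k))
  testFn-inside r (false ∷ T) (false ∷ u) g k p q = testFn-inside r T u g k p q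
  testFn-inside r (false ∷ T) (true ∷ u) g k p q = trans
    (testFn-inside r T u (y ⊠ g) (suc k) p (trans (sym (ℕₚ.+-suc k (wt u))) q))
    (cong (λ z → -[1+ 0 ] ↑ wt T ℤ.* z) (y⊠-suc g k))

wt-∩≤ : ∀ {n} (T u : Word n) → wt (T ∩ u) ℕ.≤ wt T
wt-∩≤ [] [] = ℕ.z≤n
wt-∩≤ (true ∷ T) (true ∷ u) = ℕ.s≤s (wt-∩≤ T u)
wt-∩≤ (true ∷ T) (false ∷ u) = ℕₚ.m≤n⇒m≤1+n (wt-∩≤ T u)
wt-∩≤ (false ∷ T) (b ∷ u) = wt-∩≤ T u

wt-∩< : ∀ {n} (T u : Word n) → T ⊆ᵇ u ≡ false → wt (T ∩ u) ℕ.< wt T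
wt-∩< [] [] ()
wt-∩< (true ∷ T) (true ∷ u) p = ℕ.s≤s (wt-∩< T u p)
wt-∩< (true ∷ T) (false ∷ u) p = ℕ.s≤s (wt-∩≤ T u)
wt-∩< (false ∷ T) (true ∷ u) p = wt-∩< T u p
wt-∩< (false ∷ T) (false ∷ u) p = wt-∩< T u p

wt-⊕ : ∀ {n} (u v : Word n) → wt (u ⊕ v) ℕ.+ 2 ℕ.* wt (u ∩ v) ≡ wt u ℕ.+ wt v
wt-⊕ [] [] = refl
wt-⊕ (false ∷ u) (false ∷ v) = wt-⊕ u v
wt-⊕ (false ∷ u) (true ∷ v) = trans (cong suc (wt-⊕ u v)) (sym (ℕₚ.+-suc (wt u) (wt v)))
wt-⊕ (true ∷ u) (false ∷ v) = cong suc (wt-⊕ u v)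
wt-⊕ (true ∷ u) (true ∷ v) = begin
  wt (u ⊕ v) ℕ.+ 2 ℕ.* suc (wt (u ∩ v)) ≡⟨ cong (wt (u ⊕ v) ℕ.+_) (ℕₚ.*-suc 2 (wt (u ∩ v))) ⟩
  wt (u ⊕ v) ℕ.+ suc (suc (2 ℕ.* wt (u ∩ v))) ≡⟨ ℕₚ.+-suc (wt (u ⊕ v)) _ ⟩
  suc (wt (u ⊕ v) ℕ.+ suc (2 ℕ.* wt (u ∩ v))) ≡⟨ cong suc (ℕₚ.+-suc (wt (u ⊕ v)) _) ⟩
  suc (suc (wt (u ⊕ v) ℕ.+ 2 ℕ.* wt (u ∩ v))) ≡⟨ cong (suc ∘ suc) (wt-⊕ u v) ⟩
  suc (suc (wt u ℕ.+ wt v)) ≡⟨ cong suc (ℕₚ.+-suc (wt u) (wt v)) ⟨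
  suc (wt u ℕ.+ suc (wt v)) ∎
  where open ≡-Reasoning

wt-zeroWord : ∀ n → wt (zeroWord n) ≡ 0
wt-zeroWord zero = refl
wt-zeroWord (suc n) = wt-zeroWord n

wt≡0 : ∀ {n} (v : Word n) → wt v ≡ 0 → v ≡ zeroWord n
wt≡0 [] p = refl
wt≡0 (false ∷ v) p = cong (false ∷_) (wt≡0 v p)

ones : (n : ℕ) → Word n
ones n = replicate n true

compl-wt : ∀ {n} (v : Word n) → wt (ones n ⊕ v) ℕ.+ wt v ≡ n
compl-wt [] = refl
compl-wt (true ∷ v) = trans (ℕₚ.+-suc _ _) (cong suc (compl-wt v))
compl-wt (false ∷ v) = cong suc (compl-wt v)

⊆ᵇ-ones : ∀ {n} (T : Word n) → T ⊆ᵇ ones n ≡ true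
⊆ᵇ-ones [] = refl
⊆ᵇ-ones (true ∷ T) = ⊆ᵇ-ones T
⊆ᵇ-ones (false ∷ T) = ⊆ᵇ-ones T

⊕-zeroʳ : ∀ {n} (v : Word n) → v ⊕ zeroWord n ≡ v
⊕-zeroʳ [] = refl
⊕-zeroʳ (false ∷ v) = cong (false ∷_) (⊕-zeroʳ v)
⊕-zeroʳ (true ∷ v) = cong (true ∷_) (⊕-zeroʳ v)

subword : ∀ {n} (u : Word n) t → t ℕ.≤ wt u → ∃ λ e → (e ⊆ᵇ u ≡ true) × (wt e ≡ t)
subword [] zero _ = [] , refl , refl
subword (true ∷ u) zero _ with subword u 0 ℕ.z≤n
... | e , p , q = false ∷ e , p , q
subword (true ∷ u) (suc t) (ℕ.s≤s le) with subword u t le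
... | e , p , q = true ∷ e , p , cong suc q
subword (false ∷ u) t le with subword u t le
... | e , p , q = false ∷ e , p , q

==ℕ-refl : ∀ a → (a ==ℕ a) ≡ true
==ℕ-refl zero = refl
==ℕ-refl (suc a) = ==ℕ-refl a

==ℕ-≢ : ∀ a b → a ≢ b → (a ==ℕ b) ≡ false
==ℕ-≢ zero zero p = ⊥-elim (p refl)
==ℕ-≢ zero (suc b) p = refl
==ℕ-≢ (suc a) zero p = refl
==ℕ-≢ (suc a) (suc b) p = ==ℕ-≢ a b (p ∘ cong suc)

==ℕ-≡ : ∀ a b → (a ==ℕ b) ≡ true → a ≡ b
==ℕ-≡ zero zero p = refl
==ℕ-≡ (suc a) (suc b) p = cong suc (==ℕ-≡ a b p)

-- Inclusion-exclusion over the subsets of T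

-- Σ_{S ⊆ T} (−1)^|S| f S
alternate : ∀ {n} → Word n → (Word n → ℤ) → ℤ
alternate [] f = f []
alternate (false ∷ T) f = alternate T (f ∘ (false ∷_))
alternate (true ∷ T) f = alternate T (f ∘ (false ∷_)) ℤ.- alternate T (f ∘ (true ∷_))

alternate-cong : ∀ {n} (T : Word n) {f g : Word n → ℤ} → (∀ S → f S ≡ g S) → alternate T f ≡ alternate T g
alternate-cong [] p = p []
alternate-cong (false ∷ T) p = alternate-cong T (p ∘ (false ∷_))
alternate-cong (true ∷ T) p = cong₂ ℤ._-_ (alternate-cong T (p ∘ (false ∷_))) (alternate-cong T (p ∘ (true ∷_)))

alternate-∑ : ∀ {n k} (T : Word n) (f : Word n → Word k → ℤ) → alternate T (λ S → ∑ (f S)) ≡ ∑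
  (λ v → alternate T (λ S → f S v))
alternate-∑ [] f = refl
alternate-∑ (false ∷ T) f = alternate-∑ T (f ∘ (false ∷_))
alternate-∑ (true ∷ T) f = begin
  alternate T (λ S → ∑ (f (false ∷ S))) ℤ.- alternate T (λ S → ∑ (f (true ∷ S)))
    ≡⟨ cong₂ ℤ._-_ (alternate-∑ T (f ∘ (false ∷_))) (alternate-∑ T (f ∘ (true ∷_))) ⟩
  ∑ a ℤ.- ∑ b ≡⟨ solve 2 (λ a b → a :- b := a :+ con -[1+ 0 ] :* b) refl (∑ a) (∑ b) ⟩
  ∑ a ℤ.+ -[1+ 0 ] ℤ.* ∑ b ≡⟨ cong (λ z → ∑ a ℤ.+ z) (∑-* -[1+ 0 ] b) ⟨
  ∑ a ℤ.+ ∑ (λ v → -[1+ 0 ] ℤ.* b v) ≡⟨ ∑-+ a _ ⟨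
  ∑ (λ v → a v ℤ.+ -[1+ 0 ] ℤ.* b v)
    ≡⟨ ∑-cong (λ v → solve 2 (λ a b → a :+ con -[1+ 0 ] :* b := a :- b) refl (a v) (b v)) ⟩
  ∑ (λ v → a v ℤ.- b v) ∎
  where
  open ≡-Reasoning
  a b : Word _ → ℤ
  a v = alternate T (λ S → f (false ∷ S) v)
  b v = alternate T (λ S → f (true ∷ S) v)

alternate-* : ∀ {n} (T : Word n) c f → alternate T (λ S → c ℤ.* f S) ≡ c ℤ.* alternate T f
alternate-* [] c f = refl
alternate-* (false ∷ T) c f = alternate-* T c (f ∘ (false ∷_))
alternate-* (true ∷ T) c f rewrite alternate-* T c (f ∘ (false ∷_)) | alternate-* T c (f ∘ (true ∷_)) =
  solve 3 (λ c a b → c :* a :- c :* b := c :* (a :- b)) refl c (alternate T (f ∘ (false ∷_)))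
      (alternate T (f ∘ (true ∷_)))

alternate-0 : ∀ {n} (T : Word n) → alternate T (λ _ → 0ℤ) ≡ 0ℤ
alternate-0 [] = refl
alternate-0 (false ∷ T) = alternate-0 T
alternate-0 (true ∷ T) rewrite alternate-0 T = refl

-- The alternating sum detects that v misses T; this is written as an inclusion in the complement,
-- the form in which complements of blocks are counted.
alternate-⊆ : ∀ {n} (T v : Word n) → alternate T (λ S → ι (S ⊆ᵇ v)) ≡ ι (T ⊆ᵇ (ones n ⊕ v))
alternate-⊆ [] [] = refl
alternate-⊆ (false ∷ T) (b ∷ v) = alternate-⊆ T v
alternate-⊆ (true ∷ T) (false ∷ v) = trans (cong₂ ℤ._-_ (alternate-⊆ T v) (alternate-0 T)) (ℤₚ.+-identityʳ _)
alternate-⊆ (true ∷ T) (true ∷ v) = ℤₚ.+-inverseʳ (alternate T (λ S → ι (S ⊆ᵇ v)))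

alternateℕ : ℕ → (ℕ → ℤ) → ℤ
alternateℕ zero φ = φ 0
alternateℕ (suc t) φ = alternateℕ t φ ℤ.- alternateℕ t (φ ∘ suc)

alternate-below : ∀ {n} (T : Word n) f φ → (∀ S → wt S ℕ.≤ wt T → f S ≡ φ (wt S)) → alternate T f ≡ alternateℕ
  (wt T) φ
alternate-below [] f φ p = p [] ℕ.z≤n
alternate-below (false ∷ T) f φ p = alternate-below T (f ∘ (false ∷_)) φ (p ∘ (false ∷_))
alternate-below (true ∷ T) f φ p = cong₂ ℤ._-_
  (alternate-below T (f ∘ (false ∷_)) φ (λ S le → p (false ∷ S) (ℕₚ.m≤n⇒m≤1+n le)))
  (alternate-below T (f ∘ (true ∷_)) (φ ∘ suc) (λ S le → p (true ∷ S) (ℕ.s≤s le)))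

opaque
  unfolding _↑_

  -- T itself is the only subset at which f may differ from φ. In the application |T| = 7 and only
  -- smaller sets are known to have constant counts.
  alternate-top : ∀ {n} (T : Word n) f φ → (∀ S → wt S ℕ.< wt T → f S ≡ φ (wt S)) →
    alternate T f ≡ alternateℕ (wt T) φ ℤ.+ -[1+ 0 ] ↑ wt T ℤ.* (f T ℤ.- φ (wt T))
  alternate-top [] f φ p = solve 2 (λ a b → a := b :+ con 1ℤ :* (a :- b)) refl (f []) (φ 0)
  alternate-top (false ∷ T) f φ p = alternate-top T (f ∘ (false ∷_)) φ (p ∘ (false ∷_))
  alternate-top (true ∷ T) f φ p
    rewrite alternate-below T (f ∘ (false ∷_)) φ (λ S le → p (false ∷ S) (ℕ.s≤s le))
    | alternate-top T (f ∘ (true ∷_)) (φ ∘ suc) (λ S lt → p (true ∷ S) (ℕ.s≤s lt)) =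
    solve 4 (λ a b s z → a :- (b :+ s :* z) := a :- b :+ con -[1+ 0 ] :* s :* z) refl
      (alternateℕ (wt T) φ) (alternateℕ (wt T) (φ ∘ suc)) (-[1+ 0 ] ↑ wt T) (f (true ∷ T) ℤ.- φ (suc (wt T)))

-- Moments of the intersection of blocks with a fixed word

-- Σ f (T ∪ {x}) over the points x of W outside T
extend : ∀ {n} → Word n → Word n → (Word n → ℤ) → ℤ
extend [] [] f = 0ℤ
extend (true ∷ T) (w ∷ W) f = extend T W (f ∘ (true ∷_))
extend (false ∷ T) (true ∷ W) f = f (true ∷ T) ℤ.+ extend T W (f ∘ (false ∷_))
extend (false ∷ T) (false ∷ W) f = extend T W (f ∘ (false ∷_))

extend-∑ : ∀ {n k} (T W : Word n) (f : Word n → Word k → ℤ) → extend T W (λ S → ∑ (f S)) ≡ ∑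
  (λ v → extend T W (λ S → f S v))
extend-∑ [] [] f = sym (∑-0 _)
extend-∑ (true ∷ T) (w ∷ W) f = extend-∑ T W (f ∘ (true ∷_))
extend-∑ (false ∷ T) (true ∷ W) f = trans (cong (λ z → ∑ (f (true ∷ T)) ℤ.+ z) (extend-∑ T W (f ∘ (false ∷_))))
  (sym (∑-+ _ _))
extend-∑ (false ∷ T) (false ∷ W) f = extend-∑ T W (f ∘ (false ∷_))

extend-* : ∀ {n} (T W : Word n) f c → extend T W (λ S → f S ℤ.* c) ≡ extend T W f ℤ.* c
extend-* [] [] f c = refl
extend-* (true ∷ T) (w ∷ W) f c = extend-* T W (f ∘ (true ∷_)) c
extend-* (false ∷ T) (true ∷ W) f c rewrite extend-* T W (f ∘ (false ∷_)) c = sym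
  (ℤₚ.*-distribʳ-+ c (f (true ∷ T)) (extend T W (f ∘ (false ∷_))))
extend-* (false ∷ T) (false ∷ W) f c = extend-* T W (f ∘ (false ∷_)) c

extend-0 : ∀ {n} (T W : Word n) → extend T W (λ _ → 0ℤ) ≡ 0ℤ
extend-0 [] [] = refl
extend-0 (true ∷ T) (w ∷ W) = extend-0 T W
extend-0 (false ∷ T) (true ∷ W) rewrite extend-0 T W = refl
extend-0 (false ∷ T) (false ∷ W) = extend-0 T W

-- If T ⊆ v, the admissible points x are those of v ∩ W outside T; if not, there are none.
extend-⊆ : ∀ {n} (T W v : Word n) → T ⊆ᵇ W ≡ true →
  extend T W (λ S → ι (S ⊆ᵇ v)) ≡ ι (T ⊆ᵇ v) ℤ.* (+ wt (v ∩ W) ℤ.- + wt T)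
extend-⊆ [] [] [] p = refl
extend-⊆ (true ∷ T) (true ∷ W) (false ∷ v) p = extend-0 T W
extend-⊆ (true ∷ T) (true ∷ W) (true ∷ v) p = trans (extend-⊆ T W v p) (cong (λ z → ι (T ⊆ᵇ v) ℤ.* z)
  (solve 2 (λ a b → a :- b := (con 1ℤ :+ a) :- (con 1ℤ :+ b)) refl (+ wt (v ∩ W)) (+ wt T)))
extend-⊆ (false ∷ T) (true ∷ W) (false ∷ v) p = trans (ℤₚ.+-identityˡ _) (extend-⊆ T W v p)
extend-⊆ (false ∷ T) (true ∷ W) (true ∷ v) p = trans (cong (λ z → ι (T ⊆ᵇ v) ℤ.+ z) (extend-⊆ T W v p))
  (solve 3 (λ i a b → i :+ i :* (a :- b) := i :* ((con 1ℤ :+ a) :- b)) refl (ι (T ⊆ᵇ v)) (+ wt (v ∩ W)) (+ wt T))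
extend-⊆ (false ∷ T) (false ∷ W) (false ∷ v) p = extend-⊆ T W v p
extend-⊆ (false ∷ T) (false ∷ W) (true ∷ v) p = extend-⊆ T W v p

extend-const : ∀ {n} (T W : Word n) f c → T ⊆ᵇ W ≡ true →
  (∀ S → S ⊆ᵇ W ≡ true → wt S ≡ suc (wt T) → f S ≡ c) → extend T W f ≡ (+ wt W ℤ.- + wt T) ℤ.* c
extend-const [] [] f c p q = refl
extend-const (true ∷ T) (true ∷ W) f c p q = trans
  (extend-const T W (f ∘ (true ∷_)) c p (λ S s e → q (true ∷ S) s (cong suc e)))
  (cong (ℤ._* c) (solve 2 (λ a b → a :- b := (con 1ℤ :+ a) :- (con 1ℤ :+ b)) refl (+ wt W) (+ wt T)))
extend-const (false ∷ T) (true ∷ W) f c p q = trans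
  (cong₂ ℤ._+_ (q (true ∷ T) p refl) (extend-const T W (f ∘ (false ∷_)) c p (λ S s e → q (false ∷ S) s e)))
  (solve 3 (λ a b c → c :+ (a :- b) :* c := ((con 1ℤ :+ a) :- b) :* c) refl (+ wt W) (+ wt T) c)
extend-const (false ∷ T) (false ∷ W) f c p q = extend-const T W (f ∘ (false ∷_)) c p (λ S s e → q (false ∷ S) s e)

fall : ℤ → ℕ → ℤ
fall x zero = 1ℤ
fall x (suc k) = fall x k ℤ.* (x ℤ.- + k)

fall-suc : ∀ x k → fall x (suc k) ≡ x ℤ.* fall (x ℤ.- 1ℤ) k
fall-suc x zero = solve 1 (λ x → con 1ℤ :* (x :- con 0ℤ) := x :* con 1ℤ) refl x
fall-suc x (suc k) = trans (cong (ℤ._* (x ℤ.- + suc k)) (fall-suc x k))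
  (solve 3 (λ x f k → x :* f :* (x :- (con 1ℤ :+ k)) := x :* (f :* ((x :- con 1ℤ) :- k))) refl x (fall (x ℤ.- 1ℤ) k)
      (+ k))

-- Integrality of binomial coefficients, through (h+1)_(k+1) = (h)_(k+1) + (k+1)(h)_k for falling
-- factorials.
fall-∣ : ∀ h k → ∃ λ z → fall (+ h) k ≡ + (k !) ℤ.* z
fall-∣ h zero = 1ℤ , refl
fall-∣ zero (suc k) = 0ℤ , trans (fall-suc 0ℤ k) (sym (ℤₚ.*-zeroʳ (+ (suc k !))))
fall-∣ (suc h) (suc k) with fall-∣ h (suc k) | fall-∣ h k
... | z , p | w , q = z ℤ.+ w , (begin
  fall (+ suc h) (suc k) ≡⟨ fall-suc (+ suc h) k ⟩
  + suc h ℤ.* fall (+ h) k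
    ≡⟨ solve 3 (λ h k f → (con 1ℤ :+ h) :* f := f :* (h :- k) :+ (con 1ℤ :+ k) :* f) refl (+ h) (+ k) (fall (+ h) k) ⟩
  fall (+ h) (suc k) ℤ.+ + suc k ℤ.* fall (+ h) k ≡⟨ cong₂ (λ a b → a ℤ.+ + suc k ℤ.* b) p q ⟩
  + (suc k !) ℤ.* z ℤ.+ + suc k ℤ.* (+ (k !) ℤ.* w)
    ≡⟨ cong (λ a → a ℤ.* z ℤ.+ + suc k ℤ.* (+ (k !) ℤ.* w)) (ℤₚ.pos-* (suc k) (k !)) ⟩
  + suc k ℤ.* + (k !) ℤ.* z ℤ.+ + suc k ℤ.* (+ (k !) ℤ.* w)
    ≡⟨ solve 4 (λ a b z w → a :* b :* z :+ a :* (b :* w) := a :* b :* (z :+ w)) refl (+ suc k) (+ (k !)) z w ⟩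
  + suc k ℤ.* + (k !) ℤ.* (z ℤ.+ w) ≡⟨ cong (ℤ._* (z ℤ.+ w)) (ℤₚ.pos-* (suc k) (k !)) ⟨
  + (suc k !) ℤ.* (z ℤ.+ w) ∎)
  where open ≡-Reasoning

-- If μ j is the moment of fall i j, then evenMoment μ s j is that of fall i j * Π_{e<s} (i − 2e).
evenMoment : (ℕ → ℤ) → ℕ → ℕ → ℤ
evenMoment μ zero j = μ j
evenMoment μ (suc s) j = evenMoment μ s (suc j) ℤ.+ (+ j ℤ.- + (2 ℕ.* s)) ℤ.* evenMoment μ s j

evenMoment-cong : ∀ {μ ν} s j → (∀ i → i ℕ.≤ s ℕ.+ j → μ i ≡ ν i) → evenMoment μ s j ≡ evenMoment ν s j
evenMoment-cong zero j p = p j ℕₚ.≤-refl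
evenMoment-cong (suc s) j p = cong₂ (λ a b → a ℤ.+ (+ j ℤ.- + (2 ℕ.* s)) ℤ.* b)
  (evenMoment-cong s (suc j) (λ i le → p i (subst (i ℕ.≤_) (ℕₚ.+-suc s j) le)))
  (evenMoment-cong s j (λ i le → p i (ℕₚ.m≤n⇒m≤1+n le)))

evenMoment-∑ : ∀ {n} (b : Word n → ℤ) (μ : Word n → ℕ → ℤ) s j →
  evenMoment (λ i → ∑ (λ v → b v ℤ.* μ v i)) s j ≡ ∑ (λ v → b v ℤ.* evenMoment (μ v) s j)
evenMoment-∑ b μ zero j = refl
evenMoment-∑ b μ (suc s) j = begin
  evenMoment M s (suc j) ℤ.+ c ℤ.* evenMoment M s j
    ≡⟨ cong₂ (λ x y → x ℤ.+ c ℤ.* y) (evenMoment-∑ b μ s (suc j)) (evenMoment-∑ b μ s j) ⟩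
  ∑ p ℤ.+ c ℤ.* ∑ q ≡⟨ cong (λ z → ∑ p ℤ.+ z) (∑-* c q) ⟨
  ∑ p ℤ.+ ∑ (λ v → c ℤ.* q v) ≡⟨ ∑-+ p _ ⟨
  ∑ (λ v → p v ℤ.+ c ℤ.* q v)
    ≡⟨ ∑-cong (λ v → solve 4 (λ b c x y → b :* x :+ c :* (b :* y) := b :* (x :+ c :* y)) refl (b v) c
        (evenMoment (μ v) s (suc j)) (evenMoment (μ v) s j)) ⟩
  ∑ (λ v → b v ℤ.* evenMoment (μ v) (suc s) j) ∎
  where
  open ≡-Reasoning
  c = + j ℤ.- + (2 ℕ.* s)
  M : ℕ → ℤ
  M i = ∑ (λ v → b v ℤ.* μ v i)
  p q : Word _ → ℤ
  p v = b v ℤ.* evenMoment (μ v) s (suc j)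
  q v = b v ℤ.* evenMoment (μ v) s j

opaque
  unfolding _↑_

  -- At an even argument the factors 2h - 2e give 2^s (h)_s, and s! divides (h)_s: this is the
  -- source of the modulus 2^s s!. The induction uses 2h - 2s = (2h - j) + (j - 2s).
  evenMoment-fall : ∀ h s j → evenMoment (fall (+ (2 ℕ.* h))) s j ≡ (+ 2) ↑ s ℤ.* fall (+ h) s ℤ.* fall
      (+ (2 ℕ.* h)) j
  evenMoment-fall h zero j = solve 1 (λ a → a := con 1ℤ :* con 1ℤ :* a) refl (fall (+ (2 ℕ.* h)) j)
  evenMoment-fall h (suc s) j rewrite evenMoment-fall h s (suc j) | evenMoment-fall h s j
    | ℤₚ.pos-* 2 h | ℤₚ.pos-* 2 s =
    solve 6 (λ p f g h j s → p :* f :* (g :* (con (+ 2) :* h :- j)) :+ (j :- con (+ 2) :* s) :* (p :* f :* g)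
      := con (+ 2) :* p :* (f :* (h :- s)) :* g) refl ((+ 2) ↑ s) (fall (+ h) s) (fall (+ 2 ℤ.* + h) j) (+ h) (+ j)
          (+ s)

∑-∣ : ∀ {n} c (f : Word n → ℤ) → (∀ v → ∃ λ z → f v ≡ c ℤ.* z) → ∃ λ z → ∑ f ≡ c ℤ.* z
∑-∣ c f p = ∑ (proj₁ ∘ p) , trans (∑-cong (proj₂ ∘ p)) (∑-* c (proj₁ ∘ p))

module Blocks {n} (b : Word n → ℤ) where

  N : Word n → ℤ
  N T = ∑ (λ v → b v ℤ.* ι (T ⊆ᵇ v))

  extend-N : ∀ (T W : Word n) (ψ : Word n → ℤ) → T ⊆ᵇ W ≡ true →
    extend T W (λ S → ∑ (λ v → b v ℤ.* ι (S ⊆ᵇ v) ℤ.* ψ v)) ≡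
    ∑ (λ v → b v ℤ.* ι (T ⊆ᵇ v) ℤ.* ((+ wt (v ∩ W) ℤ.- + wt T) ℤ.* ψ v))
  extend-N T W ψ p = trans (extend-∑ T W _) (∑-cong (λ v → begin
    extend T W (λ S → b v ℤ.* ι (S ⊆ᵇ v) ℤ.* ψ v)
      ≡⟨ extend-* T W (λ S → b v ℤ.* ι (S ⊆ᵇ v)) (ψ v) ⟩
    extend T W (λ S → b v ℤ.* ι (S ⊆ᵇ v)) ℤ.* ψ v
      ≡⟨ cong (ℤ._* ψ v) (trans (extend-cong T W (λ S → ℤₚ.*-comm (b v) (ι (S ⊆ᵇ v))))
          (extend-* T W (λ S → ι (S ⊆ᵇ v)) (b v))) ⟩
    extend T W (λ S → ι (S ⊆ᵇ v)) ℤ.* b v ℤ.* ψ v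
      ≡⟨ cong (λ z → z ℤ.* b v ℤ.* ψ v) (extend-⊆ T W v p) ⟩
    ι (T ⊆ᵇ v) ℤ.* (+ wt (v ∩ W) ℤ.- + wt T) ℤ.* b v ℤ.* ψ v
      ≡⟨ solve 4 (λ i k b s → i :* k :* b :* s := b :* i :* (k :* s)) refl (ι (T ⊆ᵇ v)) (+ wt (v ∩ W) ℤ.- + wt T)
          (b v) (ψ v) ⟩
    b v ℤ.* ι (T ⊆ᵇ v) ℤ.* ((+ wt (v ∩ W) ℤ.- + wt T) ℤ.* ψ v) ∎))
    where
    open ≡-Reasoning
    extend-cong : ∀ {n} (T W : Word n) {f g : Word n → ℤ} → (∀ S → f S ≡ g S) → extend T W f ≡ extend T W g
    extend-cong [] [] p = refl
    extend-cong (true ∷ T) (w ∷ W) p = extend-cong T W (p ∘ (true ∷_))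
    extend-cong (false ∷ T) (true ∷ W) p = cong₂ ℤ._+_ (p (true ∷ T)) (extend-cong T W (p ∘ (false ∷_)))
    extend-cong (false ∷ T) (false ∷ W) p = extend-cong T W (p ∘ (false ∷_))

  module _ (W : Word n) (lam : ℕ → ℤ) where

    -- Double counting of blocks through T together with ordered j-tuples of distinct points of W in
    -- them, outside T. T is enlarged one point at a time, so constancy is needed for sets of size t
    -- + j only.
    fall-moment : ∀ j t (T : Word n) → (∀ S → wt S ≡ t ℕ.+ j → N S ≡ lam (t ℕ.+ j)) →
      wt T ≡ t → T ⊆ᵇ W ≡ true →
      ∑ (λ v → b v ℤ.* ι (T ⊆ᵇ v) ℤ.* fall (+ wt (v ∩ W) ℤ.- + t) j) ≡ fall (+ wt W ℤ.- + t) j ℤ.* lam (t ℕ.+ j)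
    fall-moment zero t T des wT T⊆W = trans (∑-cong (λ v → ℤₚ.*-identityʳ (b v ℤ.* ι (T ⊆ᵇ v))))
      (trans (des T (trans wT (sym (ℕₚ.+-identityʳ t)))) (sym (ℤₚ.*-identityˡ _)))
    fall-moment (suc j) t T des refl T⊆W = begin
      ∑ (λ v → b v ℤ.* ι (T ⊆ᵇ v) ℤ.* fall (+ wt (v ∩ W) ℤ.- + t) (suc j))
        ≡⟨ ∑-cong (λ v → cong (λ z → b v ℤ.* ι (T ⊆ᵇ v) ℤ.* z) (shift (+ wt (v ∩ W)))) ⟩
      ∑ (λ v → b v ℤ.* ι (T ⊆ᵇ v) ℤ.* ((+ wt (v ∩ W) ℤ.- + t) ℤ.* ψ v))
        ≡⟨ extend-N T W ψ T⊆W ⟨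
      extend T W (λ S → ∑ (λ v → b v ℤ.* ι (S ⊆ᵇ v) ℤ.* ψ v))
        ≡⟨ extend-const T W _ _ T⊆W (λ S S⊆W wS → fall-moment j (suc t) S des′ wS S⊆W) ⟩
      (+ wt W ℤ.- + t) ℤ.* (fall (+ wt W ℤ.- + suc t) j ℤ.* lam (suc t ℕ.+ j))
        ≡⟨ ℤₚ.*-assoc (+ wt W ℤ.- + t) (fall (+ wt W ℤ.- + suc t) j) (lam (suc t ℕ.+ j)) ⟨
      (+ wt W ℤ.- + t) ℤ.* fall (+ wt W ℤ.- + suc t) j ℤ.* lam (suc t ℕ.+ j)
        ≡⟨ cong₂ ℤ._*_ (sym (shift (+ wt W))) (cong lam (sym (ℕₚ.+-suc t j))) ⟩
      fall (+ wt W ℤ.- + t) (suc j) ℤ.* lam (t ℕ.+ suc j) ∎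
      where
      open ≡-Reasoning
      ψ : Word n → ℤ
      ψ v = fall (+ wt (v ∩ W) ℤ.- + suc t) j
      shift : ∀ x → fall (x ℤ.- + t) (suc j) ≡ (x ℤ.- + t) ℤ.* fall (x ℤ.- + suc t) j
      shift x = trans (fall-suc (x ℤ.- + t) j) (cong (λ z → (x ℤ.- + t) ℤ.* fall z j)
        (solve 2 (λ x t → x :- t :- con 1ℤ := x :- (con 1ℤ :+ t)) refl x (+ t)))
      des′ : ∀ S → wt S ≡ suc t ℕ.+ j → N S ≡ lam (suc t ℕ.+ j)
      des′ = subst (λ k → ∀ S → wt S ≡ k → N S ≡ lam k) (ℕₚ.+-suc t j) des

-- Parity of intersections, and weights that are 4 mod 8

odd : ℕ → Bool
odd zero = false
odd (suc k) = not (odd k)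

odd-even : ∀ h → odd (h ℕ.* 2) ≡ false
odd-even zero = refl
odd-even (suc h) = trans (not-involutive (odd (h ℕ.* 2))) (odd-even h)

even-half : ∀ k → odd k ≡ false → 2 ∣ k
even-half zero p = divides 0 refl
even-half (suc (suc k)) p with even-half k (trans (sym (not-involutive (odd k))) p)
... | divides h q = divides (suc h) (cong (suc ∘ suc) q)

dot-odd : ∀ {n} (u v : Word n) → dot u v ≡ odd (wt (u ∩ v))
dot-odd [] [] = refl
dot-odd (false ∷ u) (b ∷ v) = dot-odd u v
dot-odd (true ∷ u) (false ∷ v) = dot-odd u v
dot-odd (true ∷ u) (true ∷ v) = cong not (dot-odd u v)

dot-even : ∀ {n} (u v : Word n) → 2 ∣ wt (u ∩ v) → dot u v ≡ false
dot-even u v (divides h p) = trans (dot-odd u v) (trans (cong odd p) (odd-even h))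

∩-⊕ : ∀ {n} (x u v : Word n) → (x ∩ u) ⊕ (x ∩ v) ≡ x ∩ (u ⊕ v)
∩-⊕ [] [] [] = refl
∩-⊕ (false ∷ x) (a ∷ u) (b ∷ v) = cong (false ∷_) (∩-⊕ x u v)
∩-⊕ (true ∷ x) (a ∷ u) (b ∷ v) = cong ((a xor b) ∷_) (∩-⊕ x u v)

∩-∩ : ∀ {n} (x u v : Word n) → (x ∩ u) ∩ (x ∩ v) ≡ x ∩ (u ∩ v)
∩-∩ [] [] [] = refl
∩-∩ (false ∷ x) (a ∷ u) (b ∷ v) = cong (false ∷_) (∩-∩ x u v)
∩-∩ (true ∷ x) (a ∷ u) (b ∷ v) = cong ((a ∧ b) ∷_) (∩-∩ x u v)

wt-∩-comm : ∀ {n} (u v : Word n) → wt (u ∩ v) ≡ wt (v ∩ u)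
wt-∩-comm [] [] = refl
wt-∩-comm (false ∷ u) (false ∷ v) = wt-∩-comm u v
wt-∩-comm (false ∷ u) (true ∷ v) = wt-∩-comm u v
wt-∩-comm (true ∷ u) (false ∷ v) = wt-∩-comm u v
wt-∩-comm (true ∷ u) (true ∷ v) = cong suc (wt-∩-comm u v)

wt-∩-mono : ∀ {n} (e u x : Word n) → e ⊆ᵇ u ≡ true → wt (x ∩ e) ℕ.≤ wt (x ∩ u)
wt-∩-mono [] [] [] p = ℕ.z≤n
wt-∩-mono (a ∷ e) (b ∷ u) (false ∷ x) p = wt-∩-mono e u x (tail-⊆ a b p)
  where
  tail-⊆ : ∀ a b → (a ∷ e) ⊆ᵇ (b ∷ u) ≡ true → e ⊆ᵇ u ≡ true
  tail-⊆ false b p = p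
  tail-⊆ true true p = p
wt-∩-mono (true ∷ e) (true ∷ u) (true ∷ x) p = ℕ.s≤s (wt-∩-mono e u x p)
wt-∩-mono (false ∷ e) (true ∷ u) (true ∷ x) p = ℕₚ.m≤n⇒m≤1+n (wt-∩-mono e u x p)
wt-∩-mono (false ∷ e) (false ∷ u) (true ∷ x) p = wt-∩-mono e u x p

wt-∩-⊆ : ∀ {n} (e u x : Word n) → e ⊆ᵇ u ≡ true → u ⊆ᵇ x ≡ true → wt (x ∩ e) ≡ wt e
wt-∩-⊆ [] [] [] p q = refl
wt-∩-⊆ (true ∷ e) (true ∷ u) (true ∷ x) p q = cong suc (wt-∩-⊆ e u x p q)
wt-∩-⊆ (false ∷ e) (true ∷ u) (true ∷ x) p q = wt-∩-⊆ e u x p q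
wt-∩-⊆ (false ∷ e) (false ∷ u) (false ∷ x) p q = wt-∩-⊆ e u x p q
wt-∩-⊆ (false ∷ e) (false ∷ u) (true ∷ x) p q = wt-∩-⊆ e u x p q

-- If every weight were divisible by 8, then C would be closed under intersection,
-- and any two points of a word of minimum weight would form a codeword.
not-8-divisible : ∀ {n} (C : Code n) → IsLinear C → IsSelfDual C → ∀ d → 3 ℕ.≤ d → HasMinWeight C d →
  ¬ (∀ v → v ∈C C → 8 ∣ wt v)
not-8-divisible {n} C linear self-dual d 3≤d (min , u , u∈C , wt-u) eight with subword u 2
  (subst (2 ℕ.≤_) (sym wt-u) (ℕₚ.<⇒≤ 3≤d))
... | e , e⊆u , wt-e = ℕₚ.<⇒≱ 3≤d (subst (d ℕ.≤_) wt-e (min e e∈C e≢0))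
  where
  -- By |a ⊕ b| + 2|a ∩ b| = |a| + |b| each intersection costs one factor 2: words have 8, pairs 4,
  -- triples 2, and 2 is what orthogonality needs.
  half-∣ : ∀ k (a b : Word n) → 2 ℕ.* k ∣ wt a → 2 ℕ.* k ∣ wt b → 2 ℕ.* k ∣ wt (a ⊕ b) → k ∣ wt (a ∩ b)
  half-∣ k a b p q s = *-cancelˡ-∣ 2 (∣m+n∣m⇒∣n (subst (2 ℕ.* k ∣_) (sym (wt-⊕ a b)) (∣m∣n⇒∣m+n p q)) s)
  four : ∀ v w → v ∈C C → w ∈C C → 4 ∣ wt (v ∩ w)
  four v w v∈ w∈ = half-∣ 4 v w (eight v v∈) (eight w w∈) (eight (v ⊕ w) (proj₂ linear v w v∈ w∈))
  closed : ∀ v w → v ∈C C → w ∈C C → (v ∩ w) ∈C C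
  closed v w v∈ w∈ = Equivalence.from (self-dual (v ∩ w)) (λ x x∈ → dot-even x (v ∩ w)
    (subst (2 ∣_) (cong wt (∩-∩ x v w)) (half-∣ 2 (x ∩ v) (x ∩ w) (four x v x∈ v∈) (four x w x∈ w∈)
      (subst (4 ∣_) (cong wt (sym (∩-⊕ x v w))) (four x (v ⊕ w) x∈ (proj₂ linear v w v∈ w∈))))))
  -- u ∩ x is a codeword inside the minimum word u, hence empty or u itself, so x meets the pair e
  -- in 0 or 2 points.
  e-orth : ∀ x → x ∈C C → 2 ∣ wt (x ∩ e)
  e-orth x x∈ with wt (u ∩ x) ℕ.≟ 0
  ... | yes p = subst (2 ∣_) (sym (ℕₚ.n≤0⇒n≡0 (subst (wt (x ∩ e) ℕ.≤_) (trans (wt-∩-comm x u) p)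
      (wt-∩-mono e u x e⊆u)))) (divides 0 refl)
  ... | no p with u ⊆ᵇ x in ux
  ...   | true = subst (2 ∣_) (sym (trans (wt-∩-⊆ e u x e⊆u ux) wt-e)) (divides 1 refl)
  ...   | false = ⊥-elim (ℕₚ.<⇒≱ (wt-∩< u x ux) (subst (ℕ._≤ wt (u ∩ x)) (sym wt-u)
            (min (u ∩ x) (closed u x u∈C x∈) (λ z → p (trans (cong wt z) (wt-zeroWord n))))))
  e∈C : e ∈C C
  e∈C = Equivalence.from (self-dual e) (λ x x∈ → dot-even x e (e-orth x x∈))
  e≢0 : ¬ (e ≡ zeroWord n)
  e≢0 p with trans (sym wt-e) (trans (cong wt p) (wt-zeroWord n))
  ... | ()

-- Extremal codes

wt-ones : ∀ n → wt (ones n) ≡ n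
wt-ones zero = refl
wt-ones (suc n) = cong suc (wt-ones n)

∩-ones : ∀ {n} (v : Word n) → wt (v ∩ ones n) ≡ wt v
∩-ones [] = refl
∩-ones (true ∷ v) = cong suc (∩-ones v)
∩-ones (false ∷ v) = ∩-ones v

-- A representative s-set, on which λ_s can be read off before counts are known to be constant.
first : (n s : ℕ) → Word n
first zero s = []
first (suc n) zero = false ∷ first n zero
first (suc n) (suc s) = true ∷ first n s

wt-first : ∀ n s → s ℕ.≤ n → wt (first n s) ≡ s
wt-first zero zero _ = refl
wt-first (suc n) zero _ = wt-first n zero ℕ.z≤n
wt-first (suc n) (suc s) (ℕ.s≤s le) = cong suc (wt-first n s le)

-- `J` and `top` are the indices j for which d + 4j is n - d and n: the complements of blocks and
-- the all-one word.
module Extremal {n : ℕ} (C : Code n) (linear : IsLinear C) (self-dual : IsSelfDual C) (doubly-even : IsDoublyEven C)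
  (d : ℕ) (min-weight : HasMinWeight C d) (J top : ℕ) (4∣d : 4 ∣ d) (0<d : 0 ℕ.< d) (0<J : 0 ℕ.< J)
  (n≡d+4top : d ℕ.+ 4 ℕ.* top ≡ n) (n≡d+4J+d : d ℕ.+ 4 ℕ.* J ℕ.+ d ≡ n) where

  open Poisson C linear self-dual

  self-orthogonal : ∀ u v → u ∈C C → v ∈C C → 2 ∣ wt (u ∩ v)
  self-orthogonal u v u∈ v∈ = even-half _ (trans (sym (dot-odd u v)) (Equivalence.to (self-dual v) v∈ u u∈))

  ones∈C : ones n ∈C C
  ones∈C = Equivalence.from (self-dual (ones n)) (λ u u∈ → dot-even u (ones n)
    (subst (2 ∣_) (sym (∩-ones u)) (∣-trans (divides 2 refl) (doubly-even u u∈))))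

  d≤wt : ∀ v → v ∈C C → wt v ≢ 0 → d ℕ.≤ wt v
  d≤wt v v∈ v≢0 = proj₁ min-weight v v∈ (λ p → v≢0 (trans (cong wt p) (wt-zeroWord n)))

  d≤n : d ℕ.≤ n
  d≤n = subst (d ℕ.≤_) n≡d+4top (ℕₚ.m≤m+n d (4 ℕ.* top))

  weight-form : ∀ v → v ∈C C → wt v ≢ 0 → ∃ λ j → wt v ≡ d ℕ.+ 4 ℕ.* j
  weight-form v v∈ v≢0 with ∣m+n∣m⇒∣n (subst (4 ∣_) (sym eq) (doubly-even v v∈)) 4∣d
    where
    eq : d ℕ.+ (wt v ℕ.∸ d) ≡ wt v
    eq = ℕₚ.m+[n∸m]≡n (d≤wt v v∈ v≢0)
  ... | divides j p = j , trans (sym (ℕₚ.m+[n∸m]≡n (d≤wt v v∈ v≢0))) (cong (d ℕ.+_) (trans p (ℕₚ.*-comm j 4)))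

  data Class (v : Word n) (j : ℕ) : Set where
    all-ones : wt (ones n ⊕ v) ≡ 0 → j ≡ top → Class v j
    proper : wt (ones n ⊕ v) ≢ 0 → j ℕ.≤ J → Class v j

  -- The complement of v is a codeword too, so it is zero or has weight at least d.
  classify : ∀ v → v ∈C C → ∀ j → wt v ≡ d ℕ.+ 4 ℕ.* j → Class v j
  classify v v∈ j wv with wt (ones n ⊕ v) ℕ.≟ 0
  ... | yes p = all-ones p (ℕₚ.*-cancelˡ-≡ j top 4 (ℕₚ.+-cancelˡ-≡ d (4 ℕ.* j) (4 ℕ.* top)
         (trans (sym wv) (trans (trans (cong (ℕ._+ wt v) (sym p)) (compl-wt v)) (sym n≡d+4top)))))
  ... | no p = proper p (ℕₚ.*-cancelˡ-≤ 4 (ℕₚ.+-cancelˡ-≤ d (4 ℕ.* j) (4 ℕ.* J)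
         (ℕₚ.+-cancelʳ-≤ d (d ℕ.+ 4 ℕ.* j) (d ℕ.+ 4 ℕ.* J) (begin
           d ℕ.+ 4 ℕ.* j ℕ.+ d ≡⟨ cong (ℕ._+ d) wv ⟨
           wt v ℕ.+ d ≤⟨ ℕₚ.+-monoʳ-≤ (wt v) (d≤wt (ones n ⊕ v) (proj₂ linear (ones n) v ones∈C v∈) p) ⟩
           wt v ℕ.+ wt (ones n ⊕ v) ≡⟨ trans (ℕₚ.+-comm (wt v) _) (compl-wt v) ⟩
           n ≡⟨ n≡d+4J+d ⟨
           d ℕ.+ 4 ℕ.* J ℕ.+ d ∎))))
    where open ℕₚ.≤-Reasoning

  -- d + 4 J = n − d: the coblocks are the complements of the blocks.
  block coblock : Word n → ℤ
  block v = ι (C v ∧ (wt v ==ℕ d))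
  coblock v = ι (C v ∧ (wt v ==ℕ (d ℕ.+ 4 ℕ.* J)))

  open Blocks block
  open Blocks coblock using () renaming (N to N′)

  blocksThrough≡N : ∀ T → + blocksThrough C d T ≡ N T
  blocksThrough≡N T = trans (countᵇ-∑ _) (∑-cong (λ v → trans
    (cong ι (sym (∧-assoc (C v) (wt v ==ℕ d) (T ⊆ᵇ v)))) (ι-∧ (C v ∧ (wt v ==ℕ d)) (T ⊆ᵇ v))))

  coblock-ones : ∀ v → coblock (ones n ⊕ v) ≡ block v
  coblock-ones v = cong ι (cong₂ _∧_ (C-translate (ones n) v ones∈C) (wt-eq (wt v ℕ.≟ d)))
    where
    sum-eq : wt (ones n ⊕ v) ℕ.+ wt v ≡ d ℕ.+ 4 ℕ.* J ℕ.+ d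
    sum-eq = trans (compl-wt v) (sym n≡d+4J+d)
    wt-eq : Dec (wt v ≡ d) → (wt (ones n ⊕ v) ==ℕ (d ℕ.+ 4 ℕ.* J)) ≡ (wt v ==ℕ d)
    wt-eq (yes p) = trans (cong (_==ℕ (d ℕ.+ 4 ℕ.* J)) (ℕₚ.+-cancelʳ-≡ d _ _
        (trans (cong (wt (ones n ⊕ v) ℕ.+_) (sym p)) sum-eq)))
      (trans (==ℕ-refl (d ℕ.+ 4 ℕ.* J)) (sym (trans (cong (_==ℕ d) p) (==ℕ-refl d))))
    wt-eq (no p) = trans (==ℕ-≢ _ _ (λ q → p (ℕₚ.+-cancelˡ-≡ (d ℕ.+ 4 ℕ.* J) _ _
        (trans (cong (ℕ._+ wt v) (sym q)) sum-eq))))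
      (sym (==ℕ-≢ _ _ p))

  -- Translation by the all-one word exchanges blocks and coblocks, and the complement of a block
  -- contains T exactly when the block misses T.
  N′-alternate : ∀ T → N′ T ≡ alternate T N
  N′-alternate T = begin
    ∑ (λ v → coblock v ℤ.* ι (T ⊆ᵇ v))
      ≡⟨ ∑-translate (ones n) (λ v → coblock v ℤ.* ι (T ⊆ᵇ v)) ⟨
    ∑ (λ v → coblock (ones n ⊕ v) ℤ.* ι (T ⊆ᵇ (ones n ⊕ v)))
      ≡⟨ ∑-cong (λ v → cong₂ ℤ._*_ (coblock-ones v) (sym (alternate-⊆ T v))) ⟩
    ∑ (λ v → block v ℤ.* alternate T (λ S → ι (S ⊆ᵇ v)))
      ≡⟨ ∑-cong (λ v → sym (alternate-* T (block v) (λ S → ι (S ⊆ᵇ v)))) ⟩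
    ∑ (λ v → alternate T (λ S → block v ℤ.* ι (S ⊆ᵇ v)))
      ≡⟨ alternate-∑ T (λ S v → block v ℤ.* ι (S ⊆ᵇ v)) ⟨
    alternate T N ∎
    where open ≡-Reasoning

  -- Here |T| = t + 1 > 0, so the zero word does not contain T and every codeword through T has a
  -- weight d + 4j. The exponents are A = d - |T| and B = n - d.
  module Moment (t r A B : ℕ) (A+t : A ℕ.+ suc t ≡ d) (B+d : B ℕ.+ d ≡ n)
    (G-mid : ∀ j → suc j ℕ.< J → G r (suc j) ≡ 0ℤ) (T : Word n) (wtT : wt T ≡ suc t) where

    h : Series
    h = testSeries A B r

    two : ℤ
    two = (+ 2) ↑ suc t

    transform-value : ∀ v j → T ⊆ᵇ v ≡ true → wt v ≡ d ℕ.+ 4 ℕ.* j → transform r T v h ≡ two ℤ.* G r j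
    transform-value v j T⊆v wv = trans
      (transform-inside r T v h (A ℕ.+ 4 ℕ.* j) e T⊆v A-eq (trans (ℕₚ.+-comm e (wt v)) eq))
      (cong₂ (λ k z → (+ 2) ↑ k ℤ.* z) wtT (testSeries-value A B r j e B-eq))
      where
      e = n ℕ.∸ wt v
      eq : wt v ℕ.+ e ≡ n
      eq = ℕₚ.m+[n∸m]≡n (wt≤n v)
      A-eq : A ℕ.+ 4 ℕ.* j ℕ.+ wt T ≡ wt v
      A-eq = trans (cong (A ℕ.+ 4 ℕ.* j ℕ.+_) wtT) (trans
        (solveⁿ 3 (λ a b c → a :+ⁿ b :+ⁿ c :=ⁿ a :+ⁿ c :+ⁿ b) refl A (4 ℕ.* j) (suc t))
        (trans (cong (ℕ._+ 4 ℕ.* j) A+t) (sym wv)))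
      B-eq : e ℕ.+ 4 ℕ.* j ≡ B
      B-eq = ℕₚ.+-cancelʳ-≡ d _ _ (trans (solveⁿ 3 (λ e j d → e :+ⁿ j :+ⁿ d :=ⁿ (d :+ⁿ j) :+ⁿ e) refl e (4 ℕ.* j) d)
        (trans (cong (ℕ._+ e) (sym wv)) (trans eq (sym B+d))))

    -- The classes of codewords through T that survive in the transform: j = 0, `J` and `top`, each
    -- with its residue.
    value : Word n → ℤ
    value v = (+ 8) ↑ r ℤ.* (block v ℤ.* ι (T ⊆ᵇ v)) ℤ.+ G r J ℤ.* (coblock v ℤ.* ι (T ⊆ᵇ v))
      ℤ.+ G r top ℤ.* ι (wt (ones n ⊕ v) ==ℕ 0)

    not-ones : ∀ v → (C v ≡ false ⊎ T ⊆ᵇ v ≡ false) → (wt (ones n ⊕ v) ==ℕ 0) ≡ false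
    not-ones v bad = ==ℕ-≢ _ _ (λ p → contra bad (trans (sym (⊕-self (ones n) v))
      (trans (cong (ones n ⊕_) (wt≡0 (ones n ⊕ v) p)) (⊕-zeroʳ (ones n)))))
      where
      contra : (C v ≡ false ⊎ T ⊆ᵇ v ≡ false) → v ≡ ones n → ⊥
      contra (inj₁ p) q with trans (sym p) (trans (cong C q) ones∈C)
      ... | ()
      contra (inj₂ p) q with trans (sym p) (trans (cong (T ⊆ᵇ_) q) (⊆ᵇ-ones T))
      ... | ()

    4J≢0 : 4 ℕ.* J ≢ 0
    4J≢0 p = ℕₚ.<⇒≢ (ℕₚ.*-monoʳ-< 4 0<J) (sym p)

    top≢0 : top ≢ 0
    top≢0 p = 4J≢0 (ℕₚ.m+n≡0⇒m≡0 (4 ℕ.* J) (ℕₚ.+-cancelˡ-≡ d _ _ (trans (sym (ℕₚ.+-assoc d (4 ℕ.* J) d))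
      (trans n≡d+4J+d (trans (sym n≡d+4top) (cong (λ z → d ℕ.+ 4 ℕ.* z) p))))))

    not-d : ∀ w j → j ≢ 0 → w ≡ d ℕ.+ 4 ℕ.* j → (w ==ℕ d) ≡ false
    not-d w zero j≢0 wv = ⊥-elim (j≢0 refl)
    not-d w (suc j) _ wv = ==ℕ-≢ w d (λ q → ℕₚ.m+1+n≢m d (trans (sym wv) q))

    not-complementary : ∀ w j → j ≢ J → w ≡ d ℕ.+ 4 ℕ.* j → (w ==ℕ (d ℕ.+ 4 ℕ.* J)) ≡ false
    not-complementary w j j≢J wv = ==ℕ-≢ w (d ℕ.+ 4 ℕ.* J)
        (λ q → j≢J (ℕₚ.*-cancelˡ-≡ j J 4 (ℕₚ.+-cancelˡ-≡ d _ _ (trans (sym wv) q))))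

    top≢J : top ≢ J
    top≢J p = ℕₚ.<⇒≢ 0<d (ℕₚ.+-cancelˡ-≡ (d ℕ.+ 4 ℕ.* J) 0 d
      (trans (ℕₚ.+-identityʳ (d ℕ.+ 4 ℕ.* J)) (trans (cong (λ z → d ℕ.+ 4 ℕ.* z) (sym p))
          (trans n≡d+4top (sym n≡d+4J+d)))))

    value-≡ : ∀ v {a b c} → C v ≡ true → T ⊆ᵇ v ≡ true → (wt v ==ℕ d) ≡ a → (wt v ==ℕ (d ℕ.+ 4 ℕ.* J)) ≡ b →
      (wt (ones n ⊕ v) ==ℕ 0) ≡ c → value v ≡ (+ 8) ↑ r ℤ.* ι a ℤ.+ G r J ℤ.* ι b ℤ.+ G r top ℤ.* ι c
    value-≡ v {a} {b} {c} Cv Tv p q s = cong₂ ℤ._+_ (cong₂ ℤ._+_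
      (cong ((+ 8) ↑ r ℤ.*_) (indicator p)) (cong (G r J ℤ.*_) (indicator q))) (cong (λ z → G r top ℤ.* ι z) s)
      where
      indicator : ∀ {i k} → i ≡ k → ι (C v ∧ i) ℤ.* ι (T ⊆ᵇ v) ≡ ι k
      indicator {k = k} refl = trans (cong₂ (λ x y → ι (x ∧ k) ℤ.* ι y) Cv Tv) (ℤₚ.*-identityʳ (ι k))

    inside : ∀ v j → C v ≡ true → T ⊆ᵇ v ≡ true → wt v ≡ d ℕ.+ 4 ℕ.* j → transform r T v h ≡ two ℤ.* value v
    inside v j Cv Tv wv = trans (transform-value v j Tv wv) (cong (two ℤ.*_) (by-class (classify v Cv j wv)))
      where
      by-class : Class v j → G r j ≡ value v
      by-class (all-ones p refl) = sym (trans
        (value-≡ v Cv Tv (not-d (wt v) j top≢0 wv) (not-complementary (wt v) j top≢J wv) (cong (_==ℕ 0) p))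
        (solve 3 (λ a b c → a :* con 0ℤ :+ b :* con 0ℤ :+ c :* con 1ℤ := c) refl ((+ 8) ↑ r) (G r J) (G r j)))
      by-class (proper p j≤J) with ℕₚ.m≤n⇒m<n∨m≡n j≤J
      ... | inj₂ refl = sym (trans
        (value-≡ v Cv Tv (not-d (wt v) j (λ q → ℕₚ.<⇒≢ 0<J (sym q)) wv)
            (trans (cong (_==ℕ (d ℕ.+ 4 ℕ.* j)) wv) (==ℕ-refl (d ℕ.+ 4 ℕ.* j))) (==ℕ-≢ _ 0 p))
        (solve 3 (λ a b c → a :* con 0ℤ :+ b :* con 1ℤ :+ c :* con 0ℤ := b) refl ((+ 8) ↑ r) (G r j) (G r top)))
      ... | inj₁ j<J = below j refl j<J
        where
        below : ∀ k → j ≡ k → k ℕ.< J → G r j ≡ value v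
        below zero refl j<J = trans (G-first r) (sym (trans
          (value-≡ v Cv Tv (trans (cong (_==ℕ d) (trans wv (ℕₚ.+-identityʳ d))) (==ℕ-refl d))
              (not-complementary (wt v) 0 (ℕₚ.<⇒≢ 0<J) wv) (==ℕ-≢ _ 0 p))
          (solve 3 (λ a b c → a :* con 1ℤ :+ b :* con 0ℤ :+ c :* con 0ℤ := a) refl ((+ 8) ↑ r) (G r J) (G r top))))
        below (suc k) refl j<J = trans (G-mid k j<J) (sym (trans
          (value-≡ v Cv Tv (not-d (wt v) (suc k) (λ ()) wv) (not-complementary (wt v) (suc k) (ℕₚ.<⇒≢ j<J) wv)
              (==ℕ-≢ _ 0 p))
          (solve 3 (λ a b c → a :* con 0ℤ :+ b :* con 0ℤ :+ c :* con 0ℤ := con 0ℤ) refl ((+ 8) ↑ r) (G r J)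
              (G r top))))

    outside : ∀ v → (C v ≡ false ⊎ T ⊆ᵇ v ≡ false) → value v ≡ 0ℤ
    outside v bad = trans (cong₂ ℤ._+_ (cong₂ ℤ._+_
        (cong ((+ 8) ↑ r ℤ.*_) (vanish (wt v ==ℕ d) bad)) (cong (G r J ℤ.*_) (vanish (wt v ==ℕ (d ℕ.+ 4 ℕ.* J)) bad)))
        (cong (λ z → G r top ℤ.* ι z) (not-ones v bad)))
      (solve 3 (λ a b c → a :* con 0ℤ :+ b :* con 0ℤ :+ c :* con 0ℤ := con 0ℤ) refl ((+ 8) ↑ r) (G r J) (G r top))
      where
      vanish : ∀ i → (C v ≡ false ⊎ T ⊆ᵇ v ≡ false) → ι (C v ∧ i) ℤ.* ι (T ⊆ᵇ v) ≡ 0ℤ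
      vanish i (inj₁ p) = cong (λ x → ι (x ∧ i) ℤ.* ι (T ⊆ᵇ v)) p
      vanish i (inj₂ p) = trans (cong (λ x → ι (C v ∧ i) ℤ.* ι x) p) (ℤₚ.*-zeroʳ (ι (C v ∧ i)))

    pointwise : ∀ v → ι (C v) ℤ.* transform r T v h ≡ two ℤ.* value v
    pointwise v = go (C v) refl (T ⊆ᵇ v) refl
      where
      vanishing : ∀ {x} → x ≡ 0ℤ → (C v ≡ false ⊎ T ⊆ᵇ v ≡ false) → x ≡ two ℤ.* value v
      vanishing p bad = trans p (sym (trans (cong (two ℤ.*_) (outside v bad)) (ℤₚ.*-zeroʳ two)))
      go : ∀ c → C v ≡ c → ∀ i → T ⊆ᵇ v ≡ i → ι (C v) ℤ.* transform r T v h ≡ two ℤ.* value v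
      go false Cv i Tv = vanishing (cong (λ c → ι c ℤ.* transform r T v h) Cv) (inj₁ Cv)
      go true Cv false Tv = vanishing (trans (cong (ι (C v) ℤ.*_) (transform-outside r T v h Tv))
          (ℤₚ.*-zeroʳ (ι (C v)))) (inj₂ Tv)
      go true Cv true Tv with weight-form v Cv (λ p → ℕₚ.<⇒≱ (ℕ.s≤s (ℕ.z≤n {t})) (subst₂ ℕ._≤_ wtT p (⊆ᵇ-wt T v Tv)))
      ... | j , wv = trans (trans (cong (λ c → ι c ℤ.* transform r T v h) Cv) (ℤₚ.*-identityˡ _))
          (inside v j Cv Tv wv)

    ∑-ones : ∑ (λ v → ι (wt (ones n ⊕ v) ==ℕ 0)) ≡ 1ℤ
    ∑-ones = trans (∑-translate (ones n) (λ v → ι (wt v ==ℕ 0)))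
      (trans (∑-cong (λ v → sym (ℤₚ.*-identityʳ (ι (wt v ==ℕ 0))))) (∑-weight-zero (λ _ → 1ℤ)))

    moment : size ℤ.* ∑ (λ u → ι (C u) ℤ.* testFn r T u h) ≡
      two ℤ.* ((+ 8) ↑ r ℤ.* N T ℤ.+ G r J ℤ.* N′ T ℤ.+ G r top)
    moment = begin
      size ℤ.* ∑ (λ u → ι (C u) ℤ.* testFn r T u h)
        ≡⟨ poisson (λ u → testFn r T u h) ⟩
      ∑ (λ v → ι (C v) ℤ.* ∑ (λ u → sgn (dot v u) ℤ.* testFn r T u h))
        ≡⟨ ∑-cong (λ v → trans (cong (λ z → ι (C v) ℤ.* z) (transform-correct r T v h)) (pointwise v)) ⟩
      ∑ (λ v → two ℤ.* value v) ≡⟨ ∑-* two value ⟩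
      two ℤ.* ∑ value
        ≡⟨ cong (two ℤ.*_) (trans (∑-+ _ _) (cong₂ ℤ._+_
             (trans (∑-+ _ _) (cong₂ ℤ._+_ (∑-* ((+ 8) ↑ r) _) (∑-* (G r J) _)))
             (trans (∑-* (G r top) _) (trans (cong (G r top ℤ.*_) ∑-ones) (ℤₚ.*-identityʳ _))))) ⟩
      two ℤ.* ((+ 8) ↑ r ℤ.* N T ℤ.+ G r J ℤ.* N′ T ℤ.+ G r top) ∎
      where open ≡-Reasoning

    testFn-vanishes : ∀ u → u ∈C C → wt u ≢ 0 → r ℕ.+ wt (T ∩ u) ℕ.< d → testFn r T u h ≡ 0ℤ
    testFn-vanishes u u∈ u≢0 lt = testFn-high r T u h 0 (λ _ ()) (ℕₚ.<-≤-trans lt (d≤wt u u∈ u≢0))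

    testFn-origin : ∀ u → C u ≡ true → wt u ≡ 0 → testFn r T u h ≡ h r
    testFn-origin u _ p = trans (cong (λ w → testFn r T w h) (wt≡0 u p)) (testFn-zeroWord r T h)

    origin-only : ∀ (g : Word n → ℤ) → ∑ (λ u → ι (wt u ==ℕ 0) ℤ.* h r ℤ.+ g u) ≡ h r ℤ.+ ∑ g
    origin-only g = trans (∑-+ _ g) (cong (ℤ._+ ∑ g) (∑-weight-zero (λ _ → h r)))

    nonzero : ∀ u → C u ≡ false → (wt u ==ℕ 0) ≡ false
    nonzero u Cu = ==ℕ-≢ (wt u) 0 (λ p → absurd (trans (sym Cu) (trans (cong C (wt≡0 u p)) (proj₁ linear))))
      where
      absurd : false ≢ true
      absurd ()

    -- A nonzero codeword has at least d - |T| > r points outside T.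
    lhs-strict : r ℕ.+ suc t ℕ.< d → ∑ (λ u → ι (C u) ℤ.* testFn r T u h) ≡ h r
    lhs-strict lt = trans (∑-cong (λ u → go u (C u) refl))
      (trans (origin-only (λ _ → 0ℤ)) (trans (cong (λ z → h r ℤ.+ z) (∑-0 n)) (ℤₚ.+-identityʳ (h r))))
      where
      go : ∀ u c → C u ≡ c → ι c ℤ.* testFn r T u h ≡ ι (wt u ==ℕ 0) ℤ.* h r ℤ.+ 0ℤ
      go u false Cu = sym (cong (λ z → ι z ℤ.* h r ℤ.+ 0ℤ) (nonzero u Cu))
      go u true Cu with wt u ℕ.≟ 0
      ... | yes p = trans (cong (1ℤ ℤ.*_) (testFn-origin u Cu p))
          (trans (sym (ℤₚ.+-identityʳ _)) (cong (λ z → ι (z ==ℕ 0) ℤ.* h r ℤ.+ 0ℤ) (sym p)))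
      ... | no p = trans (cong (1ℤ ℤ.*_) (testFn-vanishes u Cu p
          (ℕₚ.≤-<-trans (ℕₚ.+-monoʳ-≤ r (subst (wt (T ∩ u) ℕ.≤_) wtT (wt-∩≤ T u))) lt)))
                     (sym (cong (λ z → ι z ℤ.* h r ℤ.+ 0ℤ) (==ℕ-≢ (wt u) 0 p)))

    -- Now the blocks through T, and no other nonzero codewords, have as few as r points outside T;
    -- each contributes (-1)^|T| times the constant coefficient 1 of `h`.
    lhs-tight : r ℕ.+ suc t ≡ d → ∑ (λ u → ι (C u) ℤ.* testFn r T u h) ≡ h r ℤ.+ -[1+ 0 ] ↑ suc t ℤ.* N T
    lhs-tight eq = trans (∑-cong (λ u → go u (C u) refl))
      (trans (origin-only _) (cong (λ z → h r ℤ.+ z) (∑-* s (λ u → block u ℤ.* ι (T ⊆ᵇ u)))))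
      where
      s = -[1+ 0 ] ↑ suc t
      zero-rhs : ∀ {a c i} → a ≡ false → c ≡ false ⊎ i ≡ false → ι a ℤ.* h r ℤ.+ s ℤ.* (ι c ℤ.* ι i) ≡ 0ℤ
      zero-rhs {i = i} refl (inj₁ refl) = solve 3 (λ h s i → con 0ℤ :* h :+ s :* (con 0ℤ :* i) := con 0ℤ) refl (h r)
          s (ι i)
      zero-rhs {c = c} refl (inj₂ refl) = solve 3 (λ h s i → con 0ℤ :* h :+ s :* (i :* con 0ℤ) := con 0ℤ) refl (h r)
          s (ι c)
      block≡ : ∀ u {c i} → C u ≡ c → (wt u ==ℕ d) ≡ i → C u ∧ (wt u ==ℕ d) ≡ c ∧ i
      block≡ u = cong₂ _∧_
      go : ∀ u c → C u ≡ c → ι c ℤ.* testFn r T u h ≡ ι (wt u ==ℕ 0) ℤ.* h r ℤ.+ s ℤ.* (block u ℤ.* ι (T ⊆ᵇ u))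
      go u false Cu = sym (zero-rhs (nonzero u Cu) (inj₁ (cong (_∧ (wt u ==ℕ d)) Cu)))
      go u true Cu with wt u ℕ.≟ 0
      ... | yes p = trans (cong (1ℤ ℤ.*_) (testFn-origin u Cu p)) (sym (trans
              (cong₂ (λ a c → ι a ℤ.* h r ℤ.+ s ℤ.* (ι c ℤ.* ι (T ⊆ᵇ u))) (cong (_==ℕ 0) p)
                (block≡ u Cu (trans (cong (_==ℕ d) p) (==ℕ-≢ 0 d (ℕₚ.<⇒≢ 0<d)))))
              (solve 3 (λ h s i → con 1ℤ :* h :+ s :* (con 0ℤ :* i) := con 1ℤ :* h) refl (h r) s (ι (T ⊆ᵇ u)))))
      ... | no p with T ⊆ᵇ u in Tu
      ...   | false = trans (cong (1ℤ ℤ.*_) (testFn-vanishes u Cu p (subst (r ℕ.+ wt (T ∩ u) ℕ.<_) eq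
                        (ℕₚ.+-monoʳ-< r (subst (wt (T ∩ u) ℕ.<_) wtT (wt-∩< T u Tu))))))
                        (sym (zero-rhs {c = C u ∧ (wt u ==ℕ d)} (==ℕ-≢ (wt u) 0 p) (inj₂ refl)))
      ...   | true with wt u ℕ.≟ d
      ...     | yes q = trans (cong (1ℤ ℤ.*_) (trans (testFn-inside r T u h 0 Tu
          (trans q (trans (sym eq) (cong (r ℕ.+_) (sym wtT)))))
                          (cong₂ (λ k z → -[1+ 0 ] ↑ k ℤ.* z) wtT (testSeries-zero A B r))))
                        (sym (trans (cong₂ (λ a c → ι a ℤ.* h r ℤ.+ s ℤ.* (ι c ℤ.* 1ℤ)) (==ℕ-≢ (wt u) 0 p)
                            (block≡ u Cu (trans (cong (_==ℕ d) q) (==ℕ-refl d))))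
                          (solve 2 (λ h s → con 0ℤ :* h :+ s :* (con 1ℤ :* con 1ℤ) := con 1ℤ :* (s :* con 1ℤ)) refl
                              (h r) s)))
      ...     | no q = trans (cong (1ℤ ℤ.*_) (testFn-high r T u h 0 (λ _ ()) (ℕₚ.≤-<-trans
                          (subst (r ℕ.+ wt (T ∩ u) ℕ.≤_) eq
                              (ℕₚ.+-monoʳ-≤ r (subst (wt (T ∩ u) ℕ.≤_) wtT (wt-∩≤ T u))))
                          (ℕₚ.≤∧≢⇒< (d≤wt u Cu p) (q ∘ sym)))))
                        (sym (zero-rhs {i = true} (==ℕ-≢ (wt u) 0 p) (inj₁ (block≡ u Cu (==ℕ-≢ (wt u) d q)))))

  lam : ℕ → ℕ
  lam s = blocksThrough C d (first n s)

  Balanced : ℕ → Set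
  Balanced s = ∀ S → wt S ≡ s → N S ≡ + lam s

  design⇒balanced : ∀ s → IsTDesign C d s → Balanced s
  design⇒balanced s (s≤d , ℓ , p) S wS = trans (sym (blocksThrough≡N S)) (cong +_
    (trans (p S wS) (sym (p (first n s) (wt-first n s (ℕₚ.≤-trans s≤d d≤n))))))

  balanced⇒design : ∀ s → s ℕ.≤ d → Balanced s → IsTDesign C d s
  balanced⇒design s s≤d p = s≤d , lam s , λ T wT → ℤₚ.+-injective (trans (blocksThrough≡N T) (p T wT))

  block-weight : ∀ v (f : ℕ → ℤ) → block v ℤ.* f (wt v) ≡ block v ℤ.* f d
  block-weight v f with wt v ==ℕ d in eq
  ... | true = cong (λ w → ι (C v ∧ true) ℤ.* f w) (==ℕ-≡ (wt v) d eq)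
  ... | false with C v
  ...   | true = refl
  ...   | false = refl

  -- The case j = 1 of `fall-moment` with W the set of all points; `block-weight` replaces the size
  -- of a block by d.
  point-count : ∀ s → Balanced (suc s) → ∀ T → wt T ≡ s →
    (+ d ℤ.- + s) ℤ.* N T ≡ (+ n ℤ.- + s) ℤ.* + lam (suc s)
  point-count s bal T wT = begin
    (+ d ℤ.- + s) ℤ.* N T ≡⟨ ∑-* (+ d ℤ.- + s) _ ⟨
    ∑ (λ v → (+ d ℤ.- + s) ℤ.* (block v ℤ.* ι (T ⊆ᵇ v)))
      ≡⟨ ∑-cong (λ v → trans (solve 3 (λ k b i → k :* (b :* i) := b :* k :* i) refl (+ d ℤ.- + s) (block v)
          (ι (T ⊆ᵇ v)))
           (trans (cong (ℤ._* ι (T ⊆ᵇ v)) (trans (sym (block-weight v (λ w → + w ℤ.- + s)))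
               (cong (λ w → block v ℤ.* (+ w ℤ.- + s)) (sym (∩-ones v)))))
           (solve 4 (λ b w s i → b :* (w :- s) :* i := b :* i :* (con 1ℤ :* ((w :- s) :- con 0ℤ))) refl (block v)
               (+ wt (v ∩ ones n)) (+ s) (ι (T ⊆ᵇ v))))) ⟩
    ∑ (λ v → block v ℤ.* ι (T ⊆ᵇ v) ℤ.* fall (+ wt (v ∩ ones n) ℤ.- + s) 1)
      ≡⟨ fall-moment (ones n) (λ i → + lam i) 1 s T bal′ wT (⊆ᵇ-ones T) ⟩
    fall (+ wt (ones n) ℤ.- + s) 1 ℤ.* + lam (s ℕ.+ 1)
      ≡⟨ cong₂ (λ w i → fall (+ w ℤ.- + s) 1 ℤ.* + lam i) (wt-ones n) (ℕₚ.+-comm s 1) ⟩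
    fall (+ n ℤ.- + s) 1 ℤ.* + lam (suc s)
      ≡⟨ solve 3 (λ a s l → con 1ℤ :* (a :- s :- con 0ℤ) :* l := (a :- s) :* l) refl (+ n) (+ s) (+ lam (suc s)) ⟩
    (+ n ℤ.- + s) ℤ.* + lam (suc s) ∎
    where
    open ≡-Reasoning
    bal′ : ∀ S → wt S ≡ s ℕ.+ 1 → N S ≡ + lam (s ℕ.+ 1)
    bal′ = subst Balanced (ℕₚ.+-comm 1 s) bal

  ⊖-≤ : ∀ {a b} → b ℕ.≤ a → + a ℤ.- + b ≡ + (a ℕ.∸ b)
  ⊖-≤ {a} {b} le = trans (ℤₚ.m-n≡m⊖n a b) (ℤₚ.⊖-≥ le)

  balanced-down : ∀ s → suc s ℕ.≤ d → Balanced (suc s) → Balanced s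
  balanced-down s s<d bal S wS = ℤₚ.*-cancelˡ-≡ (+ d ℤ.- + s) (N S) (+ lam s) {{nz}}
    (trans (point-count s bal S wS) (sym (trans (cong ((+ d ℤ.- + s) ℤ.*_) (blocksThrough≡N (first n s)))
      (point-count s bal (first n s) (wt-first n s (ℕₚ.≤-trans (ℕₚ.<⇒≤ s<d) d≤n))))))
    where
    nz : ℤ.NonZero (+ d ℤ.- + s)
    nz = subst ℤ.NonZero (sym (⊖-≤ (ℕₚ.<⇒≤ s<d))) (ℕ.>-nonZero (ℕₚ.m<n⇒0<n∸m s<d))

  lam-ratio : ∀ s → suc s ℕ.≤ d → Balanced (suc s) → (d ℕ.∸ s) ℕ.* lam s ≡ (n ℕ.∸ s) ℕ.* lam (suc s)
  lam-ratio s s<d bal = ℤₚ.+-injective (begin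
    + ((d ℕ.∸ s) ℕ.* lam s) ≡⟨ ℤₚ.pos-* (d ℕ.∸ s) (lam s) ⟩
    + (d ℕ.∸ s) ℤ.* + lam s ≡⟨ cong₂ ℤ._*_ (⊖-≤ (ℕₚ.<⇒≤ s<d)) (sym (blocksThrough≡N (first n s))) ⟨
    (+ d ℤ.- + s) ℤ.* N (first n s) ≡⟨ point-count s bal (first n s) (wt-first n s s≤n) ⟩
    (+ n ℤ.- + s) ℤ.* + lam (suc s) ≡⟨ cong (ℤ._* + lam (suc s)) (⊖-≤ s≤n) ⟩
    + (n ℕ.∸ s) ℤ.* + lam (suc s) ≡⟨ ℤₚ.pos-* (n ℕ.∸ s) (lam (suc s)) ⟨
    + ((n ℕ.∸ s) ℕ.* lam (suc s)) ∎)
    where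
    open ≡-Reasoning
    s≤n : s ℕ.≤ n
    s≤n = ℕₚ.≤-trans (ℕₚ.<⇒≤ s<d) d≤n

  moment-∣ : ∀ s → (∀ j → j ℕ.≤ s → Balanced j) → ∀ W → W ∈C C →
    ∃ λ z → evenMoment (λ j → fall (+ wt W) j ℤ.* + lam j) s 0 ≡ (+ 2) ↑ s ℤ.* + (s !) ℤ.* z
  moment-∣ s bal W W∈ with ∑-∣ ((+ 2) ↑ s ℤ.* + (s !)) (λ v → block v ℤ.* evenMoment (fall (+ wt (v ∩ W))) s 0) term
    where
    term : ∀ v → ∃ λ z → block v ℤ.* evenMoment (fall (+ wt (v ∩ W))) s 0 ≡ (+ 2) ↑ s ℤ.* + (s !) ℤ.* z
    term v with C v in Cv
    ... | false = 0ℤ , sym (ℤₚ.*-zeroʳ ((+ 2) ↑ s ℤ.* + (s !)))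
    ... | true with self-orthogonal v W Cv W∈
    ...   | divides h p with fall-∣ h s
    ...     | z , q = ι (wt v ==ℕ d) ℤ.* z , (begin
        b ℤ.* evenMoment (fall (+ wt (v ∩ W))) s 0 ≡⟨ cong (λ k → b ℤ.* evenMoment (fall (+ k)) s 0)
            (trans p (ℕₚ.*-comm h 2)) ⟩
        b ℤ.* evenMoment (fall (+ (2 ℕ.* h))) s 0 ≡⟨ cong (b ℤ.*_) (evenMoment-fall h s 0) ⟩
        b ℤ.* ((+ 2) ↑ s ℤ.* fall (+ h) s ℤ.* 1ℤ) ≡⟨ cong (λ k → b ℤ.* ((+ 2) ↑ s ℤ.* k ℤ.* 1ℤ)) q ⟩
        b ℤ.* ((+ 2) ↑ s ℤ.* (+ (s !) ℤ.* z) ℤ.* 1ℤ)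
          ≡⟨ solve 4 (λ b t f z → b :* (t :* (f :* z) :* con 1ℤ) := t :* f :* (b :* z)) refl b ((+ 2) ↑ s) (+ (s !))
              z ⟩
        (+ 2) ↑ s ℤ.* + (s !) ℤ.* (b ℤ.* z) ∎)
      where
      open ≡-Reasoning
      b = ι (wt v ==ℕ d)
  ... | z , p = z , trans (evenMoment-cong s 0 moments) (trans (evenMoment-∑ block (λ v → fall (+ wt (v ∩ W))) s 0) p)
    where
    ∅ = zeroWord n
    ⊆ᵇ-zero : ∀ {n} (v : Word n) → zeroWord n ⊆ᵇ v ≡ true
    ⊆ᵇ-zero [] = refl
    ⊆ᵇ-zero (b ∷ v) = ⊆ᵇ-zero v
    -- With T empty, `fall-moment` turns the design parameters into the factorial moments of |B ∩ W|
    -- over the blocks B.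
    moments : ∀ j → j ℕ.≤ s ℕ.+ 0 → fall (+ wt W) j ℤ.* + lam j ≡ ∑ (λ v → block v ℤ.* fall (+ wt (v ∩ W)) j)
    moments j le = begin
      fall (+ wt W) j ℤ.* + lam j ≡⟨ cong (λ x → fall x j ℤ.* + lam j) (ℤₚ.+-identityʳ (+ wt W)) ⟨
      fall (+ wt W ℤ.- 0ℤ) j ℤ.* + lam j
        ≡⟨ fall-moment W (λ i → + lam i) j 0 ∅ (bal j (subst (j ℕ.≤_) (ℕₚ.+-identityʳ s) le)) (wt-zeroWord n)
            (⊆ᵇ-zero W) ⟨
      ∑ (λ v → block v ℤ.* ι (∅ ⊆ᵇ v) ℤ.* fall (+ wt (v ∩ W) ℤ.- 0ℤ) j)
        ≡⟨ ∑-cong (λ v → cong₂ (λ i x → block v ℤ.* ι i ℤ.* fall x j) (⊆ᵇ-zero v) (ℤₚ.+-identityʳ (+ wt (v ∩ W)))) ⟩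
      ∑ (λ v → block v ℤ.* 1ℤ ℤ.* fall (+ wt (v ∩ W)) j)
        ≡⟨ ∑-cong (λ v → cong (ℤ._* fall (+ wt (v ∩ W)) j) (ℤₚ.*-identityʳ (block v))) ⟩
      ∑ (λ v → block v ℤ.* fall (+ wt (v ∩ W)) j) ∎
      where open ≡-Reasoning

-- The relations for |T| = 5 and |T| = 7

opaque
  unfolding _↑_

  neg-8^ : ∀ k → -[1+ 7 ] ↑ (k ℕ.* 4) ≡ (+ 8) ↑ (k ℕ.* 4)
  neg-8^ zero = refl
  neg-8^ (suc k) rewrite neg-8^ k =
    solve 1 (λ p → con -[1+ 7 ] :* (con -[1+ 7 ] :* (con -[1+ 7 ] :* (con -[1+ 7 ] :* p))) := con (+ 8) :*
        (con (+ 8) :* (con (+ 8) :* (con (+ 8) :* p)))) refl ((+ 8) ↑ (k ℕ.* 4))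

  pos-^ : ∀ a k → + (a ℕ.^ k) ≡ (+ a) ↑ k
  pos-^ a zero = refl
  pos-^ a (suc k) = trans (ℤₚ.pos-* a (a ℕ.^ k)) (cong (+ a ℤ.*_) (pos-^ a k))

opaque
  unfolding _↑_

  neg-8^-even : ∀ k → -[1+ 7 ] ↑ (2 ℕ.+ k ℕ.* 4) ≡ (+ 8) ↑ (2 ℕ.+ k ℕ.* 4)
  neg-8^-even k = trans (cong (λ p → -[1+ 7 ] ℤ.* (-[1+ 7 ] ℤ.* p)) (neg-8^ k))
    (solve 1 (λ p → con -[1+ 7 ] :* (con -[1+ 7 ] :* p) := con (+ 8) :* (con (+ 8) :* p)) refl ((+ 8) ↑ (k ℕ.* 4)))

  neg-8^-odd : ∀ k → -[1+ 7 ] ↑ (1 ℕ.+ k ℕ.* 4) ≡ ℤ.- (+ 8) ↑ (1 ℕ.+ k ℕ.* 4)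
  neg-8^-odd k = trans (cong (-[1+ 7 ] ℤ.*_) (neg-8^ k))
      (solve 1 (λ p → con -[1+ 7 ] :* p := :- (con (+ 8) :* p)) refl ((+ 8) ↑ (k ℕ.* 4)))

  neg-1^7 : -[1+ 0 ] ↑ 7 ≡ -[1+ 0 ]
  neg-1^7 = refl

  ↑-suc : ∀ x k → x ↑ suc k ≡ x ℤ.* x ↑ k
  ↑-suc x k = refl

power-nonzero : ∀ c t r → .{{nz : ℕ.NonZero c}} → ℤ.NonZero (+ c ℤ.* ((+ 2) ↑ t ℤ.* (+ 8) ↑ r))
power-nonzero c t r {{nz}} = subst ℤ.NonZero
  (trans (ℤₚ.pos-* c (2 ℕ.^ t ℕ.* 8 ℕ.^ r)) (cong (+ c ℤ.*_)
    (trans (ℤₚ.pos-* (2 ℕ.^ t) (8 ℕ.^ r)) (cong₂ ℤ._*_ (pos-^ 2 t) (pos-^ 8 r)))))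
  (ℕₚ.m*n≢0 c (2 ℕ.^ t ℕ.* 8 ℕ.^ r) {{nz}} {{ℕₚ.m*n≢0 (2 ℕ.^ t) (8 ℕ.^ r) {{ℕₚ.m^n≢0 2 t}} {{ℕₚ.m^n≢0 8 r}}}})

five-solve : ∀ c e N N′ c₁ c₂ S → S ≡ + 2 ℤ.* c ℤ.* e → S ℤ.* (+ 2 ℤ.* c₁) ≡ c ℤ.*
  (e ℤ.* N ℤ.+ 0ℤ ℤ.* N′ ℤ.+ e ℤ.* c₂) →
  1ℤ ℤ.* (c ℤ.* e) ℤ.* (N ℤ.+ c₂) ≡ 1ℤ ℤ.* (c ℤ.* e) ℤ.* (+ 4 ℤ.* c₁)
five-solve c e N N′ c₁ c₂ S refl p = trans
  (solve 5 (λ c e a b n → con 1ℤ :* (c :* e) :* (a :+ b) := c :* (e :* a :+ con 0ℤ :* n :+ e :* b)) refl c e N c₂ N′)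
  (trans (sym p) (solve 3 (λ c e x → con (+ 2) :* c :* e :* (con (+ 2) :* x) := con 1ℤ :* (c :* e) :*
      (con (+ 4) :* x)) refl c e c₁))

-- Used with c = 2^7, e = 8^r and S = |C| = 4ce. After cancelling ce the unknown N occurs as -4N on
-- the left and 2N on the right, whence the coefficient 6.
seven-solve : ∀ c e N h g a S → S ≡ + 2 ℤ.* (+ 2 ℤ.* c) ℤ.* e →
  S ℤ.* (h ℤ.+ -[1+ 0 ] ℤ.* N) ≡ c ℤ.* (e ℤ.* N ℤ.+ ℤ.- e ℤ.* (a ℤ.- N) ℤ.+ g) →
  + 6 ℤ.* (c ℤ.* e) ℤ.* N ≡ S ℤ.* h ℤ.- c ℤ.* (g ℤ.- e ℤ.* a)
seven-solve c e N h g a S refl p = trans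
  (solve 6 (λ c e n h g a → con (+ 6) :* (c :* e) :* n := con (+ 2) :* (con (+ 2) :* c) :* e :* h :- c :*
      (g :- e :* a)
    :- (con (+ 2) :* (con (+ 2) :* c) :* e :* (h :+ con -[1+ 0 ] :* n) :- c :* (e :* n :+ :- e :* (a :- n) :+ g)))
        refl c e N h g a)
  (trans (cong (λ z → + 2 ℤ.* (+ 2 ℤ.* c) ℤ.* e ℤ.* h ℤ.- c ℤ.* (g ℤ.- e ℤ.* a) ℤ.- z)
    (trans (cong (ℤ._- c ℤ.* (e ℤ.* N ℤ.+ ℤ.- e ℤ.* (a ℤ.- N) ℤ.+ g)) p)
        (ℤₚ.+-inverseʳ (c ℤ.* (e ℤ.* N ℤ.+ ℤ.- e ℤ.* (a ℤ.- N) ℤ.+ g)))))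
    (ℤₚ.+-identityʳ (+ 2 ℤ.* (+ 2 ℤ.* c) ℤ.* e ℤ.* h ℤ.- c ℤ.* (g ℤ.- e ℤ.* a))))

-- μ = m − 1
module ExtremalCode (μ n d : ℕ) (n≡ : n ≡ 24 ℕ.+ μ ℕ.* 24) (d≡ : d ≡ 8 ℕ.+ μ ℕ.* 4) (C : Code n)
  (linear : IsLinear C) (self-dual : IsSelfDual C) (doubly-even : IsDoublyEven C)
  (dimension : HasDimension C (12 ℕ.* suc μ)) (min-weight : HasMinWeight C d) where

  open Extremal C linear self-dual doubly-even
    d min-weight (2 ℕ.+ μ ℕ.* 4) (4 ℕ.+ 5 ℕ.* μ) (divides (2 ℕ.+ μ) d≡)
    (subst (0 ℕ.<_) (sym d≡) (ℕ.s≤s ℕ.z≤n)) (ℕ.s≤s ℕ.z≤n)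
    (trans (cong (ℕ._+ 4 ℕ.* (4 ℕ.+ 5 ℕ.* μ)) d≡) (trans
        (solveⁿ 1 (λ μ → conⁿ 8 :+ⁿ μ :*ⁿ conⁿ 4 :+ⁿ conⁿ 4 :*ⁿ (conⁿ 4 :+ⁿ conⁿ 5 :*ⁿ μ)
      :=ⁿ conⁿ 24 :+ⁿ μ :*ⁿ conⁿ 24) refl μ) (sym n≡)))
    (trans (cong (λ d → d ℕ.+ 4 ℕ.* (2 ℕ.+ μ ℕ.* 4) ℕ.+ d) d≡)
        (trans (solveⁿ 1 (λ μ → conⁿ 8 :+ⁿ μ :*ⁿ conⁿ 4 :+ⁿ conⁿ 4 :*ⁿ (conⁿ 2 :+ⁿ μ :*ⁿ conⁿ 4) :+ⁿ
        (conⁿ 8 :+ⁿ μ :*ⁿ conⁿ 4)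
      :=ⁿ conⁿ 24 :+ⁿ μ :*ⁿ conⁿ 24) refl μ) (sym n≡)))
    public
  open Poisson C linear self-dual using (size)
  open Blocks block using (N)
  open Blocks coblock using () renaming (N to N′)

  size≡ : ∀ t r → t ℕ.+ 3 ℕ.* r ≡ 12 ℕ.* suc μ → size ≡ (+ 2) ↑ t ℤ.* (+ 8) ↑ r
  size≡ t r p = begin
    size ≡⟨ countᵇ-∑ C ⟨
    + countᵇ C (allWords n) ≡⟨ cong +_ dimension ⟩
    + (2 ℕ.^ (12 ℕ.* suc μ)) ≡⟨ cong (λ e → + (2 ℕ.^ e)) p ⟨
    + (2 ℕ.^ (t ℕ.+ 3 ℕ.* r)) ≡⟨ cong +_ (ℕₚ.^-distribˡ-+-* 2 t (3 ℕ.* r)) ⟩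
    + (2 ℕ.^ t ℕ.* 2 ℕ.^ (3 ℕ.* r)) ≡⟨ cong (λ e → + (2 ℕ.^ t ℕ.* e)) (ℕₚ.^-*-assoc 2 3 r) ⟨
    + (2 ℕ.^ t ℕ.* 8 ℕ.^ r) ≡⟨ ℤₚ.pos-* (2 ℕ.^ t) (8 ℕ.^ r) ⟩
    + (2 ℕ.^ t) ℤ.* + (8 ℕ.^ r) ≡⟨ cong₂ ℤ._*_ (pos-^ 2 t) (pos-^ 8 r) ⟩
    (+ 2) ↑ t ℤ.* (+ 8) ↑ r ∎
    where open ≡-Reasoning

  B+d≡n : 16 ℕ.+ 20 ℕ.* μ ℕ.+ d ≡ n
  B+d≡n = trans (cong (16 ℕ.+ 20 ℕ.* μ ℕ.+_) d≡) (trans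
    (solveⁿ 1 (λ μ → conⁿ 16 :+ⁿ conⁿ 20 :*ⁿ μ :+ⁿ (conⁿ 8 :+ⁿ μ :*ⁿ conⁿ 4) :=ⁿ conⁿ 24 :+ⁿ μ :*ⁿ conⁿ 24) refl μ)
        (sym n≡))

  5≤d : 5 ℕ.≤ d
  5≤d = subst (5 ℕ.≤_) (sym d≡) (ℕₚ.m≤m+n 5 (3 ℕ.+ μ ℕ.* 4))

  7≤d : 7 ℕ.≤ d
  7≤d = subst (7 ℕ.≤_) (sym d≡) (ℕₚ.m≤m+n 7 (1 ℕ.+ μ ℕ.* 4))

  -- With r = `J` the residue vanishes at coblocks as well, and r + 5 < d leaves only the zero word
  -- on the other side. There |C| = 2^6 8^r meets 2^5 8^r, which together with `testSeries-coeff`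
  -- gives the factor 4.
  lam-five : lam 5 ℕ.+ (3 ℕ.+ 5 ℕ.* μ) choose (2 ℕ.+ μ ℕ.* 4) ≡ 4 ℕ.* ((4 ℕ.+ μ ℕ.* 4 ℕ.+ μ) choose μ)
  lam-five = ℤₚ.+-injective (ℤₚ.*-cancelˡ-≡ (1ℤ ℤ.* (two ℤ.* e)) (+ lam 5 ℤ.+ + c₂) (+ (4 ℕ.* c₁))
      {{power-nonzero 1 5 r}} (begin
    1ℤ ℤ.* (two ℤ.* e) ℤ.* (+ lam 5 ℤ.+ + c₂) ≡⟨ cong (λ z → 1ℤ ℤ.* (two ℤ.* e) ℤ.* (z ℤ.+ + c₂))
        (blocksThrough≡N T) ⟩
    1ℤ ℤ.* (two ℤ.* e) ℤ.* (N T ℤ.+ + c₂)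
      ≡⟨ five-solve two e (N T) (N′ T) (+ c₁) (+ c₂) size (trans (size≡ 6 r dim) (cong (ℤ._* e) (↑-suc (+ 2) 5)))
          (trans (cong (size ℤ.*_) (sym lhs)) (trans M.moment
           (cong₂ (λ u w → two ℤ.* (e ℤ.* N T ℤ.+ u ℤ.* N′ T ℤ.+ w)) G-J G-top))) ⟩
    1ℤ ℤ.* (two ℤ.* e) ℤ.* (+ 4 ℤ.* + c₁) ≡⟨ cong (1ℤ ℤ.* (two ℤ.* e) ℤ.*_) (ℤₚ.pos-* 4 c₁) ⟨
    1ℤ ℤ.* (two ℤ.* e) ℤ.* + (4 ℕ.* c₁) ∎))
    where
    open ≡-Reasoning
    r = 2 ℕ.+ μ ℕ.* 4
    e = (+ 8) ↑ r
    two = (+ 2) ↑ 5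
    c₁ = (4 ℕ.+ μ ℕ.* 4 ℕ.+ μ) choose μ
    c₂ = (3 ℕ.+ 5 ℕ.* μ) choose r
    T = first n 5
    B = 16 ℕ.+ 20 ℕ.* μ
    B≡ : B ≡ 4 ℕ.* (3 ℕ.+ μ ℕ.* 4) ℕ.+ (4 ℕ.+ μ ℕ.* 4)
    B≡ = solveⁿ 1 (λ μ → conⁿ 16 :+ⁿ conⁿ 20 :*ⁿ μ :=ⁿ conⁿ 4 :*ⁿ (conⁿ 3 :+ⁿ μ :*ⁿ conⁿ 4) :+ⁿ
        (conⁿ 4 :+ⁿ μ :*ⁿ conⁿ 4)) refl μ
    dim : 6 ℕ.+ 3 ℕ.* r ≡ 12 ℕ.* suc μ
    dim = solveⁿ 1 (λ μ → conⁿ 6 :+ⁿ conⁿ 3 :*ⁿ (conⁿ 2 :+ⁿ μ :*ⁿ conⁿ 4) :=ⁿ conⁿ 12 :*ⁿ (conⁿ 1 :+ⁿ μ)) refl μ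
    G-low : ∀ j → j ℕ.< r → G r (suc j) ≡ 0ℤ
    G-low j lt = trans (G-suc r j) (trans (cong (λ c → -[1+ 7 ] ↑ r ℤ.* + c) (k>n⇒nCk≡0 lt))
        (ℤₚ.*-zeroʳ (-[1+ 7 ] ↑ r)))
    G-J : G r r ≡ 0ℤ
    G-J = G-low (suc (μ ℕ.* 4)) ℕₚ.≤-refl
    G-top : G r (4 ℕ.+ 5 ℕ.* μ) ≡ e ℤ.* + c₂
    G-top = trans (G-suc r (3 ℕ.+ 5 ℕ.* μ)) (cong (ℤ._* + c₂) (neg-8^-even μ))
    strict : r ℕ.+ 5 ℕ.< d
    strict = subst (r ℕ.+ 5 ℕ.<_) (sym d≡) (ℕₚ.≤-reflexive (cong suc (ℕₚ.+-comm r 5)))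
    module M = Moment 4 r (3 ℕ.+ μ ℕ.* 4) B
      (trans (ℕₚ.+-comm (3 ℕ.+ μ ℕ.* 4) 5) (sym d≡))
      B+d≡n
      (λ j lt → G-low j (ℕₚ.<-trans (ℕₚ.n<1+n j) lt)) T (wt-first n 5 (ℕₚ.≤-trans 5≤d d≤n))

    lhs : ∑ (λ u → ι (C u) ℤ.* testFn r T u M.h) ≡ + 2 ℤ.* + c₁
    lhs = trans (M.lhs-strict strict) (trans (cong (λ b → testSeries (3 ℕ.+ μ ℕ.* 4) b r r) B≡) (testSeries-coeff μ))

  balanced-seven : (∀ s → s ℕ.≤ 6 → Balanced s) → Balanced 7
  balanced-seven bal T wT = trans (ℤₚ.*-cancelˡ-≡ K (N T) (N T₀) {{power-nonzero 6 7 r}}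
      (trans (determined T wT) (sym (determined T₀ wT₀)))) (sym (blocksThrough≡N T₀))
    where
    open ≡-Reasoning
    r = 1 ℕ.+ μ ℕ.* 4
    e = (+ 8) ↑ r
    two = (+ 2) ↑ 7
    B = 16 ℕ.+ 20 ℕ.* μ
    T₀ = first n 7
    wT₀ = wt-first n 7 (ℕₚ.≤-trans 7≤d d≤n)
    φ : ℕ → ℤ
    φ s = + lam s
    K h₀ a g : ℤ
    K = + 6 ℤ.* (two ℤ.* e)
    h₀ = testSeries (1 ℕ.+ μ ℕ.* 4) B r r
    -- At this point `φ 7` is not known to be a common value. Adding it cancels the -φ 7 inside
    -- `alternateℕ 7 φ`, so `a` depends on λ₀, ..., λ₆ only.
    a = alternateℕ 7 φ ℤ.+ φ 7
    g = G r (4 ℕ.+ 5 ℕ.* μ)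
    G-J : G r (suc r) ≡ ℤ.- e
    G-J = trans (G-suc r r) (trans (cong (λ c → -[1+ 7 ] ↑ r ℤ.* + c) (nCn≡1 r)) (trans (ℤₚ.*-identityʳ _)
      (neg-8^-odd μ)))
    G-low : ∀ j → j ℕ.< r → G r (suc j) ≡ 0ℤ
    G-low j lt = trans (G-suc r j) (trans (cong (λ c → -[1+ 7 ] ↑ r ℤ.* + c) (k>n⇒nCk≡0 lt))
        (ℤₚ.*-zeroʳ (-[1+ 7 ] ↑ r)))
    N′-value : ∀ T → wt T ≡ 7 → N′ T ≡ a ℤ.- N T
    N′-value T wT = begin
      N′ T ≡⟨ N′-alternate T ⟩
      alternate T N ≡⟨ alternate-top T N φ (λ S lt → bal (wt S) (ℕₚ.≤-pred (subst (wt S ℕ.<_) wT lt)) S refl) ⟩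
      alternateℕ (wt T) φ ℤ.+ -[1+ 0 ] ↑ wt T ℤ.* (N T ℤ.- φ (wt T))
        ≡⟨ cong (λ k → alternateℕ k φ ℤ.+ -[1+ 0 ] ↑ k ℤ.* (N T ℤ.- φ k)) wT ⟩
      alternateℕ 7 φ ℤ.+ -[1+ 0 ] ↑ 7 ℤ.* (N T ℤ.- φ 7)
        ≡⟨ cong (λ z → alternateℕ 7 φ ℤ.+ z ℤ.* (N T ℤ.- φ 7)) neg-1^7 ⟩
      alternateℕ 7 φ ℤ.+ -[1+ 0 ] ℤ.* (N T ℤ.- φ 7)
        ≡⟨ solve 3 (λ a n f → a :+ con -[1+ 0 ] :* (n :- f) := a :+ f :- n) refl (alternateℕ 7 φ) (N T) (φ 7) ⟩
      a ℤ.- N T ∎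
    dim : 9 ℕ.+ 3 ℕ.* r ≡ 12 ℕ.* suc μ
    dim = solveⁿ 1 (λ μ → conⁿ 9 :+ⁿ conⁿ 3 :*ⁿ (conⁿ 1 :+ⁿ μ :*ⁿ conⁿ 4) :=ⁿ conⁿ 12 :*ⁿ (conⁿ 1 :+ⁿ μ)) refl μ
    -- As r is odd, the coblock term -8^r (a - N(T)) reinforces 8^r N(T). The right side does not
    -- mention T, so N(T) is the same for all 7-sets.
    determined : ∀ T → wt T ≡ 7 → K ℤ.* N T ≡ size ℤ.* h₀ ℤ.- two ℤ.* (g ℤ.- e ℤ.* a)
    determined T wT = seven-solve two e (N T) h₀ g a size
        (trans (size≡ 9 r dim) (cong (ℤ._* e) (trans (↑-suc (+ 2) 8) (cong (+ 2 ℤ.*_) (↑-suc (+ 2) 7)))))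
      (trans (cong (size ℤ.*_) (sym (trans (M.lhs-tight (trans (ℕₚ.+-comm r 7) (sym d≡)))
          (cong (λ z → h₀ ℤ.+ z ℤ.* N T) neg-1^7)))) (trans M.moment
        (cong₂ (λ u w → two ℤ.* (e ℤ.* N T ℤ.+ u ℤ.* w ℤ.+ g)) G-J (N′-value T wT))))
      where
      module M = Moment 6 r (1 ℕ.+ μ ℕ.* 4) B
        (trans (ℕₚ.+-comm (1 ℕ.+ μ ℕ.* 4) 7) (sym d≡))
        B+d≡n
        (λ j lt → G-low j (ℕₚ.≤-pred lt)) T wT

-- Elimination of m

-- The rounding and the default at 0 do no harm: a result is trusted only through `quot-exact`,
-- which asks for an exact division by a positive number.
quot : ℕ → ℕ → ℕ
quot a zero = 0
quot a (suc b) = a ℕ./ suc b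

quot-exact : ∀ a b x → 0 ℕ.< b → b * x ≡ a → quot a b ≡ x
quot-exact a (suc b) x _ refl = trans (cong (ℕ._/ suc b) (ℕₚ.*-comm (suc b) x)) (m*n/n≡m x (suc b))

_∣ᵇ_ : ℕ → ℕ → Bool
zero ∣ᵇ a = false
suc b ∣ᵇ a = (a ℕ.% suc b) ℕ.≡ᵇ 0

∣ᵇ-true : ∀ a b x → 0 ℕ.< b → b * x ≡ a → b ∣ᵇ a ≡ true
∣ᵇ-true a (suc b) x _ refl = cong (ℕ._≡ᵇ 0) (trans (cong (ℕ._% suc b) (ℕₚ.*-comm (suc b) x)) (m*n%n≡0 x (suc b)))

allBelow : ℕ → (ℕ → Bool) → Bool
allBelow zero p = true
allBelow (suc k) p = p k ∧ allBelow k p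

allBelow-sound : ∀ k p → allBelow k p ≡ true → ∀ i → i ℕ.< k → p i ≡ true
allBelow-sound (suc k) p eq i i<k with p k in pk | ℕₚ.m≤n⇒m<n∨m≡n (ℕₚ.≤-pred i<k)
... | true | inj₁ lt = allBelow-sound k p eq i lt
... | true | inj₂ refl = pk

-- λ_j computed from λ₅ = l by (d − s) λ_s = (n − s) λ_{s+1}.
module Table (n d l : ℕ) where

  -- `below k` stands for λ_(5-k) and `above k` for λ_(5+k).
  below above table : ℕ → ℕ
  below zero = l
  below (suc k) = quot ((n ℕ.∸ (4 ℕ.∸ k)) * below k) (d ℕ.∸ (4 ℕ.∸ k))
  above zero = l
  above (suc k) = quot ((d ℕ.∸ (5 + k)) * above k) (n ℕ.∸ (5 + k))
  table j = if j ℕ.≤ᵇ 5 then below (5 ℕ.∸ j) else above (j ℕ.∸ 5)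

evenMoments : (ℕ → ℕ) → ℕ → ℕ → ℤ
evenMoments L w s = evenMoment (λ j → fall (+ w) j ℤ.* + L j) s 0

-- The divisibility of the even moments fails for codewords of weight 4 + 8q.
avoids : (ℕ → ℕ) → ℕ → ℕ → Bool
avoids L s q = not ((2 ℕ.^ s * s !) ∣ᵇ ℤ.∣ evenMoments L (4 + q * 8) s ∣)

-- Truncated subtraction is safe because `lam-five` has the form of a sum.
λ₅ : ℕ → ℕ
λ₅ μ = 4 * ((4 + μ * 4 + μ) choose μ) ℕ.∸ ((3 + 5 * μ) choose (2 + μ * 4))

candidates : List ℕ
candidates = 15 ∷ 52 ∷ 55 ∷ 57 ∷ 59 ∷ 60 ∷ 63 ∷ 90 ∷ 93 ∷ 104 ∷ 105 ∷ 107 ∷ 118 ∷ 125 ∷ 127 ∷ 135 ∷ 143 ∷ 151 ∷ []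

-- Each alternative is a contradiction: a non-integral λ, or failure of the moment test. Nothing
-- tells which weight 4 + 8q occurs in the code, so the test has to fail for every q below 3 + 3μ =
-- n/8.
excluded₇ excluded₈ : ℕ → ℕ → (ℕ → ℕ) → ℕ → Bool
excluded₇ n d L μ = not ((n ℕ.∸ 5) ∣ᵇ ((d ℕ.∸ 5) * L 5)) ∨ not ((n ℕ.∸ 6) ∣ᵇ ((d ℕ.∸ 6) * L 6)) ∨ allBelow
  (3 + μ * 3) (avoids L 6)
excluded₈ n d L μ = not ((n ℕ.∸ 7) ∣ᵇ ((d ℕ.∸ 7) * L 7)) ∨ allBelow (3 + μ * 3) (avoids L 8)

opaque

  -- A candidate m has to be refuted only as an 8-design, any other m already as a 6-design with its
  -- consequence for 7.
  verdict : (n d l μ : ℕ) → Bool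
  verdict n d l μ = if does (suc μ ∈? candidates)
    then excluded₈ n d (Table.table n d l) μ else excluded₇ n d (Table.table n d l) μ

  verdict-∈ : ∀ n d l μ → suc μ ∈ candidates → verdict n d l μ ≡ true → excluded₈ n d (Table.table n d l) μ ≡ true
  verdict-∈ n d l μ p = subst (λ b → (if b then excluded₈ n d (Table.table n d l) μ else excluded₇ n d
      (Table.table n d l) μ) ≡ true →
    excluded₈ n d (Table.table n d l) μ ≡ true) (sym (dec-true (suc μ ∈? candidates) p)) id

  verdict-∉ : ∀ n d l μ → ¬ (suc μ ∈ candidates) → verdict n d l μ ≡ true → excluded₇ n d (Table.table n d l) μ ≡ true
  verdict-∉ n d l μ p = subst (λ b → (if b then excluded₈ n d (Table.table n d l) μ else excluded₇ n d
      (Table.table n d l) μ) ≡ true →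
    excluded₇ n d (Table.table n d l) μ ≡ true) (sym (dec-false (suc μ ∈? candidates) p)) id

  verdicts : allBelow 153 (λ μ → verdict (24 + μ * 24) (8 + μ * 4) (λ₅ μ) μ) ≡ true
  verdicts = refl

false≢true : false ≢ true
false≢true ()

resolve : ∀ {a b} → a ≡ true → not a ∨ b ≡ true → b ≡ true
resolve refl p = p

-- From the computed table to the code

module Numerics (μ n d : ℕ) (n≡ : n ≡ 24 ℕ.+ μ ℕ.* 24) (d≡ : d ≡ 8 ℕ.+ μ ℕ.* 4) (C : Code n)
  (linear : IsLinear C) (self-dual : IsSelfDual C) (doubly-even : IsDoublyEven C)
  (dimension : HasDimension C (12 ℕ.* suc μ)) (min-weight : HasMinWeight C d) where

  open ExtremalCode μ n d n≡ d≡ C linear self-dual doubly-even dimension min-weight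

  balanced-to : ∀ k j → k + j ≤ d → Balanced (k + j) → Balanced j
  balanced-to zero j le bal = bal
  balanced-to (suc k) j le bal = balanced-to k j (ℕₚ.<⇒≤ le) (balanced-down (k + j) le bal)

  balanced-below : ∀ s → s ≤ d → Balanced s → ∀ j → j ≤ s → Balanced j
  balanced-below s s≤d bal j j≤s = balanced-to (s ℕ.∸ j) j
    (subst (_≤ d) (sym (ℕₚ.m∸n+n≡m j≤s)) s≤d) (subst Balanced (sym (ℕₚ.m∸n+n≡m j≤s)) bal)

  8≤d : 8 ≤ d
  8≤d = subst (8 ≤_) (sym d≡) (ℕₚ.m≤m+n 8 (μ * 4))

  lam5≡ : lam 5 ≡ λ₅ μ
  lam5≡ = trans (sym (ℕₚ.m+n∸n≡m (lam 5) ((3 + 5 * μ) choose (2 + μ * 4))))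
      (cong (ℕ._∸ ((3 + 5 * μ) choose (2 + μ * 4))) lam-five)

  mod-8 : ∀ v → v ∈C C → 8 ∣ wt v ⊎ ∃ λ h → wt v ≡ 4 + h * 8
  mod-8 v v∈ with doubly-even v v∈
  ... | divides k p with odd k in ok
  ...   | false with even-half k ok
  ...     | divides h q = inj₁ (divides h (trans p (trans (cong (_* 4) q) (ℕₚ.*-assoc h 2 4))))
  mod-8 v v∈ | divides (suc k) p | true with even-half k (trans (sym (not-involutive (odd k))) (cong not ok))
  ...     | divides h q = inj₂ (h , trans p (cong (λ x → 4 + x) (trans (cong (_* 4) q) (ℕₚ.*-assoc h 2 4))))

  -- n = 8(3 + 3μ), so a weight 4 + 8h that is at most n has h < 3 + 3μ.
  index-bound : ∀ (v : Word n) h → wt v ≡ 4 + h * 8 → h ℕ.< 3 + μ * 3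
  index-bound v h wv = ℕₚ.*-cancelʳ-< 8 h (3 + μ * 3) (ℕₚ.<-≤-trans (ℕₚ.m<n+m (h * 8) {4} (ℕ.s≤s ℕ.z≤n))
    (subst₂ _≤_ wv (trans n≡ (sym (cong (24 ℕ.+_) (ℕₚ.*-assoc μ 3 8)))) (wt≤n v)))

  open Table n d (lam 5)

  module _ (S : ℕ) (S≤d : S ≤ d) (bal : ∀ j → j ≤ S → Balanced j) where

    below-correct : 5 ≤ S → ∀ k → k ≤ 5 → below k ≡ lam (5 ℕ.∸ k)
    below-correct 5≤S zero k≤5 = refl
    below-correct 5≤S (suc k) (ℕ.s≤s k≤4) = quot-exact _ _ (lam (4 ℕ.∸ k)) (ℕₚ.m<n⇒0<n∸m small)
      (trans (lam-ratio (4 ℕ.∸ k) small (bal (suc (4 ℕ.∸ k)) (ℕₚ.≤-trans (ℕ.s≤s (ℕₚ.m∸n≤m 4 k)) 5≤S)))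
        (cong ((n ℕ.∸ (4 ℕ.∸ k)) *_) (trans (cong lam (sym (ℕₚ.+-∸-assoc 1 k≤4)))
            (sym (below-correct 5≤S k (ℕₚ.m≤n⇒m≤1+n k≤4))))))
      where
      small : 4 ℕ.∸ k ℕ.< d
      small = ℕₚ.≤-trans (ℕ.s≤s (ℕₚ.m∸n≤m 4 k)) (ℕₚ.≤-trans 5≤S S≤d)

    above-correct : ∀ k → 5 + k ≤ S → above k ≡ lam (5 + k)
    above-correct zero le = refl
    above-correct (suc k) le = quot-exact _ _ (lam (6 + k)) (ℕₚ.m<n⇒0<n∸m (ℕₚ.≤-trans le (ℕₚ.≤-trans S≤d d≤n)))
      (trans (sym (lam-ratio (5 + k) (ℕₚ.≤-trans le S≤d) (bal (6 + k) le)))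
          (cong ((d ℕ.∸ (5 + k)) *_) (sym (above-correct k (ℕₚ.<⇒≤ le)))))

    table-correct : 5 ≤ S → ∀ j → j ≤ S → table j ≡ lam j
    table-correct 5≤S j j≤S with j ℕ.≤ᵇ 5 in eq
    ... | true = trans (below-correct 5≤S (5 ℕ.∸ j) (ℕₚ.m∸n≤m 5 j))
      (cong lam (ℕₚ.m∸[m∸n]≡n (ℕₚ.≤ᵇ⇒≤ j 5 (Equivalence.from T-≡ eq))))
    ... | false = trans (above-correct (j ℕ.∸ 5) (subst (_≤ S) (sym 5+) j≤S)) (cong lam 5+)
      where
      5≤j : 5 ≤ j
      5≤j = ℕₚ.<⇒≤ (ℕₚ.≰⇒> (λ le → false≢true (trans (sym eq) (Equivalence.to T-≡ (ℕₚ.≤⇒≤ᵇ le)))))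
      5+ : 5 + (j ℕ.∸ 5) ≡ j
      5+ = ℕₚ.m+[n∸m]≡n 5≤j

    modulus-divides : 5 ≤ S → ∀ v → v ∈C C → (2 ℕ.^ S * S !) ∣ᵇ ℤ.∣ evenMoments table (wt v) S ∣ ≡ true
    modulus-divides 5≤S v v∈ = conclude (moment-∣ S bal v v∈)
      where
      conclude : (∃ λ z → evenMoments lam (wt v) S ≡ (+ 2) ↑ S ℤ.* + (S !) ℤ.* z) →
        (2 ℕ.^ S * S !) ∣ᵇ ℤ.∣ evenMoments table (wt v) S ∣ ≡ true
      conclude (z , p) = ∣ᵇ-true _ _ ℤ.∣ z ∣ (ℕₚ.*-mono-≤ (ℕₚ.m^n>0 2 S) (ℕₚ.1≤n! S)) (sym (begin
        ℤ.∣ evenMoments table (wt v) S ∣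
          ≡⟨ cong ℤ.∣_∣ (evenMoment-cong S 0 (λ i le → cong (λ x → fall (+ wt v) i ℤ.* + x)
              (table-correct 5≤S i (subst (i ≤_) (ℕₚ.+-identityʳ S) le)))) ⟩
        ℤ.∣ evenMoments lam (wt v) S ∣ ≡⟨ cong ℤ.∣_∣ p ⟩
        ℤ.∣ (+ 2) ↑ S ℤ.* + (S !) ℤ.* z ∣ ≡⟨ ℤₚ.abs-* ((+ 2) ↑ S ℤ.* + (S !)) z ⟩
        ℤ.∣ (+ 2) ↑ S ℤ.* + (S !) ∣ * ℤ.∣ z ∣ ≡⟨ cong (λ x → ℤ.∣ x ℤ.* + (S !) ∣ * ℤ.∣ z ∣) (pos-^ 2 S) ⟨
        ℤ.∣ + (2 ℕ.^ S) ℤ.* + (S !) ∣ * ℤ.∣ z ∣ ≡⟨ cong (_* ℤ.∣ z ∣) (ℤₚ.abs-* (+ (2 ℕ.^ S)) (+ (S !))) ⟩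
        2 ℕ.^ S * S ! * ℤ.∣ z ∣ ∎))
        where open ≡-Reasoning

    some-divisible : 5 ≤ S → allBelow (3 + μ * 3) (avoids table S) ≡ true → ⊥
    some-divisible 5≤S avoid = not-8-divisible C linear self-dual d (ℕₚ.≤-trans (ℕₚ.m≤m+n 3 4) 7≤d) min-weight
      (λ v v∈ → [ id , ⊥-elim ∘ avoided v v∈ ]′ (mod-8 v v∈))
      where
      avoided : ∀ v → v ∈C C → (∃ λ h → wt v ≡ 4 + h * 8) → ⊥
      avoided v v∈ (h , wv) = false≢true (trans
        (sym (cong not (trans (cong (λ w → (2 ℕ.^ S * S !) ∣ᵇ ℤ.∣ evenMoments table w S ∣) (sym wv))
            (modulus-divides 5≤S v v∈))))
        (allBelow-sound (3 + μ * 3) (avoids table S) avoid h (index-bound v h wv)))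

    above-divides : ∀ k → suc (5 + k) ≤ S → (n ℕ.∸ (5 + k)) ∣ᵇ ((d ℕ.∸ (5 + k)) * table (5 + k)) ≡ true
    above-divides k le = ∣ᵇ-true _ _ (lam (6 + k)) (ℕₚ.m<n⇒0<n∸m (ℕₚ.≤-trans le (ℕₚ.≤-trans S≤d d≤n)))
      (trans (sym (lam-ratio (5 + k) (ℕₚ.≤-trans le S≤d) (bal (6 + k) le)))
        (cong ((d ℕ.∸ (5 + k)) *_) (sym (table-correct (ℕₚ.≤-trans (ℕₚ.m≤m+n 5 (suc k))
            (ℕₚ.≤-trans (ℕₚ.≤-reflexive (ℕₚ.+-suc 5 k)) le)) (5 + k) (ℕₚ.<⇒≤ le)))))

  -- The transport along `n≡`, `d≡` and `lam5≡` happens under the opaque `verdict`, so nothing is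
  -- evaluated for a variable μ.
  judged : suc μ ≤ 153 → verdict n d (lam 5) μ ≡ true
  judged μ<153 = trans (cong (λ l → verdict n d l μ) lam5≡) (trans (cong₂ (λ n d → verdict n d (λ₅ μ) μ) n≡ d≡)
    (allBelow-sound 153 (λ μ → verdict (24 + μ * 24) (8 + μ * 4) (λ₅ μ) μ) verdicts μ μ<153))

  conclusion : suc μ ≤ 153 → ∀ t → 6 ≤ t → IsTDesign C d t →
    IsTDesign C d 7 × suc μ ∈ candidates × ¬ IsTDesign C d 8
  conclusion μ<153 t 6≤t design = balanced⇒design 7 7≤d (bal₇ 7 ℕₚ.≤-refl) , member , not-eight
    where
    bal₆ : ∀ j → j ≤ 6 → Balanced j
    bal₆ j j≤6 = balanced-below t (proj₁ design) (design⇒balanced t design) j (ℕₚ.≤-trans j≤6 6≤t)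
    bal₇ : ∀ j → j ≤ 7 → Balanced j
    bal₇ = balanced-below 7 7≤d (balanced-seven bal₆)
    6≤d : 6 ≤ d
    6≤d = ℕₚ.<⇒≤ 7≤d
    member : suc μ ∈ candidates
    member = decidable-stable (suc μ ∈? candidates) (λ p →
      some-divisible 6 6≤d bal₆ (ℕₚ.m≤m+n 5 1)
        -- Integrality of λ₇ and of λ₆ strikes out the first two alternatives of `excluded₇`; the
        -- remaining one denies every weight that is 4 mod 8.
        (resolve (above-divides 7 7≤d bal₇ 1 ℕₚ.≤-refl)
          (resolve (above-divides 7 7≤d bal₇ 0 (ℕₚ.m≤m+n 6 1)) (verdict-∉ n d (lam 5) μ p (judged μ<153)))))
    not-eight : ¬ IsTDesign C d 8
    not-eight design₈ = some-divisible 8 8≤d bal₈ (ℕₚ.m≤m+n 5 3)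
      (resolve (above-divides 8 8≤d bal₈ 2 ℕₚ.≤-refl) (verdict-∈ n d (lam 5) μ member (judged μ<153)))
      where
      bal₈ : ∀ j → j ≤ 8 → Balanced j
      bal₈ = balanced-below 8 8≤d (design⇒balanced 8 design₈)

theorem1 : (m : ℕ) → 1 ≤ m → m ≤ 153 → (C : Code (24 * m)) → IsExtremal m C →
    Σ ℕ (λ t → (6 ≤ t) × IsTDesign C (4 * m + 4) t) →
    IsTDesign C (4 * m + 4) 7 ×
    (m ∈ (15 ∷ 52 ∷ 55 ∷ 57 ∷ 59 ∷ 60 ∷ 63 ∷ 90 ∷ 93 ∷ 104 ∷ 105 ∷ 107 ∷ 118 ∷ 125 ∷ 127 ∷ 135 ∷ 143 ∷ 151 ∷ [])) ×
    ¬ IsTDesign C (4 * m + 4) 8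
theorem1 (suc μ) _ m≤153 C (linear , self-dual , doubly-even , dimension , min-weight) (t , 6≤t , design) =
  conclusion μ (24 * suc μ) (4 * suc μ + 4) (ℕₚ.*-comm 24 (suc μ))
      (trans (ℕₚ.+-comm (4 * suc μ) 4) (cong (λ k → 4 + k) (ℕₚ.*-comm 4 (suc μ)))) C
    linear self-dual doubly-even dimension min-weight m≤153 t 6≤t design
  where open Numerics
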